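{- There is an FPTAS for budget-restrained makespan minimization (given a budget $b$, minimize the makespan among valid schedules with cost at most $b$) in Server Cloud Scheduling on extended chain task graphs, provided that for every parallel subgraph $\mathcal{J}_e$ inserted in place of a chain edge $e=(j-1,j)$ at least one of the following holds: (1) $\min_{j'\in\mathcal{J}_e}\min\{p_s(j'),p_c(j')\}\ge\max_{j'\in\mathcal{J}_e}\max\{c(j-1,j'),c(j',j)\}$; (2) $c(j-1,j')\le c_{\max}$ and $c(j',j)\le c_{\max}$ for all $j'\in\mathcal{J}_e$, where $c_{\max}$ is a fixed constant; (3) $c(j-1,j')=c(j-1,j'')$ for all $j',j''\in\mathcal{J}_e$.
   Context: Server Cloud Scheduling: the input is a directed acyclic task graph $G=(\mathcal{J},E)$ with exactly one source $s$ and one sink $t$; each job $j\in\mathcal{J}$ has a server processing time $p_s(j)\in\mathbb{N}_0$ and a cloud processing time $p_c(j)\in\mathbb{N}_0$, where $p_s(s)=p_s(t)=0$ and $p_c(s)=p_c(t)=\infty$; each edge $(i,j)\in E$ has a communication delay $c(i,j)\in\mathbb{N}_0$. There is one server machine (processing at most one job at a time) and unboundedly many cloud machines. A schedule is a partition $\mathcal{J}=\mathcal{J}_s\cup\mathcal{J}_c$ together with completion times $C:\mathcal{J}\to\mathbb{N}_0$; let $p_\pi(j)=p_s(j)$ if $j\in\mathcal{J}_s$ and $p_\pi(j)=p_c(j)$ if $j\in\mathcal{J}_c$. It is valid if (a) for distinct $i,j\in\mathcal{J}_s$: $C(i)\le C(j)-p_\pi(j)$ or $C(i)-p_\pi(i)\ge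 C(j)$; (b) for every edge $(i,j)$ with $i,j$ on the same side: $C(i)\le C(j)-p_\pi(j)$, and for every edge with $i,j$ on different sides: $C(i)+c(i,j)\le C(j)-p_\pi(j)$. The makespan is $C(t)$ and the cost is $\sum_{j\in\mathcal{J}_c}p_c(j)$. Extended chain: start from a chain $s=0\to1\to\dots\to n\to n+1=t$; for any subset of the chain edges $e=(j-1,j)$, remove the edge, add a set $\mathcal{J}_e$ of new jobs (the parallel subgraph of $e$), and for each $j'\in\mathcal{J}_e$ add edges $(j-1,j')$ and $(j',j)$. -}

module Defs where

open import Axiom.UniquenessOfIdentityProofs.WithK using (uip)
open import Data.Empty using (⊥-elim)
open import Data.Fin.Base using (Fin; zero; suc; fromℕ; inject₁; toℕ)
open import Data.Fin.Properties using (toℕ-inject₁; inject₁-injective; fromℕ≢inject₁)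
open import Data.Fin.Relation.Unary.Top using (view; ‵fromℕ; ‵inject₁)
open import Data.Integer.Base as ℤ using (∣_∣)
open import Data.List.Base as List
  using (List; []; _∷_; _++_; length; allFin; concatMap; foldr; lookup)
open import Data.List.Membership.Propositional using (_∈_)
open import Data.List.Membership.Propositional.Properties
  using (∈-++⁺ˡ; ∈-++⁺ʳ; ∈-allFin; ∈-map⁺; ∈-map⁻; ∈-concat⁺′; ∈-concat⁻′)
open import Data.List.NonEmpty.Base as List⁺ using (List⁺; _∷_; foldr₁)
open import Data.List.Relation.Binary.Disjoint.Propositional using (Disjoint)
open import Data.List.Relation.Unary.All as All using ()
import Data.List.Relation.Unary.All.Properties as All
open import Data.List.Relation.Unary.AllPairs as AllPairs using ([]; _∷_)
import Data.List.Relation.Unary.AllPairs.Properties as AllPairs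
open import Data.List.Relation.Unary.Any using (here; there)
open import Data.List.Relation.Unary.Unique.Propositional using (Unique)
import Data.List.Relation.Unary.Unique.Propositional.Properties as Unique
open import Data.Maybe.Base using (zipWith)
open import Data.Nat.Base hiding (NonZero)
open import Data.Nat.Logarithm using (⌊log₂_⌋)
open import Data.Nat.Properties
  using (≤-refl; ≤-reflexive; <-trans; <-irrefl; n<1+n; +-suc)
open import Data.Product using (∃-syntax; Σ-syntax; _×_; _,_)
open import Data.Rational.Base as ℚ using (ℚ; Positive; 1ℚ; ceiling; ↥_; ↧ₙ_)
open import Data.Rational.Properties using (pos⇒nonZero)
open import Data.Sum.Base using (_⊎_; inj₁; inj₂)
open import Data.Unit.Base using (⊤; tt)
open import Data.Vec.Base as Vec using (Vec; []; _∷_; _∷ʳ_)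
open import Function.Base using (_∘_)
open import Function.Bundles using (_⇔_; mk⇔)
open import Relation.Binary.Construct.Add.Supremum.NonStrict (_≤_) using (_≤⁺_)
open import Relation.Binary.Construct.Closure.Transitive using (TransClosure; [_]; _∷_)
open import Relation.Binary.Definitions using (Irrelevant)
open import Relation.Binary.PropositionalEquality
  using (_≡_; _≢_; refl; sym; trans; cong; subst₂)
open import Relation.Nullary.Construct.Add.Supremum using (_⁺; ⊤⁺) renaming ([_] to ⌜_⌝)
open import Relation.Nullary.Negation.Core using (¬_)

------------------------------------------------------------------------
-- Model of computation

-- A deterministic first-order language over finite data, with unbounded
-- iteration.  Constructors, projections and tests are constant-time
-- pointer operations; arithmetic is charged the bit lengths of its
-- operands (logarithmic cost criterion).  Every result of arithmetic is
-- at most as long as its charge (up to a constant), so that, once the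
-- length of the output is added to the cost, time is polynomially related
-- to time on a Turing machine, in both directions.

infixr 2 _⊗_
infixr 1 _⊕_

data Ty : Set where
  unit nat : Ty
  _⊗_ _⊕_  : Ty → Ty → Ty
  list     : Ty → Ty

⟦_⟧ : Ty → Set
⟦ unit ⟧   = ⊤
⟦ nat ⟧    = ℕ
⟦ σ ⊗ τ ⟧  = ⟦ σ ⟧ × ⟦ τ ⟧
⟦ σ ⊕ τ ⟧  = ⟦ σ ⟧ ⊎ ⟦ τ ⟧
⟦ list σ ⟧ = List ⟦ σ ⟧

bits : ℕ → ℕ
bits n = suc ⌊log₂ n ⌋

size : ∀ τ → ⟦ τ ⟧ → ℕ
size unit     _        = 1
size nat      n        = bits n
size (σ ⊗ τ)  (x , y)  = suc (size σ x + size τ y)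
size (σ ⊕ τ)  (inj₁ x) = suc (size σ x)
size (σ ⊕ τ)  (inj₂ y) = suc (size τ y)
size (list σ) xs       = suc (foldr (λ x n → suc (size σ x + n)) 0 xs)

data ArithOp : Set where
  add monus mul quot : ArithOp

arith : ArithOp → ℕ → ℕ → ℕ
arith add   m n       = m + n
arith monus m n       = m ∸ n
arith mul   m n       = m * n
arith quot  m zero    = 0
arith quot  m (suc n) = m / suc n

infixr 9 _⨾_

data Prog : Ty → Ty → Set where
  idp     : ∀ {σ} → Prog σ σ
  _⨾_     : ∀ {ρ σ τ} → Prog ρ σ → Prog σ τ → Prog ρ τ
  pair    : ∀ {ρ σ τ} → Prog ρ σ → Prog ρ τ → Prog ρ (σ ⊗ τ)
  fst     : ∀ {σ τ} → Prog (σ ⊗ τ) σ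
  snd     : ∀ {σ τ} → Prog (σ ⊗ τ) τ
  bang    : ∀ {σ} → Prog σ unit
  inl     : ∀ {σ τ} → Prog σ (σ ⊕ τ)
  inr     : ∀ {σ τ} → Prog τ (σ ⊕ τ)
  branch  : ∀ {σ σ′ ρ τ} → Prog (σ ⊗ ρ) τ → Prog (σ′ ⊗ ρ) τ → Prog ((σ ⊕ σ′) ⊗ ρ) τ
  nil     : ∀ {σ τ} → Prog σ (list τ)
  cons    : ∀ {σ} → Prog (σ ⊗ list σ) (list σ)
  uncons  : ∀ {σ} → Prog (list σ) (unit ⊕ (σ ⊗ list σ))
  literal : ∀ {σ} → ℕ → Prog σ nat
  op      : ArithOp → Prog (nat ⊗ nat) nat
  isZero  : Prog nat (unit ⊕ unit)
  -- Repeat the body on its left results until it returns a right one.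
  iterate : ∀ {σ τ} → Prog σ (σ ⊕ τ) → Prog σ τ

infix 4 _·_⇓_∣_

-- p · x ⇓ y ∣ c : on input x, program p halts with output y at cost c.
data _·_⇓_∣_ : ∀ {σ τ} → Prog σ τ → ⟦ σ ⟧ → ⟦ τ ⟧ → ℕ → Set where
  idp      : ∀ {σ x} → idp {σ} · x ⇓ x ∣ 1
  _⨾_      : ∀ {ρ σ τ} {p : Prog ρ σ} {q : Prog σ τ} {x y z a b} →
             p · x ⇓ y ∣ a → q · y ⇓ z ∣ b → p ⨾ q · x ⇓ z ∣ suc (a + b)
  pair     : ∀ {ρ σ τ} {p : Prog ρ σ} {q : Prog ρ τ} {x y z a b} →
             p · x ⇓ y ∣ a → q · x ⇓ z ∣ b → pair p q · x ⇓ (y , z) ∣ suc (a + b)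
  fst      : ∀ {σ τ x y} → fst {σ} {τ} · (x , y) ⇓ x ∣ 1
  snd      : ∀ {σ τ x y} → snd {σ} {τ} · (x , y) ⇓ y ∣ 1
  bang     : ∀ {σ x} → bang {σ} · x ⇓ tt ∣ 1
  inl      : ∀ {σ τ x} → inl {σ} {τ} · x ⇓ inj₁ x ∣ 1
  inr      : ∀ {σ τ y} → inr {σ} {τ} · y ⇓ inj₂ y ∣ 1
  branch₁  : ∀ {σ σ′ ρ τ} {p : Prog (σ ⊗ ρ) τ} {q : Prog (σ′ ⊗ ρ) τ} {x r z a} →
             p · (x , r) ⇓ z ∣ a → branch p q · (inj₁ x , r) ⇓ z ∣ suc a
  branch₂  : ∀ {σ σ′ ρ τ} {p : Prog (σ ⊗ ρ) τ} {q : Prog (σ′ ⊗ ρ) τ} {y r z a} →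
             q · (y , r) ⇓ z ∣ a → branch p q · (inj₂ y , r) ⇓ z ∣ suc a
  nil      : ∀ {σ τ x} → nil {σ} {τ} · x ⇓ [] ∣ 1
  cons     : ∀ {σ x xs} → cons {σ} · (x , xs) ⇓ x ∷ xs ∣ 1
  uncons[] : ∀ {σ} → uncons {σ} · [] ⇓ inj₁ tt ∣ 1
  uncons∷  : ∀ {σ x xs} → uncons {σ} · (x ∷ xs) ⇓ inj₂ (x , xs) ∣ 1
  literal  : ∀ {σ x n} → literal {σ} n · x ⇓ n ∣ 1
  op       : ∀ {o m n} → op o · (m , n) ⇓ arith o m n ∣ suc (bits m + bits n)
  isZero₀  : isZero · 0 ⇓ inj₁ tt ∣ 1
  isZero₊  : ∀ {n} → isZero · suc n ⇓ inj₂ tt ∣ 1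
  again    : ∀ {σ τ} {p : Prog σ (σ ⊕ τ)} {x x′ y a b} →
             p · x ⇓ inj₁ x′ ∣ a → iterate p · x′ ⇓ y ∣ b → iterate p · x ⇓ y ∣ suc (a + b)
  done     : ∀ {σ τ} {p : Prog σ (σ ⊕ τ)} {x y a} →
             p · x ⇓ inj₂ y ∣ a → iterate p · x ⇓ y ∣ suc a

infix 4 _·_⇓_within_

-- Writing out the output is part of the running time: the value may share
-- subterms, so its size is not bounded by the cost.
_·_⇓_within_ : ∀ {σ τ} → Prog σ τ → ⟦ σ ⟧ → ⟦ τ ⟧ → ℕ → Set
_·_⇓_within_ {τ = τ} p x y t = ∃[ c ] (p · x ⇓ y ∣ c) × c + size τ y ≤ t

------------------------------------------------------------------------
-- Approximation schemes

record MinimizationProblem : Set₁ where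
  field
    Instance       : Set
    Solution       : Instance → Set
    objective      : ∀ x → Solution x → ℕ
    InputTy        : Ty
    OutputTy       : Ty
    encode         : Instance → ⟦ InputTy ⟧
    encodeSolution : ∀ x → Solution x → ⟦ OutputTy ⟧

⌈1/_⌉ : (ε : ℚ) → .{{Positive ε}} → ℕ
⌈1/ ε ⌉ = ∣ ceiling ((ℚ.1/ ε) {{pos⇒nonZero ε}}) ∣

fromℕℚ : ℕ → ℚ
fromℕℚ n = ℤ.+ n ℚ./ 1

-- The accuracy ε is part of the input, as numerator and denominator.
record FPTAS (P : MinimizationProblem) : Set where
  open MinimizationProblem P

  SchemeTy : Ty
  SchemeTy = InputTy ⊗ (nat ⊗ nat)

  schemeInput : Instance → ℚ → ⟦ SchemeTy ⟧
  schemeInput x ε = encode x , (∣ ↥ ε ∣ , ↧ₙ ε)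

  field
    program     : Prog SchemeTy OutputTy
    coefficient : ℕ
    degree      : ℕ

  timeBound : Instance → (ε : ℚ) → .{{Positive ε}} → ℕ
  timeBound x ε = coefficient * (size SchemeTy (schemeInput x ε) + ⌈1/ ε ⌉) ^ degree

  field
    approximates : ∀ (x : Instance) (ε : ℚ) .{{_ : Positive ε}} →
      Σ[ y ∈ Solution x ]
        (program · schemeInput x ε ⇓ encodeSolution x y within timeBound x ε)
        × (∀ (z : Solution x) →
             fromℕℚ (objective x y) ℚ.≤ (1ℚ ℚ.+ ε) ℚ.* fromℕℚ (objective x z))

------------------------------------------------------------------------
-- Server Cloud Scheduling

ℕ∞ : Set
ℕ∞ = ℕ ⁺

infixl 6 _+∞_

_+∞_ : ℕ∞ → ℕ∞ → ℕ∞
_+∞_ = zipWith _+_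

record TaskGraph : Set₁ where
  infix 4 _⟶_
  field
    Job           : Set
    jobs          : List Job
    jobs-unique   : Unique jobs
    jobs-complete : ∀ j → j ∈ jobs

    _⟶_           : Job → Job → Set
    ⟶-irrelevant  : Irrelevant _⟶_
    acyclic       : ∀ {j} → ¬ TransClosure _⟶_ j j

    s t           : Job
    source        : ∀ j → (∀ i → ¬ i ⟶ j) ⇔ (j ≡ s)
    sink          : ∀ i → (∀ j → ¬ i ⟶ j) ⇔ (i ≡ t)

    ps            : Job → ℕ
    pc            : Job → ℕ∞
    ps-s          : ps s ≡ 0
    ps-t          : ps t ≡ 0
    pc-infinite   : ∀ j → (pc j ≡ ⊤⁺) ⇔ (j ≡ s ⊎ j ≡ t)

    delay         : ∀ {i j} → i ⟶ j → ℕ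

data Side : Set where
  server cloud : Side

module _ (G : TaskGraph) where
  open TaskGraph G

  record Schedule : Set where
    field
      side       : Job → Side
      completion : Job → ℕ

module _ {G : TaskGraph} (π : Schedule G) where
  open TaskGraph G
  open Schedule π

  processing : Job → ℕ∞
  processing j with side j
  ... | server = ⌜ ps j ⌝
  ... | cloud  = pc j

  -- d ≤ C(j) − p(j), with the subtraction moved to the left so that it is
  -- not truncated.
  StartsAfter : ℕ → Job → Set
  StartsAfter d j = ⌜ d ⌝ +∞ processing j ≤⁺ ⌜ completion j ⌝

  record Valid : Set where
    field
      server-exclusive : ∀ {i j} → i ≢ j → side i ≡ server → side j ≡ server →
        StartsAfter (completion i) j ⊎ StartsAfter (completion j) i
      same-side        : ∀ {i j} → i ⟶ j → side i ≡ side j →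
        StartsAfter (completion i) j
      different-side   : ∀ {i j} (e : i ⟶ j) → side i ≢ side j →
        StartsAfter (completion i + delay e) j

  makespan : ℕ
  makespan = completion t

  cloudCost : Job → ℕ∞
  cloudCost j with side j
  ... | server = ⌜ 0 ⌝
  ... | cloud  = pc j

  cost : ℕ∞
  cost = foldr (λ j c → cloudCost j +∞ c) ⌜ 0 ⌝ jobs

------------------------------------------------------------------------
-- Extended chains

record ChainJob : Set where
  constructor chainJob
  field ps pc : ℕ

-- A job j′ of a parallel subgraph, with its delays c(j-1,j′) and c(j′,j).
record ParallelJob : Set where
  constructor parallelJob
  field ps pc cᵢₙ cₒᵤₜ : ℕ

-- What connects j-1 to j: the chain edge, or a parallel subgraph replacing
-- it (nonempty, as otherwise there would be several sources).
data Link : Set where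
  edge     : (c : ℕ) → Link
  parallel : List⁺ ParallelJob → Link

parallelJobs : Link → List ParallelJob
parallelJobs (edge _)      = []
parallelJobs (parallel js) = List⁺.toList js

-- links at position k joins chain jobs k and k+1; inner holds jobs 1, …, n.
record ExtendedChain : Set where
  field
    n     : ℕ
    inner : Vec ChainJob n
    links : Vec Link (suc n)

module Chain (X : ExtendedChain) where
  open ExtendedChain X

  link : Fin (suc n) → Link
  link = Vec.lookup links

  data Job : Set where
    chain : Fin (2 + n) → Job
    par   : (k : Fin (suc n)) → Fin (length (parallelJobs (link k))) → Job

  parJob : ∀ k → Fin (length (parallelJobs (link k))) → ParallelJob
  parJob k = lookup (parallelJobs (link k))

  infix 4 _⟶_

  data _⟶_ : Job → Job → Set where
    direct : ∀ k {c} → link k ≡ edge c → chain (inject₁ k) ⟶ chain (suc k)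
    fork   : ∀ k i → chain (inject₁ k) ⟶ par k i
    join   : ∀ k i → par k i ⟶ chain (suc k)

  delay : ∀ {i j} → i ⟶ j → ℕ
  delay (direct k {c} _) = c
  delay (fork k i)       = ParallelJob.cᵢₙ (parJob k i)
  delay (join k i)       = ParallelJob.cₒᵤₜ (parJob k i)

  s t : Job
  s = chain zero
  t = chain (fromℕ (suc n))

  ps : Job → ℕ
  ps (chain k) = Vec.lookup (0 ∷ (Vec.map ChainJob.ps inner ∷ʳ 0)) k
  ps (par k i) = ParallelJob.ps (parJob k i)

  pc : Job → ℕ∞
  pc (chain k) = Vec.lookup (⊤⁺ ∷ (Vec.map (λ j → ⌜ ChainJob.pc j ⌝) inner ∷ʳ ⊤⁺)) k
  pc (par k i) = ⌜ ParallelJob.pc (parJob k i) ⌝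

  stage : Fin (suc n) → List Job
  stage k = chain (inject₁ k) ∷ List.map (par k) (allFin _)

  jobs : List Job
  jobs = concatMap stage (allFin (suc n)) ++ (t ∷ [])

  chain-injective : ∀ {a b} → chain a ≡ chain b → a ≡ b
  chain-injective refl = refl

  private
    t∉stage : ∀ k → ¬ t ∈ stage k
    t∉stage k (here eq) = fromℕ≢inject₁ (chain-injective eq)
    t∉stage k (there t∈) with ∈-map⁻ (par k) t∈
    ... | _ , _ , ()

    index : ∀ {j k} → j ∈ stage k → ∀ {l} → j ∈ stage l → k ≡ l
    index {k = k} (here refl) {l} (here eq) = inject₁-injective (chain-injective eq)
    index {k = k} (here refl) {l} (there j∈) with ∈-map⁻ (par l) j∈
    ... | _ , _ , ()
    index {k = k} (there j∈) {l} (here refl) with ∈-map⁻ (par k) j∈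
    ... | _ , _ , ()
    index {k = k} (there j∈) {l} (there j∈′) with ∈-map⁻ (par k) j∈ | ∈-map⁻ (par l) j∈′
    ... | _ , _ , refl | _ , _ , refl = refl

    stages-disjoint : ∀ {k l} → k ≢ l → Disjoint (stage k) (stage l)
    stages-disjoint k≢l (j∈k , j∈l) = k≢l (index j∈k j∈l)

    stage-unique : ∀ k → Unique (stage k)
    stage-unique k =
      All.map⁺ (All.universal (λ _ ()) (allFin _))
      ∷ Unique.map⁺ (λ { refl → refl }) (Unique.allFin⁺ _)

  jobs-unique : Unique jobs
  jobs-unique = Unique.++⁺
    (Unique.concat⁺
      (All.map⁺ (All.universal stage-unique (allFin _)))
      (AllPairs.map⁺ (AllPairs.map stages-disjoint (Unique.allFin⁺ _))))
    (All.[] ∷ [])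
    λ { (t∈ , here refl) → notIn t∈ }
    where
    notIn : ¬ t ∈ concatMap stage (allFin (suc n))
    notIn t∈ with ∈-concat⁻′ (List.map stage (allFin (suc n))) t∈
    ... | xs , t∈xs , xs∈ with ∈-map⁻ stage xs∈
    ... | k , _ , refl = t∉stage k t∈xs

  private
    ∈-stage : ∀ {j} k → j ∈ stage k → j ∈ jobs
    ∈-stage k j∈ = ∈-++⁺ˡ (∈-concat⁺′ j∈ (∈-map⁺ stage (∈-allFin k)))

  jobs-complete : ∀ j → j ∈ jobs
  jobs-complete (chain k) with view k
  ... | ‵fromℕ     = ∈-++⁺ʳ (concatMap stage (allFin (suc n))) (here refl)
  ... | ‵inject₁ l = ∈-stage l (here refl)
  jobs-complete (par k i) = ∈-stage k (there (∈-map⁺ (par k) (∈-allFin i)))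

  ⟶-irrelevant : Irrelevant _⟶_
  ⟶-irrelevant e f = unique e f refl refl
    where
    unique : ∀ {i j i′ j′} (e : i ⟶ j) (f : i′ ⟶ j′) (p : i ≡ i′) (q : j ≡ j′) →
             subst₂ _⟶_ p q e ≡ f
    unique (direct k x) (direct k y) p refl with trans (sym x) y
    unique (direct k x) (direct k y) refl refl | refl = cong (direct k) (uip x y)
    unique (fork k i) (fork k i) refl refl = refl
    unique (join k i) (join k i) refl refl = refl

  private
    rank : Job → ℕ
    rank (chain k) = 2 * toℕ k
    rank (par k _) = suc (2 * toℕ k)

    2k<2sk : ∀ m → suc (2 * m) < 2 * suc m
    2k<2sk m = ≤-reflexive (cong suc (sym (+-suc m (m + 0))))

    rank-< : ∀ {i j} → i ⟶ j → rank i < rank j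
    rank-< (direct k _) rewrite toℕ-inject₁ k = <-trans (n<1+n _) (2k<2sk (toℕ k))
    rank-< (fork k _)   rewrite toℕ-inject₁ k = ≤-refl
    rank-< (join k _)   = 2k<2sk (toℕ k)

    rank-<⁺ : ∀ {i j} → TransClosure _⟶_ i j → rank i < rank j
    rank-<⁺ [ e ]    = rank-< e
    rank-<⁺ (e ∷ es) = <-trans (rank-< e) (rank-<⁺ es)

    edge⊎parallel : ∀ l → (∃[ c ] l ≡ edge c) ⊎ Fin (length (parallelJobs l))
    edge⊎parallel (edge c)            = inj₁ (c , refl)
    edge⊎parallel (parallel (_ ∷ _)) = inj₂ zero

  acyclic : ∀ {j} → ¬ TransClosure _⟶_ j j
  acyclic es = <-irrefl refl (rank-<⁺ es)

  source : ∀ j → (∀ i → ¬ i ⟶ j) ⇔ (j ≡ s)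
  source j = mk⇔ (to j) (λ { refl i () })
    where
    to : ∀ j → (∀ i → ¬ i ⟶ j) → j ≡ s
    to (chain zero)    no = refl
    to (chain (suc k)) no with edge⊎parallel (link k)
    ... | inj₁ (_ , eq) = ⊥-elim (no _ (direct k eq))
    ... | inj₂ i        = ⊥-elim (no _ (join k i))
    to (par k i)       no = ⊥-elim (no _ (fork k i))

  sink : ∀ i → (∀ j → ¬ i ⟶ j) ⇔ (i ≡ t)
  sink i = mk⇔ (to i) (λ { refl j e → from e refl })
    where
    to : ∀ i → (∀ j → ¬ i ⟶ j) → i ≡ t
    to (chain k) no with view k
    ... | ‵fromℕ     = refl
    ... | ‵inject₁ l with edge⊎parallel (link l)
    ...   | inj₁ (_ , eq) = ⊥-elim (no _ (direct l eq))
    ...   | inj₂ i        = ⊥-elim (no _ (fork l i))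
    to (par k i) no = ⊥-elim (no _ (join k i))

    from : ∀ {i j} → i ⟶ j → i ≢ t
    from (direct k _) eq = fromℕ≢inject₁ (sym (chain-injective eq))
    from (fork k _)   eq = fromℕ≢inject₁ (sym (chain-injective eq))

  private
    lookup-last : ∀ {A : Set} {m} (xs : Vec A m) x → Vec.lookup (xs ∷ʳ x) (fromℕ m) ≡ x
    lookup-last []       x = refl
    lookup-last (_ ∷ xs) x = lookup-last xs x

    finite : ∀ {m} (xs : Vec ChainJob m) k →
             Vec.lookup (Vec.map (λ j → ⌜ ChainJob.pc j ⌝) xs ∷ʳ ⊤⁺) k ≡ ⊤⁺ → k ≡ fromℕ m
    finite []       zero    _  = refl
    finite (_ ∷ xs) (suc k) eq = cong suc (finite xs k eq)

  ps-t : ps t ≡ 0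
  ps-t = lookup-last (Vec.map ChainJob.ps inner) 0

  pc-infinite : ∀ j → (pc j ≡ ⊤⁺) ⇔ (j ≡ s ⊎ j ≡ t)
  pc-infinite j = mk⇔ (to j) (λ { (inj₁ refl) → refl ; (inj₂ refl) → lookup-last (Vec.map _ inner) ⊤⁺ })
    where
    to : ∀ j → pc j ≡ ⊤⁺ → j ≡ s ⊎ j ≡ t
    to (chain zero)    _  = inj₁ refl
    to (chain (suc k)) eq = inj₂ (cong (chain ∘ suc) (finite inner k eq))

taskGraph : ExtendedChain → TaskGraph
taskGraph X = record { Chain X ; ps-s = refl }

------------------------------------------------------------------------
-- Conditions on parallel subgraphs

module _ (js : List⁺ ParallelJob) where
  open ParallelJob

  ProcessingDominatesDelay : Set
  ProcessingDominatesDelay =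
    foldr₁ _⊓_ (List⁺.map (λ j → ps j ⊓ pc j) js) ≥ foldr₁ _⊔_ (List⁺.map (λ j → cᵢₙ j ⊔ cₒᵤₜ j) js)

  DelaysAtMost : ℕ → Set
  DelaysAtMost cmax = ∀ {j} → j ∈ List⁺.toList js → cᵢₙ j ≤ cmax × cₒᵤₜ j ≤ cmax

  EqualInDelays : Set
  EqualInDelays = ∀ {i j} → i ∈ List⁺.toList js → j ∈ List⁺.toList js → cᵢₙ i ≡ cᵢₙ j

Admissible : ℕ → ExtendedChain → Set
Admissible cmax X = ∀ k {js} → Vec.lookup links k ≡ parallel js →
  ProcessingDominatesDelay js ⊎ DelaysAtMost js cmax ⊎ EqualInDelays js
  where open ExtendedChain X

------------------------------------------------------------------------
-- Budget-restrained makespan minimization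

ChainJobTy ParallelJobTy LinkTy ChainTy SideTy : Ty
ChainJobTy    = nat ⊗ nat
ParallelJobTy = (nat ⊗ nat) ⊗ (nat ⊗ nat)
LinkTy        = nat ⊕ (ParallelJobTy ⊗ list ParallelJobTy)
ChainTy       = list ChainJobTy ⊗ list LinkTy
SideTy        = unit ⊕ unit

encodeChainJob : ChainJob → ⟦ ChainJobTy ⟧
encodeChainJob (chainJob ps pc) = ps , pc

encodeParallelJob : ParallelJob → ⟦ ParallelJobTy ⟧
encodeParallelJob (parallelJob ps pc cᵢₙ cₒᵤₜ) = (ps , pc) , (cᵢₙ , cₒᵤₜ)

encodeLink : Link → ⟦ LinkTy ⟧
encodeLink (edge c)            = inj₁ c
encodeLink (parallel (j ∷ js)) = inj₂ (encodeParallelJob j , List.map encodeParallelJob js)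

encodeChain : ExtendedChain → ⟦ ChainTy ⟧
encodeChain X = List.map encodeChainJob (Vec.toList inner) , List.map encodeLink (Vec.toList links)
  where open ExtendedChain X

encodeSide : Side → ⟦ SideTy ⟧
encodeSide server = inj₁ tt
encodeSide cloud  = inj₂ tt

encodeSchedule : ∀ G → Schedule G → ⟦ list (SideTy ⊗ nat) ⟧
encodeSchedule G π = List.map (λ j → encodeSide (side j) , completion j) (TaskGraph.jobs G)
  where open Schedule π

record BudgetInstance (cmax : ℕ) : Set where
  field
    extendedChain : ExtendedChain
    budget        : ℕ
    admissible    : Admissible cmax extendedChain

record BudgetSchedule (G : TaskGraph) (b : ℕ) : Set where
  field
    schedule     : Schedule G
    valid        : Valid schedule
    withinBudget : cost schedule ≤⁺ ⌜ b ⌝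

BudgetMakespan : ℕ → MinimizationProblem
BudgetMakespan cmax = record
  { Instance       = BudgetInstance cmax
  ; Solution       = λ I → BudgetSchedule (taskGraph (extendedChain I)) (budget I)
  ; objective      = λ _ → makespan ∘ schedule
  ; InputTy        = ChainTy ⊗ nat
  ; OutputTy       = list (SideTy ⊗ nat)
  ; encode         = λ I → encodeChain (extendedChain I) , budget I
  ; encodeSolution = λ _ → encodeSchedule _ ∘ schedule
  }
  where
  open BudgetInstance
  open BudgetSchedule

{-# OPTIONS --safe #-}

-- Divide all times by a scale δ and round up.  A schedule of the rounded
-- instance, multiplied by δ, is a schedule of the given one; conversely rounding
-- prolongs a schedule by at most W steps, where W is linear in the number of
-- jobs, since every server job delays the jobs behind it by at most one step.
-- Hence, at the first δ = 1, 2, 4, … at which the optimum survives rounding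
-- within the horizon M = W + 2 (W + 1) ⌈1/ε⌉, the error δ (W + 1) is at most ε
-- times the optimum (and there is none if δ = 1).
--
-- For makespans up to M the rounded instance is solved exactly, by cheapest
-- paths in layered graphs.  The outer one goes through the chain backwards, with
-- the side and the starting time of a chain job as state.  The inner one goes
-- through the jobs of one link, with the load of the server as state: by release
-- time if the next chain job is on the server, by Jackson's rule (longest tail
-- first) otherwise.  Release times and tails compete only between two chain jobs
-- on the cloud.  Then Jackson's rule is optimal for the jobs after a certain
-- time, and under each condition few intervals are needed for those before:
-- none under (3), that of the first job under (1), and under (2) at most two for
-- each starting time below cmax (one of length 0, one longer).  These slots are
-- guessed.
module Submission where

open import Defs
open import Data.Bool.Base using (Bool; true; false)
open import Data.Empty using (⊥; ⊥-elim)
open import Data.Fin.Base using (Fin; zero; suc; fromℕ; inject₁; toℕ)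
open import Data.Fin.Properties using (any?; toℕ<n; toℕ-injective; toℕ-inject₁) renaming (_≟_ to _≟ᶠ_)
open import Data.Integer.Base as ℤ using (-[1+_]; +[1+_]; ∣_∣)
import Data.Integer.DivMod as ℤ
import Data.Integer.Properties as ℤ
open import Data.List.Base as List
  using (List; []; _∷_; _++_; length; foldr; foldl; map; concatMap; _ʳ++_; reverse; allFin; tabulate; upTo)
open import Data.List.Membership.Propositional using (_∈_; _∉_; find; lose)
open import Data.List.Membership.Propositional.Properties
  using (∈-++⁺ˡ; ∈-++⁺ʳ; ∈-++⁻; ∈-map⁺; ∈-map⁻; ∈-allFin; ∈-upTo⁺; ∈-upTo⁻; ∈-lookup)
open import Data.List.NonEmpty.Base as List⁺ using (List⁺; _∷_; foldr₁)
open import Data.List.Properties hiding (sum-++)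
open import Data.List.Relation.Binary.Permutation.Propositional using (_↭_; prep; ↭-refl; ↭-trans; ↭-sym; ↭⇒↭ₛ)
open import Data.List.Relation.Binary.Permutation.Propositional.Properties using (shift; map⁺; ↭-map-inv; ∈-resp-↭)
open import Data.List.Relation.Binary.Permutation.Setoid.Properties using (AllPairs-resp-↭)
open import Data.List.Relation.Binary.Pointwise using (Pointwise; []; _∷_)
open import Data.List.Relation.Unary.All as All using (All; []; _∷_)
import Data.List.Relation.Unary.All.Properties as All
open import Data.List.Relation.Unary.AllPairs as AllPairs using (AllPairs; []; _∷_)
import Data.List.Relation.Unary.AllPairs.Properties as AllPairs
open import Data.List.Relation.Unary.Any as Any using (Any; here; there)
import Data.List.Relation.Unary.Any.Properties as Any
open import Data.List.Relation.Unary.Unique.Propositional using (Unique)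
open import Data.List.Relation.Unary.Unique.Propositional.Properties using (allFin⁺)
open import Data.Maybe.Base using (fromMaybe)
open import Data.Nat.Base hiding (NonZero)
open import Data.Nat.DivMod
  using (m/n≤m; /-monoˡ-≤; m<n⇒m/n≡0; m≡m%n+[m/n]*n; m%n<n; m<n*o⇒m/o<n; m/n*n≤m; n/1≡n; +-distrib-/-∣ˡ)
open import Data.Nat.Divisibility using (divides)
open import Data.Nat.Induction using (<-rec)
open import Data.Nat.ListAction using (sum)
open import Data.Nat.ListAction.Properties using (sum-↭; sum-++)
open import Data.Nat.Logarithm
open import Data.Nat.Properties
open import Data.Nat.Tactic.RingSolver using (solve-∀)
open import Data.Product using (∃-syntax; Σ-syntax; _×_; _,_; proj₁; proj₂)
open import Data.Rational.Base as ℚ using (ℚ; mkℚ; 1ℚ; Positive; ↥_; ↧ₙ_; toℚᵘ)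
import Data.Rational.Properties as ℚ
open import Data.Rational.Unnormalised.Base as ℚᵘ using (mkℚᵘ; 1ℚᵘ)
import Data.Rational.Unnormalised.Properties as ℚᵘ
open import Data.Sum.Base as Sum using (_⊎_; inj₁; inj₂; [_,_]′; swap)
open import Data.Unit.Base using (⊤; tt)
open import Data.Vec.Base as Vec using (Vec; []; _∷_; _∷ʳ_)
open import Data.Vec.Properties using (lookup-map; toList-map)
open import Function.Base using (_∘_; id)
open import Function.Bundles using (Equivalence)
open import Relation.Binary.Construct.Add.Supremum.NonStrict (_≤_) using (_≤⁺_)
import Relation.Binary.Construct.Add.Supremum.NonStrict as NonStrict
open import Relation.Binary.Definitions using (tri<; tri≈; tri>)
open import Relation.Binary.PropositionalEquality
open import Relation.Nullary using (¬_; Dec; yes; no)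
open import Relation.Nullary.Construct.Add.Supremum using (⊤⁺) renaming ([_] to ⌜_⌝)
open import Relation.Nullary.Decidable using (_×-dec_; ¬?)
open import Relation.Unary using (Decidable)

-- Polynomial bounds

-- Time is the state of the dynamic programs and cost their value, so only times are rounded: costs
-- stay exact and the budget is met without slack. As the optimum is unknown, all scales and all
-- makespans within the horizon are tried; the right scale occurs in the analysis alone. The factor
-- 2 in the horizon pays for the step between scales: failure at δ / 2 forces the optimum to be at
-- least δ (W + 1) ⌈1/ε⌉. At the last scale no server processing time exceeds δ, so the schedule
-- entirely on the server has rounded length at most W; it costs nothing, so a candidate exists for
-- every budget. A formal running time meets the obstacle that a polynomial-time step, iterated, may
-- square the size of its state again and again. Every loop therefore carries a bound on all its
-- states: a table is trimmed to an explicit universe, costs are cut at the budget, and a stored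
-- schedule grows by one decision per item. The guessed slots are a list of at most K pairs of times
-- with K depending on `cmax` only, so the universe stays polynomial.

n<2^n : ∀ n → n < 2 ^ n
n<2^n zero    = ≤-refl
n<2^n (suc n) = begin-strict
  suc n           <⟨ s≤s (n<2^n n) ⟩
  suc (2 ^ n)     ≤⟨ +-monoˡ-≤ (2 ^ n) (m^n>0 2 n) ⟩
  2 ^ n + 2 ^ n   ≡⟨ cong (2 ^ n +_) (+-identityʳ (2 ^ n)) ⟨
  2 ^ suc n       ∎
  where open ≤-Reasoning

interchange : ∀ a b c d → a + b + (c + d) ≡ a + c + (b + d)
interchange = solve-∀

-- No leading coefficient: as the base is at least 2, a constant `c` is below `2 ^ c`, and a sum of
-- two powers is absorbed by a larger exponent. The measure is a parameter because the accuracy will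
-- enter the bounds beside the size of the input.
record Poly {A : Set} (m g : A → ℕ) : Set where
  constructor poly
  field
    degree  : ℕ
    bounded : ∀ a → g a ≤ (2 + m a) ^ degree

module _ {A : Set} {m : A → ℕ} where

  poly-mono : ∀ {g h} → (∀ a → g a ≤ h a) → Poly m h → Poly m g
  poly-mono g≤h (poly k b) = poly k λ a → ≤-trans (g≤h a) (b a)

  poly-const : ∀ c → Poly m (λ _ → c)
  poly-const c = poly c λ a → ≤-trans (<⇒≤ (n<2^n c)) (^-monoˡ-≤ c (s≤s (s≤s z≤n)))

  poly-measure : Poly m m
  poly-measure = poly 1 λ a → ≤-trans (m≤n+m (m a) 2) (≤-reflexive (sym (*-identityʳ (2 + m a))))

  poly-* : ∀ {g h} → Poly m g → Poly m h → Poly m (λ a → g a * h a)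
  poly-* (poly k b) (poly l c) = poly (k + l) λ a →
    ≤-trans (*-mono-≤ (b a) (c a)) (≤-reflexive (sym (^-distribˡ-+-* (2 + m a) k l)))

  poly-+ : ∀ {g h} → Poly m g → Poly m h → Poly m (λ a → g a + h a)
  poly-+ {g} {h} (poly k b) (poly l c) = poly (suc (k + l)) λ a → begin
    g a + h a                                 ≤⟨ +-mono-≤ (b a) (c a) ⟩
    (2 + m a) ^ k + (2 + m a) ^ l             ≤⟨ +-mono-≤ (^-monoʳ-≤ (2 + m a) (m≤m+n k l)) (^-monoʳ-≤ (2 + m a) (m≤n+m l k)) ⟩
    (2 + m a) ^ (k + l) + (2 + m a) ^ (k + l) ≡⟨ cong ((2 + m a) ^ (k + l) +_) (+-identityʳ _) ⟨
    2 * (2 + m a) ^ (k + l)                   ≤⟨ *-monoˡ-≤ ((2 + m a) ^ (k + l)) (m≤m+n 2 (m a)) ⟩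
    (2 + m a) ^ suc (k + l)                   ∎
    where open ≤-Reasoning

  poly-suc : ∀ {g} → Poly m g → Poly m (λ a → suc (g a))
  poly-suc = poly-+ (poly-const 1)

  poly-^ : ∀ {g} → Poly m g → ∀ k → Poly m (λ a → g a ^ k)
  poly-^ p zero    = poly-const 1
  poly-^ p (suc k) = poly-* p (poly-^ p k)

-- Sizes

0<size : ∀ τ (x : ⟦ τ ⟧) → 1 ≤ size τ x
0<size unit     _        = ≤-refl
0<size nat      _        = s≤s z≤n
0<size (σ ⊗ τ)  _        = s≤s z≤n
0<size (σ ⊕ τ)  (inj₁ _) = s≤s z≤n
0<size (σ ⊕ τ)  (inj₂ _) = s≤s z≤n
0<size (list σ) _        = s≤s z≤n

n<2^bits : ∀ n → n < 2 ^ bits n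
n<2^bits = <-rec _ go
  where
  go : ∀ n → (∀ {k} → k < n → k < 2 ^ bits k) → n < 2 ^ bits n
  go 0 _ = s≤s z≤n
  go 1 _ = s≤s (s≤s z≤n)
  go n@(suc (suc m)) rec = begin-strict
    n                                ≡⟨ ⌊n/2⌋+⌈n/2⌉≡n n ⟨
    ⌊ n /2⌋ + ⌈ n /2⌉                ≤⟨ +-monoʳ-≤ ⌊ n /2⌋ (⌊n/2⌋-mono (n≤1+n (suc n))) ⟩
    ⌊ n /2⌋ + suc ⌊ n /2⌋            <⟨ +-mono-≤ h h ⟩
    2 ^ bits ⌊ n /2⌋ + 2 ^ bits ⌊ n /2⌋ ≡⟨ cong (2 ^ bits ⌊ n /2⌋ +_) (+-identityʳ _) ⟨
    2 ^ suc (bits ⌊ n /2⌋)           ≡⟨ cong (2 ^_) eq ⟩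
    2 ^ bits n                       ∎
    where
    open ≤-Reasoning
    h : ⌊ n /2⌋ < 2 ^ bits ⌊ n /2⌋
    h = rec (⌊n/2⌋<n (suc m))
    eq : suc (bits ⌊ n /2⌋) ≡ bits n
    eq = cong (2 +_) (⌊log₂⌊n/2⌋⌋≡⌊log₂n⌋∸1 n)

bits-mono : ∀ {m n} → m ≤ n → bits m ≤ bits n
bits-mono m≤n = s≤s (⌊log₂⌋-mono-≤ m≤n)

bits-≤ : ∀ {n k} → n ≤ 2 ^ k → bits n ≤ suc k
bits-≤ {k = k} n≤ = s≤s (≤-trans (⌊log₂⌋-mono-≤ n≤) (≤-reflexive (⌊log₂[2^n]⌋≡n k)))

bits-≤-suc : ∀ n → bits n ≤ suc n
bits-≤-suc n = bits-≤ (<⇒≤ (n<2^n n))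

bits-* : ∀ m n → bits (m * n) ≤ suc (bits m + bits n)
bits-* m n = bits-≤ (≤-trans (*-mono-≤ (<⇒≤ (n<2^bits m)) (<⇒≤ (n<2^bits n)))
  (≤-reflexive (sym (^-distribˡ-+-* 2 (bits m) (bits n)))))

bits-+ : ∀ m n → bits (m + n) ≤ suc (suc (bits m + bits n))
bits-+ m n = bits-≤ (begin
  m + n                 ≤⟨ +-mono-≤ (<⇒≤ (n<2^bits m)) (<⇒≤ (n<2^bits n)) ⟩
  2 ^ bits m + 2 ^ bits n ≤⟨ +-mono-≤ (^-monoʳ-≤ 2 (m≤m+n (bits m) (bits n))) (^-monoʳ-≤ 2 (m≤n+m (bits n) (bits m))) ⟩
  2 ^ k + 2 ^ k         ≡⟨ cong (2 ^ k +_) (+-identityʳ (2 ^ k)) ⟨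
  2 ^ suc k             ∎)
  where
  open ≤-Reasoning
  k = bits m + bits n

bits-arith : ∀ o m n → bits (arith o m n) ≤ suc (suc (bits m + bits n))
bits-arith add   m n = bits-+ m n
bits-arith mul   m n = m≤n⇒m≤1+n (bits-* m n)
bits-arith monus m n = ≤-trans (bits-mono (m∸n≤m m n)) (≤-trans (m≤m+n (bits m) (bits n)) (m≤n+m _ 2))
bits-arith quot m zero = s≤s z≤n
bits-arith quot m (suc n) = ≤-trans (bits-mono (m/n≤m m (suc n))) (≤-trans (m≤m+n (bits m) (bits (suc n))) (m≤n+m _ 2))

module _ {α : Ty} where

  private
    A = ⟦ α ⟧

  -- Every list pays 1 for its end, and a concatenation has one end fewer than its two parts.
  size-++ : ∀ (xs ys : List A) → suc (size (list α) (xs ++ ys)) ≡ size (list α) xs + size (list α) ys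
  size-++ []       ys = refl
  size-++ (x ∷ xs) ys = cong (2 +_) (begin
    suc (size α x + sz (xs ++ ys))   ≡⟨ +-suc (size α x) _ ⟨
    size α x + suc (sz (xs ++ ys))   ≡⟨ cong (size α x +_) (suc-injective (size-++ xs ys)) ⟩
    size α x + (sz xs + suc (sz ys)) ≡⟨ +-assoc (size α x) (sz xs) (suc (sz ys)) ⟨
    size α x + sz xs + suc (sz ys)   ∎)
    where
    open ≡-Reasoning
    sz = foldr (λ x n → suc (size α x + n)) 0

  size-prefix : ∀ (xs ys : List A) → size (list α) xs ≤ size (list α) (xs ++ ys)
  size-prefix xs ys = ≤-pred (begin
    suc (size (list α) xs)                    ≡⟨ +-comm 1 (size (list α) xs) ⟩
    size (list α) xs + 1                      ≤⟨ +-monoʳ-≤ (size (list α) xs) (0<size (list α) ys) ⟩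
    size (list α) xs + size (list α) ys       ≡⟨ size-++ xs ys ⟨
    suc (size (list α) (xs ++ ys))            ∎)
    where open ≤-Reasoning

  size-suffix : ∀ (xs ys : List A) → size (list α) ys ≤ size (list α) (xs ++ ys)
  size-suffix xs ys = ≤-pred (≤-trans (+-monoˡ-≤ (size (list α) ys) (0<size (list α) xs)) (≤-reflexive (sym (size-++ xs ys))))

  length≤size : ∀ (xs : List A) → length xs ≤ size (list α) xs
  length≤size []       = z≤n
  length≤size (x ∷ xs) = s≤s (≤-trans (length≤size xs) (s≤s (m≤n+m _ (size α x))))

  size-∈ : ∀ {x} {xs : List A} → x ∈ xs → size α x ≤ size (list α) xs
  size-∈ {xs = x ∷ xs} (here refl) = ≤-trans (m≤m+n (size α x) _) (m≤n+m _ 2)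
  size-∈ {xs = x ∷ xs} (there x∈)  = ≤-trans (size-∈ x∈) (s≤s (≤-trans (m≤n+m _ (size α x)) (n≤1+n _)))

  size≤length* : ∀ {B} (xs : List A) → (∀ {x} → x ∈ xs → size α x ≤ B) →
                 size (list α) xs ≤ suc (length xs * suc B)
  size≤length* []       _ = ≤-refl
  size≤length* (x ∷ xs) b = s≤s (s≤s (+-mono-≤ (b (here refl)) (≤-pred (size≤length* xs (b ∘ there)))))

-- Polynomial time

-- The bound covers cost plus output size, so a polynomial bound on the size of the result is
-- included (`size-result`). Composition needs it, since the second program runs on that result.
record PT (σ τ : Ty) (f : ⟦ σ ⟧ → ⟦ τ ⟧) : Set where
  constructor pt
  field
    prog   : Prog σ τ
    degree : ℕ
    runs   : ∀ x → prog · x ⇓ f x within (2 + size σ x) ^ degree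

within-mono : ∀ {σ τ} {p : Prog σ τ} {x y t u} → t ≤ u → p · x ⇓ y within t → p · x ⇓ y within u
within-mono t≤u (c , d , b) = c , d , ≤-trans b t≤u

-- Opaque, lest conversion checks evaluate the degrees.
opaque
  mkPT : ∀ {σ τ f} (p : Prog σ τ) {g} → Poly (size σ) g →
         (∀ x → p · x ⇓ f x within g x) → PT σ τ f
  mkPT p (poly k b) r = pt p k λ x → within-mono (b x) (r x)

-- Lets a program follow one description of a function, such as an accumulator in reverse, and be
-- used for another.
pt-ext : ∀ {σ τ f g} → (∀ x → f x ≡ g x) → PT σ τ f → PT σ τ g
pt-ext eq (pt p k r) = pt p k λ x → subst (λ y → p · x ⇓ y within _) (eq x) (r x)

module _ {σ τ f} (p : PT σ τ f) where
  open PT p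

  timeOf : ⟦ σ ⟧ → ℕ
  timeOf x = (2 + size σ x) ^ degree

  poly-time : ∀ {A : Set} {m g : A → ℕ} → Poly m g → Poly m (λ a → (2 + g a) ^ degree)
  poly-time q = poly-^ (poly-suc (poly-suc q)) degree

  size-result : ∀ x → size τ (f x) ≤ timeOf x
  size-result x with runs x
  ... | c , _ , b = ≤-trans (m≤n+m _ c) b

  poly-size : Poly (size σ) (λ x → size τ (f x))
  poly-size = poly-mono size-result (poly-time poly-measure)

infixl 9 _⨟_

unconsF : ∀ {A : Set} → List A → ⊤ ⊎ (A × List A)
unconsF []       = inj₁ tt
unconsF (x ∷ xs) = inj₂ (x , xs)

opaque
  unitCost : ∀ {σ τ f} (p : Prog σ τ) → (∀ x → p · x ⇓ f x ∣ 1) →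
             (∀ x → size τ (f x) ≤ 2 + size σ x) → PT σ τ f
  unitCost p r s = mkPT p (poly-suc (poly-suc (poly-suc poly-measure))) λ x → 1 , r x , s≤s (s x)

  pt-id : ∀ {σ} → PT σ σ id
  pt-id = unitCost idp (λ _ → idp) (λ x → m≤n+m _ 2)

  _⨟_ : ∀ {ρ σ τ f g} → PT ρ σ f → PT σ τ g → PT ρ τ (g ∘ f)
  _⨟_ {ρ} {σ} {f = f} p q = mkPT (PT.prog p ⨾ PT.prog q)
    (poly-suc (poly-+ (poly-time p poly-measure) (poly-time q (poly-size p)))) λ x →
      let a , d , b = PT.runs p x ; a′ , d′ , b′ = PT.runs q (f x) in
      suc (a + a′) , d ⨾ d′ ,
      s≤s (≤-trans (≤-reflexive (+-assoc a a′ _)) (+-mono-≤ (≤-trans (m≤m+n a _) b) b′))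

  ⟨_,_⟩ : ∀ {ρ σ τ f g} → PT ρ σ f → PT ρ τ g → PT ρ (σ ⊗ τ) (λ x → f x , g x)
  ⟨_,_⟩ {ρ} {σ} {τ} {f} {g} p q = mkPT (pair (PT.prog p) (PT.prog q))
    (poly-suc (poly-suc (poly-+ (poly-time p poly-measure) (poly-time q poly-measure)))) λ x →
      let a , d , b = PT.runs p x ; a′ , d′ , b′ = PT.runs q x in
      suc (a + a′) , pair d d′ ,
      (begin
        suc (a + a′) + suc (size σ (f x) + size τ (g x))   ≡⟨ cong suc (+-suc (a + a′) _) ⟩
        2 + (a + a′ + (size σ (f x) + size τ (g x)))       ≡⟨ cong (2 +_) (interchange a a′ (size σ (f x)) (size τ (g x))) ⟩
        2 + (a + size σ (f x) + (a′ + size τ (g x)))       ≤⟨ +-monoʳ-≤ 2 (+-mono-≤ b b′) ⟩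
        2 + (timeOf p x + timeOf q x)                      ∎)
    where
    open ≤-Reasoning

  pt-fst : ∀ {σ τ} → PT (σ ⊗ τ) σ proj₁
  pt-fst {σ} = unitCost fst (λ _ → fst) λ { (x , y) → ≤-trans (m≤m+n (size σ x) _) (m≤n+m _ 3) }

  pt-snd : ∀ {σ τ} → PT (σ ⊗ τ) τ proj₂
  pt-snd {σ} = unitCost snd (λ _ → snd) λ { (x , y) → ≤-trans (m≤n+m _ (size σ x)) (m≤n+m _ 3) }

  pt-tt : ∀ {σ} → PT σ unit (λ _ → tt)
  pt-tt = unitCost bang (λ _ → bang) λ _ → s≤s z≤n

  pt-nil : ∀ {σ τ} → PT σ (list τ) (λ _ → [])
  pt-nil = unitCost nil (λ _ → nil) λ _ → s≤s z≤n

  pt-lit : ∀ {σ} n → PT σ nat (λ _ → n)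
  pt-lit n = mkPT (literal n) (poly-const (suc (bits n))) λ _ → 1 , literal , ≤-refl

  pt-inj₁ : ∀ {ρ σ τ f} → PT ρ σ f → PT ρ (σ ⊕ τ) (λ x → inj₁ (f x))
  pt-inj₁ p = p ⨟ unitCost inl (λ _ → inl) λ _ → n≤1+n _

  pt-inj₂ : ∀ {ρ σ τ f} → PT ρ τ f → PT ρ (σ ⊕ τ) (λ x → inj₂ (f x))
  pt-inj₂ p = p ⨟ unitCost inr (λ _ → inr) λ _ → n≤1+n _

  pt-cons : ∀ {ρ σ f g} → PT ρ σ f → PT ρ (list σ) g → PT ρ (list σ) (λ x → f x ∷ g x)
  pt-cons {σ = σ} p q = ⟨ p , q ⟩ ⨟ unitCost cons (λ _ → cons)
    λ { (x , xs) → s≤s (s≤s (≤-trans (+-monoʳ-≤ (size σ x) (n≤1+n _)) (n≤1+n _))) }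

  pt-uncons : ∀ {σ} → PT (list σ) (unit ⊕ (σ ⊗ list σ)) unconsF
  pt-uncons {σ} = unitCost uncons (λ { [] → uncons[] ; (_ ∷ _) → uncons∷ })
    λ { [] → s≤s (s≤s z≤n) ; (x ∷ xs) → s≤s (s≤s (≤-trans (≤-reflexive (+-suc (size σ x) _)) (n≤1+n _))) }

  pt-arith : ∀ {ρ f g} o → PT ρ nat f → PT ρ nat g → PT ρ nat (λ x → arith o (f x) (g x))
  pt-arith o p q = ⟨ p , q ⟩ ⨟ mkPT (op o) (poly-+ (poly-measure) (poly-suc poly-measure))
    λ { (m , n) → suc (bits m + bits n) , op , +-monoʳ-≤ (suc (bits m + bits n)) (bits-arith o m n) }

  pt-case : ∀ {ρ σ σ′ τ f g h} → PT ρ (σ ⊕ σ′) f → PT (σ ⊗ ρ) τ g → PT (σ′ ⊗ ρ) τ h →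
            PT ρ τ (λ x → [ (λ a → g (a , x)) , (λ b → h (b , x)) ]′ (f x))
  pt-case {ρ} {σ} {σ′} {τ} {f} {g} {h} p q r = ⟨ p , pt-id ⟩ ⨟ mkPT {f = both} (branch (PT.prog q) (PT.prog r))
    {bound} (poly-suc (poly-+ (poly-time q poly-measure) (poly-time r poly-measure)))
    λ { (inj₁ a , x) → let c , d , b = PT.runs q (a , x) in
          suc c , branch₁ d , s≤s (≤-trans (≤-trans b (mono q (s≤s (n≤1+n (size σ a + size ρ x))))) (m≤m+n _ _))
      ; (inj₂ a , x) → let c , d , b = PT.runs r (a , x) in
          suc c , branch₂ d , s≤s (≤-trans (≤-trans b (mono r (s≤s (n≤1+n (size σ′ a + size ρ x))))) (m≤n+m _ _)) }
    where
    both : ⟦ (σ ⊕ σ′) ⊗ ρ ⟧ → ⟦ τ ⟧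
    both (s , x) = [ (λ a → g (a , x)) , (λ b → h (b , x)) ]′ s
    bound : ⟦ (σ ⊕ σ′) ⊗ ρ ⟧ → ℕ
    bound z = suc ((2 + size ((σ ⊕ σ′) ⊗ ρ) z) ^ PT.degree q + (2 + size ((σ ⊕ σ′) ⊗ ρ) z) ^ PT.degree r)
    mono : ∀ {σ τ f} (p : PT σ τ f) {m n} → m ≤ n → (2 + m) ^ PT.degree p ≤ (2 + n) ^ PT.degree p
    mono p m≤n = ^-monoˡ-≤ (PT.degree p) (+-monoʳ-≤ 2 m≤n)

-- Loops

-- The invariant accompanies the run because the cost of each round depends on the size of the state
-- there.
data Loop {S T : Set} (f : S → S ⊎ T) (P : S → Set) : S → T → ℕ → Set where
  stop : ∀ {x y} → P x → f x ≡ inj₂ y → Loop f P x y 0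
  next : ∀ {x x′ y t} → P x → f x ≡ inj₁ x′ → Loop f P x′ y t → Loop f P x y (suc t)

iterate-runs : ∀ {σ τ f} (p : PT σ (σ ⊕ τ) f) {B x y t} → Loop f (λ s → size σ s ≤ B) x y t →
               iterate (PT.prog p) · x ⇓ y within suc t * suc ((2 + B) ^ PT.degree p)
iterate-runs {σ} {τ} p {B} {x} (stop {y = y} x≤B eq) with PT.runs p x
... | a , d , b = suc a , done (subst (λ z → PT.prog p · x ⇓ z ∣ a) eq d) , (begin
    suc a + size τ y                      ≡⟨ +-suc a (size τ y) ⟨
    a + size (σ ⊕ τ) (inj₂ y)             ≡⟨ cong (λ z → a + size (σ ⊕ τ) z) eq ⟨
    a + size (σ ⊕ τ) _                    ≤⟨ b ⟩
    (2 + size σ x) ^ PT.degree p          ≤⟨ ^-monoˡ-≤ (PT.degree p) (+-monoʳ-≤ 2 x≤B) ⟩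
    (2 + B) ^ PT.degree p                 ≤⟨ n≤1+n _ ⟩
    suc ((2 + B) ^ PT.degree p)           ≡⟨ *-identityˡ _ ⟨
    1 * suc ((2 + B) ^ PT.degree p)       ∎)
  where open ≤-Reasoning
iterate-runs {σ} {τ} p {B} {x} {y} {suc t} (next x≤B eq l) with PT.runs p x | iterate-runs p l
... | a , d , b | c , d′ , b′ = suc (a + c) , again (subst (λ z → PT.prog p · x ⇓ z ∣ a) eq d) d′ , s≤s (begin
    a + c + size τ y                      ≡⟨ +-assoc a c (size τ y) ⟩
    a + (c + size τ y)                    ≤⟨ +-mono-≤ (≤-trans (m≤m+n a _) b) b′ ⟩
    (2 + size σ x) ^ PT.degree p + rest   ≤⟨ +-monoˡ-≤ rest (^-monoˡ-≤ (PT.degree p) (+-monoʳ-≤ 2 x≤B)) ⟩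
    (2 + B) ^ PT.degree p + rest          ∎)
  where
  open ≤-Reasoning
  rest = suc t * suc ((2 + B) ^ PT.degree p)

module _ {Γ σ τ : Ty} {f : ⟦ σ ⟧ → ⟦ σ ⟧ ⊎ ⟦ τ ⟧} {g : ⟦ Γ ⟧ → ⟦ σ ⟧} {h : ⟦ Γ ⟧ → ⟦ τ ⟧}
         (init : PT Γ σ g) (body : PT σ (σ ⊕ τ) f) where

  opaque
    -- Few rounds alone do not suffice, as a polynomial-time body may enlarge its state in each of
    -- them. Hence a bound `B` on all states beside the bound `N` on the rounds.
    pt-iterate : ∀ {B N} → Poly (size Γ) B → Poly (size Γ) N →
      (∀ γ → ∃[ t ] Loop f (λ s → size σ s ≤ B γ) (g γ) (h γ) t × t ≤ N γ) → PT Γ τ h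
    pt-iterate {B} {N} poly-B poly-N loops = mkPT (PT.prog init ⨾ iterate (PT.prog body)) poly-total λ γ →
        let a , d , e = PT.runs init γ ; t , l , t≤N = loops γ ; c , d′ , e′ = iterate-runs body l
        in suc (a + c) , d ⨾ d′ , s≤s (combine γ t≤N (≤-trans (m≤m+n a _) e) e′)
      where
      open ≤-Reasoning
      steps rest : ⟦ Γ ⟧ → ℕ
      steps γ = suc ((2 + B γ) ^ PT.degree body)
      rest γ = suc (N γ) * steps γ
      poly-total : Poly (size Γ) (λ γ → suc (timeOf init γ + rest γ))
      poly-total = poly-suc (poly-+ (poly-time init poly-measure) (poly-* {g = λ γ → suc (N γ)} {steps}
        (poly-suc poly-N) (poly-suc (poly-time body poly-B))))
      combine : ∀ γ {t a c z} → t ≤ N γ → a ≤ timeOf init γ → c + z ≤ suc t * steps γ → a + c + z ≤ timeOf init γ + rest γ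
      combine γ {t} {a} {c} {z} t≤N p q = begin
        a + c + z   ≡⟨ +-assoc a c z ⟩
        a + (c + z) ≤⟨ +-mono-≤ p (≤-trans q (*-monoˡ-≤ (steps γ) (s≤s t≤N))) ⟩
        timeOf init γ + rest γ ∎

opaque
  wk : ∀ {α Γ τ f} → PT Γ τ f → PT (α ⊗ Γ) τ (f ∘ proj₂)
  wk p = pt-snd ⨟ p

module _ {Γ α σ : Ty} {f : ⟦ σ ⊗ (α ⊗ Γ) ⟧ → ⟦ σ ⟧} {s₀ : ⟦ Γ ⟧ → ⟦ σ ⟧} {xs : ⟦ Γ ⟧ → List ⟦ α ⟧}
         (step : PT (σ ⊗ (α ⊗ Γ)) σ f) (from : PT Γ σ s₀) (over : PT Γ (list α) xs) where

  private
    St : Ty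
    St = list α ⊗ (σ ⊗ Γ)

    bodyF : ⟦ St ⟧ → ⟦ St ⟧ ⊎ ⟦ σ ⟧
    bodyF (ys , s , γ) = [ (λ _ → inj₂ s) , (λ (y , ys′) → inj₁ (ys′ , f (s , y , γ) , γ)) ]′ (unconsF ys)

    opaque
      body : PT St (St ⊕ σ) bodyF
      body = pt-case (pt-fst ⨟ pt-uncons) (pt-inj₂ (wk pt-snd ⨟ pt-fst))
        (pt-inj₁ ⟨ pt-fst ⨟ pt-snd , ⟨ ⟨ wk pt-snd ⨟ pt-fst , ⟨ pt-fst ⨟ pt-fst , wk pt-snd ⨟ pt-snd ⟩ ⟩ ⨟ step
                                     , wk pt-snd ⨟ pt-snd ⟩ ⟩)

    foldl-loop : ∀ γ {G N} ys s → size (list α) ys ≤ N →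
      (∀ us vs → ys ≡ us ++ vs → size σ (foldl (λ s a → f (s , a , γ)) s us) ≤ G) →
      Loop bodyF (λ z → size St z ≤ suc (N + suc (G + size Γ γ)))
        (ys , s , γ) (foldl (λ s a → f (s , a , γ)) s ys) (length ys)
    foldl-loop γ []       s N≤ b = stop (s≤s (+-mono-≤ N≤ (s≤s (+-monoˡ-≤ _ (b [] [] refl))))) refl
    foldl-loop γ (y ∷ ys) s N≤ b = next (s≤s (+-mono-≤ N≤ (s≤s (+-monoˡ-≤ _ (b [] _ refl))))) refl
      (foldl-loop γ ys _ (≤-trans (size-suffix (y ∷ []) ys) N≤) λ us vs eq → b (y ∷ us) vs (cong (y ∷_) eq))

  opaque
    -- The prefixes `us` are the points at which the loop holds an accumulator, so the hypothesis is
    -- the state bound of `pt-iterate`.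
    pt-foldl : ∀ {G} → Poly (size Γ) G →
      (∀ γ us vs → xs γ ≡ us ++ vs → size σ (foldl (λ s a → f (s , a , γ)) (s₀ γ) us) ≤ G γ) →
      PT Γ σ (λ γ → foldl (λ s a → f (s , a , γ)) (s₀ γ) (xs γ))
    pt-foldl {G} poly-G b = pt-iterate ⟨ over , ⟨ from , pt-id ⟩ ⟩ body
      (poly-suc (poly-+ (poly-size over) (poly-suc (poly-+ poly-G poly-measure)))) (poly-size over) λ γ →
      length (xs γ) , foldl-loop γ (xs γ) (s₀ γ) ≤-refl (b γ) , length≤size (xs γ)

-- Lists

module _ {α : Ty} where

  size-ʳ++ : ∀ (xs ys : List ⟦ α ⟧) → suc (size (list α) (xs ʳ++ ys)) ≡ size (list α) xs + size (list α) ys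
  size-ʳ++ []       ys = refl
  size-ʳ++ (x ∷ xs) ys = trans (size-ʳ++ xs (x ∷ ys)) (lemma (size α x) (sz xs) (sz ys))
    where
    sz = foldr (λ x n → suc (size α x + n)) 0
    lemma : ∀ a b c → suc b + suc (suc (a + c)) ≡ suc (suc (a + b)) + suc c
    lemma = solve-∀

  size-ʳ++[] : ∀ (xs : List ⟦ α ⟧) → size (list α) (xs ʳ++ []) ≡ size (list α) xs
  size-ʳ++[] xs = suc-injective (trans (size-ʳ++ xs []) (+-comm _ 1))

opaque
  pt-ʳ++ : ∀ {Γ α f g} → PT Γ (list α) f → PT Γ (list α) g → PT Γ (list α) (λ γ → f γ ʳ++ g γ)
  pt-ʳ++ {Γ} {α} {f} {g} p q = pt-foldl (pt-cons (wk pt-fst) pt-fst) q p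
    (poly-+ (poly-size p) (poly-size q)) λ γ us vs eq →
    ≤-trans (n≤1+n _) (≤-trans (≤-reflexive (size-ʳ++ us (g γ)))
      (+-monoˡ-≤ _ (subst (λ z → size (list α) us ≤ size (list α) z) (sym eq) (size-prefix us vs))))

opaque
  pt-reverse : ∀ {Γ α f} → PT Γ (list α) f → PT Γ (list α) (λ γ → reverse (f γ))
  pt-reverse p = pt-ʳ++ p pt-nil

opaque
  pt-++ : ∀ {Γ α f g} → PT Γ (list α) f → PT Γ (list α) g → PT Γ (list α) (λ γ → f γ ++ g γ)
  pt-++ {f = f} p q = pt-ext (λ γ → ʳ++-ʳ++ (f γ)) (pt-ʳ++ (pt-reverse p) q)

foldl-ʳ++-concatMap : ∀ {A B : Set} (h : A → List B) acc xs →
  foldl (λ acc a → h a ʳ++ acc) acc xs ≡ concatMap h xs ʳ++ acc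
foldl-ʳ++-concatMap h acc []       = refl
foldl-ʳ++-concatMap h acc (x ∷ xs) = trans (foldl-ʳ++-concatMap h (h x ʳ++ acc) xs)
  (sym (++-ʳ++ (h x)))

module _ {α β : Ty} where

  size-concatMap : ∀ (h : ⟦ α ⟧ → List ⟦ β ⟧) {B} xs → (∀ {x} → x ∈ xs → size (list β) (h x) ≤ B) →
                   size (list β) (concatMap h xs) ≤ suc (length xs * B)
  size-concatMap h []       b = ≤-refl
  size-concatMap h {B} (x ∷ xs) b = ≤-pred (begin
    suc (size (list β) (h x ++ concatMap h xs))          ≡⟨ size-++ (h x) (concatMap h xs) ⟩
    size (list β) (h x) + size (list β) (concatMap h xs) ≤⟨ +-mono-≤ (b (here refl)) (size-concatMap h xs (b ∘ there)) ⟩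
    B + suc (length xs * B)                              ≡⟨ +-suc B _ ⟩
    suc (B + length xs * B)                              ≤⟨ n≤1+n _ ⟩
    suc (suc (B + length xs * B))                        ∎)
    where open ≤-Reasoning

  opaque
    -- Results are collected in reverse, since a left fold prepends; one reversal at the end
    -- restores the order.
    pt-concatMap : ∀ {Γ f xs} → PT (α ⊗ Γ) (list β) f → PT Γ (list α) xs →
                   PT Γ (list β) (λ γ → concatMap (λ a → f (a , γ)) (xs γ))
    pt-concatMap {Γ} {f} {xs} p q = pt-ext reversed (pt-reverse
      (pt-foldl (pt-ʳ++ (wk p) pt-fst) pt-nil q
        (poly-suc (poly-* {g = λ γ → size (list α) (xs γ)} {λ γ → (2 + suc (size (list α) (xs γ) + size Γ γ)) ^ PT.degree p}
          (poly-size q) (poly-time p (poly-suc (poly-+ (poly-size q) poly-measure)))))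
        bound))
      where
      reversed : ∀ γ → reverse (foldl (λ acc a → f (a , γ) ʳ++ acc) [] (xs γ)) ≡ concatMap (λ a → f (a , γ)) (xs γ)
      reversed γ = trans (cong reverse (foldl-ʳ++-concatMap (λ a → f (a , γ)) [] (xs γ)))
        (trans (ʳ++-ʳ++ (concatMap (λ a → f (a , γ)) (xs γ))) (++-identityʳ _))
      bound : ∀ γ us vs → xs γ ≡ us ++ vs →
        size (list β) (foldl (λ acc a → f (a , γ) ʳ++ acc) [] us) ≤
        suc (size (list α) (xs γ) * (2 + suc (size (list α) (xs γ) + size Γ γ)) ^ PT.degree p)
      bound γ us vs eq = begin
        size (list β) (foldl (λ acc a → f (a , γ) ʳ++ acc) [] us)
          ≡⟨ cong (size (list β)) (foldl-ʳ++-concatMap (λ a → f (a , γ)) [] us) ⟩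
        size (list β) (concatMap (λ a → f (a , γ)) us ʳ++ [])
          ≡⟨ size-ʳ++[] (concatMap (λ a → f (a , γ)) us) ⟩
        size (list β) (concatMap (λ a → f (a , γ)) us)
          ≤⟨ size-concatMap (λ a → f (a , γ)) us (λ {a} a∈ → ≤-trans (size-result p (a , γ))
               (^-monoˡ-≤ (PT.degree p) (s≤s (s≤s (s≤s (+-monoˡ-≤ _ (≤-trans (size-∈ a∈) us≤))))))) ⟩
        suc (length us * (2 + suc (size (list α) (xs γ) + size Γ γ)) ^ PT.degree p)
          ≤⟨ s≤s (*-monoˡ-≤ _ (≤-trans (length≤size us) us≤)) ⟩
        _ ∎
        where
        open ≤-Reasoning
        us≤ : size (list α) us ≤ size (list α) (xs γ)
        us≤ = subst (λ z → size (list α) us ≤ size (list α) z) (sym eq) (size-prefix us vs)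

  opaque
    pt-map : ∀ {Γ f xs} → PT (α ⊗ Γ) β f → PT Γ (list α) xs →
             PT Γ (list β) (λ γ → map (λ a → f (a , γ)) (xs γ))
    pt-map {f = f} {xs} p q = pt-ext (λ γ → singletons (λ a → f (a , γ)) (xs γ))
      (pt-concatMap (pt-cons p pt-nil) q)
      where
      singletons : ∀ {A B : Set} (h : A → B) xs → concatMap (λ a → h a ∷ []) xs ≡ map h xs
      singletons h []       = refl
      singletons h (x ∷ xs) = cong (h x ∷_) (singletons h xs)

opaque
  -- A right fold is a left fold over the reversed list, so here the suffixes `vs` index the
  -- intermediate accumulators.
  pt-foldr : ∀ {Γ α σ f s₀ xs} → PT (σ ⊗ (α ⊗ Γ)) σ f → PT Γ σ s₀ → PT Γ (list α) xs →
    ∀ {G} → Poly (size Γ) G →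
    (∀ γ us vs → xs γ ≡ us ++ vs → size σ (foldr (λ a s → f (s , a , γ)) (s₀ γ) vs) ≤ G γ) →
    PT Γ σ (λ γ → foldr (λ a s → f (s , a , γ)) (s₀ γ) (xs γ))
  pt-foldr {f = f} {s₀} {xs} step start over poly-G b =
    pt-ext (λ γ → reverse-foldl (λ s a → f (s , a , γ)) (s₀ γ) (xs γ))
      (pt-foldl step start (pt-reverse over) poly-G λ γ us vs eq →
        ≤-trans (≤-reflexive (cong (size _) (trans
          (cong (foldl _ _) (sym (reverse-involutive us)))
          (reverse-foldl (λ s a → f (s , a , γ)) (s₀ γ) (reverse us)))))
        (b γ (reverse vs) (reverse us) (trans (sym (reverse-involutive (xs γ)))
          (trans (cong reverse eq) (reverse-++ us vs)))))

-- Tests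

Test : Set
Test = ⟦ unit ⊕ unit ⟧

pattern yea = inj₁ tt
pattern nay = inj₂ tt

ite : ∀ {A : Set} → Test → A → A → A
ite b x y = [ (λ _ → x) , (λ _ → y) ]′ b

opaque
  pt-ite : ∀ {Γ τ b f g} → PT Γ (unit ⊕ unit) b → PT Γ τ f → PT Γ τ g → PT Γ τ (λ γ → ite (b γ) (f γ) (g γ))
  pt-ite b p q = pt-case b (wk p) (wk q)

both : Test → Test → Test
both b c = ite b c nay

opaque
  pt-both : ∀ {Γ b c} → PT Γ (unit ⊕ unit) b → PT Γ (unit ⊕ unit) c → PT Γ (unit ⊕ unit) (λ γ → both (b γ) (c γ))
  pt-both p q = pt-ite p q (pt-inj₂ pt-tt)

both⁻ : ∀ {b c} → both b c ≡ yea → b ≡ yea × c ≡ yea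
both⁻ {yea} eq = refl , eq

both⁺ : ∀ {b c} → b ≡ yea → c ≡ yea → both b c ≡ yea
both⁺ refl eq = eq

isZeroF : ℕ → Test
isZeroF zero    = yea
isZeroF (suc _) = nay

leq : ℕ → ℕ → Test
leq m n = isZeroF (m ∸ n)

opaque
  pt-leq : ∀ {Γ f g} → PT Γ nat f → PT Γ nat g → PT Γ (unit ⊕ unit) (λ γ → leq (f γ) (g γ))
  pt-leq p q = pt-arith monus p q ⨟ unitCost {f = isZeroF} isZero (λ { zero → isZero₀ ; (suc _) → isZero₊ })
    λ { zero → s≤s (s≤s z≤n) ; (suc _) → s≤s (s≤s z≤n) }

leq⁻ : ∀ {m n} → leq m n ≡ yea → m ≤ n
leq⁻ {m} {n} eq = m∸n≡0⇒m≤n (zero? (m ∸ n) eq)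
  where
  zero? : ∀ k → isZeroF k ≡ yea → k ≡ 0
  zero? zero _ = refl

leq⁺ : ∀ {m n} → m ≤ n → leq m n ≡ yea
leq⁺ m≤n = cong isZeroF (m≤n⇒m∸n≡0 m≤n)

leq-nay⁻ : ∀ {m n} → leq m n ≡ nay → n < m
leq-nay⁻ {m} {n} eq with m ≤? n
... | no m≰n = ≰⇒> m≰n
... | yes m≤n with trans (sym eq) (leq⁺ m≤n)
...   | ()

eqℕ : ℕ → ℕ → Test
eqℕ m n = both (leq m n) (leq n m)

opaque
  pt-eqℕ : ∀ {Γ f g} → PT Γ nat f → PT Γ nat g → PT Γ (unit ⊕ unit) (λ γ → eqℕ (f γ) (g γ))
  pt-eqℕ p q = pt-both (pt-leq p q) (pt-leq q p)

eqℕ⁻ : ∀ {m n} → eqℕ m n ≡ yea → m ≡ n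
eqℕ⁻ {m} {n} eq with both⁻ {leq m n} eq
... | e , f = ≤-antisym (leq⁻ e) (leq⁻ {n} f)

eqℕ-refl : ∀ n → eqℕ n n ≡ yea
eqℕ-refl n = both⁺ (leq⁺ (≤-refl {n})) (leq⁺ (≤-refl {n}))

-- List programs

∈-concatMap-intro : ∀ {A B : Set} (f : A → List B) {x y xs} → x ∈ xs → y ∈ f x → y ∈ concatMap f xs
∈-concatMap-intro f (here refl) y∈ = ∈-++⁺ˡ y∈
∈-concatMap-intro f (there {x = x} x∈) y∈ = ∈-++⁺ʳ (f x) (∈-concatMap-intro f x∈ y∈)

∈-concatMap-elim : ∀ {A B : Set} (f : A → List B) {y} xs → y ∈ concatMap f xs → ∃[ x ] (x ∈ xs × y ∈ f x)
∈-concatMap-elim f (x ∷ xs) y∈ with ∈-++⁻ (f x) y∈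
... | inj₁ y∈x = x , here refl , y∈x
... | inj₂ y∈′ with ∈-concatMap-elim f xs y∈′
...   | z , z∈ , y∈z = z , there z∈ , y∈z

guard : ∀ {A : Set} → Test → List A → List A
guard b xs = ite b xs []

opaque
  pt-guard : ∀ {Γ α b xs} → PT Γ (unit ⊕ unit) b → PT Γ (list α) xs → PT Γ (list α) (λ γ → guard (b γ) (xs γ))
  pt-guard b p = pt-ite b p pt-nil

∈-guard⁻ : ∀ {A : Set} b {xs : List A} {x} → x ∈ guard b xs → b ≡ yea × x ∈ xs
∈-guard⁻ yea x∈ = refl , x∈

∈-guard⁺ : ∀ {A : Set} {b} {xs : List A} {x} → b ≡ yea → x ∈ xs → x ∈ guard b xs
∈-guard⁺ refl x∈ = x∈

select : ∀ {A : Set} → (A → Test) → List A → List A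
select p = concatMap (λ x → guard (p x) (x ∷ []))

opaque
  pt-select : ∀ {Γ α p xs} → PT (α ⊗ Γ) (unit ⊕ unit) p → PT Γ (list α) xs →
              PT Γ (list α) (λ γ → select (λ a → p (a , γ)) (xs γ))
  pt-select p q = pt-concatMap (pt-guard p (pt-cons pt-fst pt-nil)) q

module _ {A : Set} (p : A → Test) where

  ∈-select⁺ : ∀ {x xs} → p x ≡ yea → x ∈ xs → x ∈ select p xs
  ∈-select⁺ px x∈ = ∈-concatMap-intro (λ x → guard (p x) (x ∷ [])) x∈ (∈-guard⁺ px (here refl))

  ∈-select⁻ : ∀ {x} xs → x ∈ select p xs → p x ≡ yea × x ∈ xs
  ∈-select⁻ xs x∈ with ∈-concatMap-elim (λ x → guard (p x) (x ∷ [])) xs x∈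
  ... | y , y∈ , x∈′ with ∈-guard⁻ (p y) x∈′
  ...   | py , here refl = py , y∈

  length-select : ∀ xs → length (select p xs) ≤ length xs
  length-select []       = z≤n
  length-select (x ∷ xs) with p x
  ... | yea = s≤s (length-select xs)
  ... | nay = m≤n⇒m≤1+n (length-select xs)

  select-AllPairs : ∀ {R : A → A → Set} {xs} → AllPairs R xs → AllPairs R (select p xs)
  select-AllPairs [] = []
  select-AllPairs {xs = x ∷ xs} (r ∷ rs) with p x
  ... | nay = select-AllPairs rs
  ... | yea = All.tabulate (λ y∈ → All.lookup r (proj₂ (∈-select⁻ xs y∈))) ∷ select-AllPairs rs

-- The list is empty or a singleton.
argmin : ∀ {A : Set} → (A → ℕ) → List A → List A
argmin w = foldr (λ x acc → [ (λ _ → x ∷ []) , (λ (y , _) → ite (leq (w x) (w y)) (x ∷ []) (y ∷ [])) ]′ (unconsF acc)) []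

module _ {A : Set} (w : A → ℕ) where

  argmin-⊆ : ∀ xs → argmin w xs ≡ [] ⊎ (∃[ x ] x ∈ xs × argmin w xs ≡ x ∷ [])
  argmin-⊆ []       = inj₁ refl
  argmin-⊆ (x ∷ xs) with argmin w xs | argmin-⊆ xs
  ... | .[]       | inj₁ refl = inj₂ (x , here refl , refl)
  ... | .(y ∷ []) | inj₂ (y , y∈ , refl) with leq (w x) (w y)
  ...   | yea = inj₂ (x , here refl , refl)
  ...   | nay = inj₂ (y , there y∈ , refl)

  argmin-≤ : ∀ {y xs} → y ∈ xs → ∃[ x ] x ∈ xs × argmin w xs ≡ x ∷ [] × w x ≤ w y
  argmin-≤ {y} {x ∷ xs} y∈ with argmin w xs | argmin-⊆ xs | argmin-≤ {y} {xs}
  argmin-≤ (here refl) | .[]       | inj₁ refl            | _ = _ , here refl , refl , ≤-refl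
  argmin-≤ (there y∈)  | .[]       | inj₁ refl            | ih with ih y∈
  ... | _ , _ , () , _
  argmin-≤ {xs = x ∷ xs} y∈ | .(z ∷ []) | inj₂ (z , z∈ , refl) | ih with leq (w x) (w z) in eq
  argmin-≤ (here refl) | _ | inj₂ (z , z∈ , refl) | ih | yea = _ , here refl , refl , ≤-refl
  argmin-≤ (there y∈)  | _ | inj₂ (z , z∈ , refl) | ih | yea with ih y∈
  ... | _ , _ , refl , z≤y = _ , here refl , refl , ≤-trans (leq⁻ eq) z≤y
  argmin-≤ (here refl) | _ | inj₂ (z , z∈ , refl) | ih | nay = z , there z∈ , refl , <⇒≤ (leq-nay⁻ eq)
  argmin-≤ (there y∈)  | _ | inj₂ (z , z∈ , refl) | ih | nay with ih y∈
  ... | _ , _ , refl , z≤y = z , there z∈ , refl , z≤y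

  length-argmin : ∀ xs → length (argmin w xs) ≤ 1
  length-argmin xs with argmin-⊆ xs
  ... | inj₁ eq           rewrite eq = z≤n
  ... | inj₂ (_ , _ , eq) rewrite eq = ≤-refl

  ∈-argmin : ∀ {x} xs → x ∈ argmin w xs → x ∈ xs
  ∈-argmin xs x∈ with argmin-⊆ xs
  ... | inj₁ eq with () ← subst (_ ∈_) eq x∈
  ... | inj₂ (y , y∈ , eq) with here refl ← subst (_ ∈_) eq x∈ = y∈

opaque
  pt-argmin : ∀ {Γ α w xs} → PT (α ⊗ Γ) nat w → PT Γ (list α) xs →
              PT Γ (list α) (λ γ → argmin (λ a → w (a , γ)) (xs γ))
  pt-argmin {Γ} {α} {w} {xs} p q = pt-foldr
    (pt-case (pt-fst ⨟ pt-uncons) (pt-cons (wk x) pt-nil)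
      (pt-ite (pt-leq (⟨ wk x , wk γ ⟩ ⨟ p) (⟨ pt-fst ⨟ pt-fst , wk γ ⟩ ⨟ p))
        (pt-cons (wk x) pt-nil) (pt-cons (pt-fst ⨟ pt-fst) pt-nil)))
    pt-nil q {λ γ → suc (suc (size (list α) (xs γ)))} (poly-suc (poly-suc (poly-size q))) bound
    where
    x : PT (list α ⊗ (α ⊗ Γ)) α (λ z → proj₁ (proj₂ z))
    x = pt-snd ⨟ pt-fst
    γ : PT (list α ⊗ (α ⊗ Γ)) Γ (λ z → proj₂ (proj₂ z))
    γ = pt-snd ⨟ pt-snd
    bound : ∀ γ us vs → xs γ ≡ us ++ vs →
            size (list α) (argmin (λ a → w (a , γ)) vs) ≤ suc (suc (size (list α) (xs γ)))
    bound γ us vs eq with argmin (λ a → w (a , γ)) vs | argmin-⊆ (λ a → w (a , γ)) vs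
    ... | _ | inj₁ refl = s≤s z≤n
    ... | _ | inj₂ (y , y∈ , refl) = s≤s (s≤s (≤-trans (≤-reflexive (+-identityʳ _))
      (≤-trans (size-∈ y∈) (subst (λ z → size (list α) vs ≤ size (list α) z) (sym eq) (size-suffix us vs)))))

-- Positions count from the end of the list, so that a right fold produces them with a counter
-- starting at 0.
enum : ∀ {A : Set} → List A → List (ℕ × A)
enum []       = []
enum (x ∷ xs) = (length xs , x) ∷ enum xs

length-enum : ∀ {A : Set} (xs : List A) → length (enum xs) ≡ length xs
length-enum []       = refl
length-enum (x ∷ xs) = cong suc (length-enum xs)

enum-∈ : ∀ {A : Set} (xs : List A) {k x} → (k , x) ∈ enum xs → k < length xs × x ∈ xs
enum-∈ (x ∷ xs) (here refl) = ≤-refl , here refl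
enum-∈ (x ∷ xs) (there k∈)  = let k< , x∈ = enum-∈ xs k∈ in m≤n⇒m≤1+n k< , there x∈

opaque
  pt-enum : ∀ {Γ α xs} → PT Γ (list α) xs → PT Γ (list (nat ⊗ α)) (λ γ → enum (xs γ))
  pt-enum {Γ} {α} {xs} q = pt-ext (λ γ → cong proj₂ (counted (xs γ))) (pt-foldr
    ⟨ pt-arith add (pt-lit 1) (pt-fst ⨟ pt-fst)
    , pt-cons ⟨ pt-fst ⨟ pt-fst , pt-snd ⨟ pt-fst ⟩ (pt-fst ⨟ pt-snd) ⟩
    ⟨ pt-lit 0 , pt-nil ⟩ q
    {λ γ → suc (suc (S γ) + suc (S γ * suc (suc (suc (S γ) + S γ))))}
    (poly-suc (poly-+ (poly-suc (poly-size q)) (poly-suc (poly-* {g = S} {λ γ → suc (suc (suc (S γ) + S γ))} (poly-size q)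
      (poly-suc (poly-suc (poly-+ (poly-suc (poly-size q)) (poly-size q)))))))) bound ⨟ pt-snd)
    where
    S : ⟦ Γ ⟧ → ℕ
    S γ = size (list α) (xs γ)
    count : ⟦ α ⟧ → ℕ × List (ℕ × ⟦ α ⟧) → ℕ × List (ℕ × ⟦ α ⟧)
    count a s = suc (proj₁ s) , (proj₁ s , a) ∷ proj₂ s
    counted : ∀ xs → foldr count (0 , []) xs ≡ (length xs , enum xs)
    counted []       = refl
    counted (x ∷ xs) rewrite counted xs = refl
    bound : ∀ γ us vs → xs γ ≡ us ++ vs → size (nat ⊗ list (nat ⊗ α)) (foldr count (0 , []) vs) ≤
            suc (suc (S γ) + suc (S γ * suc (suc (suc (S γ) + S γ))))
    bound γ us vs eq rewrite counted vs = s≤s (+-mono-≤ (≤-trans (bits-≤-suc (length vs)) (s≤s len))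
      (≤-trans (size≤length* (enum vs) entry) (s≤s (*-monoˡ-≤ _ (≤-trans (≤-reflexive (length-enum vs)) len)))))
      where
      vs≤ : size (list α) vs ≤ S γ
      vs≤ = subst (λ z → size (list α) vs ≤ size (list α) z) (sym eq) (size-suffix us vs)
      len : length vs ≤ S γ
      len = ≤-trans (length≤size vs) vs≤
      entry : ∀ {x} → x ∈ enum vs → size (nat ⊗ α) x ≤ suc (suc (S γ) + S γ)
      entry {k , x} x∈ with enum-∈ vs x∈
      ... | k< , x∈vs = s≤s (+-mono-≤ (≤-trans (bits-≤-suc k) (s≤s (≤-trans (<⇒≤ k<) len)))
        (≤-trans (size-∈ x∈vs) vs≤))

-- Bounds on time are handed over as unary lists, which keeps the list of all times below them
-- polynomial in the size of the argument.
range : ∀ {A : Set} → List A → List ℕ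
range xs = map proj₁ (enum xs)

opaque
  pt-range : ∀ {Γ α xs} → PT Γ (list α) xs → PT Γ (list nat) (λ γ → range (xs γ))
  pt-range q = pt-map (pt-fst ⨟ pt-fst) (pt-enum q)

∈-range : ∀ {A : Set} (xs : List A) {k} → k < length xs → k ∈ range xs
∈-range (x ∷ xs) {k} k< with k ≟ length xs
... | yes refl = here refl
... | no k≢    = there (∈-range xs (≤∧≢⇒< (≤-pred k<) k≢))

range-< : ∀ {A : Set} (xs : List A) {k} → k ∈ range xs → k < length xs
range-< (x ∷ xs) (here refl) = ≤-refl
range-< (x ∷ xs) (there k∈)  = m≤n⇒m≤1+n (range-< xs k∈)

-- Sorting by a numerical key

insert : ∀ {A : Set} → (A → ℕ) → A → List A → List A
insert κ x ys = select (λ y → leq (suc (κ x)) (κ y)) ys ++ x ∷ select (λ y → leq (κ y) (κ x)) ys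

-- Keys descend along the list while tables work from right to left, so jobs are treated by
-- increasing key.
sort : ∀ {A : Set} → (A → ℕ) → List A → List A
sort κ = foldr (insert κ) []

module _ {A : Set} (κ : A → ℕ) where

  private
    split-↭ : ∀ k ys → select (λ y → leq (suc k) (κ y)) ys ++ select (λ y → leq (κ y) k) ys ↭ ys
    split-↭ k [] = ↭-refl
    split-↭ k (y ∷ ys) with leq (suc k) (κ y) in p | leq (κ y) k in q
    ... | yea | yea = ⊥-elim (<-irrefl refl (≤-trans (leq⁻ {suc k} p) (leq⁻ {κ y} q)))
    ... | yea | nay = prep y (split-↭ k ys)
    ... | nay | yea = ↭-trans (shift y _ _) (prep y (split-↭ k ys))
    ... | nay | nay = ⊥-elim (<-irrefl refl (≤-trans (leq-nay⁻ {κ y} q) (≤-pred (leq-nay⁻ {suc k} p))))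

  insert-↭ : ∀ x ys → insert κ x ys ↭ x ∷ ys
  insert-↭ x ys = ↭-trans (shift x _ _) (prep x (split-↭ (κ x) ys))

  sort-↭ : ∀ xs → sort κ xs ↭ xs
  sort-↭ []       = ↭-refl
  sort-↭ (x ∷ xs) = ↭-trans (insert-↭ x (sort κ xs)) (prep x (sort-↭ xs))

  sort-sorted : ∀ xs → AllPairs (λ x y → κ y ≤ κ x) (sort κ xs)
  sort-sorted []       = []
  sort-sorted (x ∷ xs) = AllPairs.++⁺ (select-AllPairs above ih)
    (All.tabulate (λ y∈ → leq⁻ (proj₁ (∈-select⁻ below ys y∈))) ∷ select-AllPairs below ih)
    (All.tabulate λ {y} y∈ → let x<y = leq⁻ {suc (κ x)} (proj₁ (∈-select⁻ above ys y∈)) in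
      <⇒≤ x<y ∷ All.tabulate λ {z} z∈ → ≤-trans (leq⁻ (proj₁ (∈-select⁻ below ys z∈))) (<⇒≤ x<y))
    where
    ys = sort κ xs
    ih = sort-sorted xs
    above below : A → Test
    above y = leq (suc (κ x)) (κ y)
    below y = leq (κ y) (κ x)

size-↭ : ∀ {α} {xs ys : List ⟦ α ⟧} → xs ↭ ys → size (list α) xs ≡ size (list α) ys
size-↭ {α} {xs} {ys} p = cong suc (trans (as-sum xs) (trans (sum-↭ (map⁺ _ p)) (sym (as-sum ys))))
  where
  as-sum : ∀ xs → foldr (λ x n → suc (size α x + n)) 0 xs ≡ sum (map (suc ∘ size α) xs)
  as-sum []       = refl
  as-sum (x ∷ xs) = cong (λ z → suc (size α x + z)) (as-sum xs)

opaque
  pt-sort : ∀ {Γ α κ xs} → PT α nat κ → PT Γ (list α) xs → PT Γ (list α) (λ γ → sort κ (xs γ))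
  pt-sort {Γ} {α} {κ} {xs} p q = pt-foldr {f = λ z → insert κ (proj₁ (proj₂ z)) (proj₁ z)}
    (pt-++ (pt-select (pt-leq (pt-arith add (pt-lit 1) (wk x ⨟ p)) (pt-fst ⨟ p)) pt-fst)
      (pt-cons x (pt-select (pt-leq (pt-fst ⨟ p) (wk x ⨟ p)) pt-fst)))
    pt-nil q (poly-size q) λ γ us vs eq → ≤-trans (≤-reflexive (size-↭ (sort-↭ κ vs)))
      (subst (λ z → size (list α) vs ≤ size (list α) z) (sym eq) (size-suffix us vs))
    where
    x : PT (list α ⊗ (α ⊗ Γ)) α (λ z → proj₁ (proj₂ z))
    x = pt-snd ⨟ pt-fst

-- Equality of lists

module _ {A : Set} (eq : A → A → Test) where

  -- The comparison has to be a fold to become a program; its state is the verdict so far and what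
  -- remains of the second list.
  match : Test × List A → A → Test × List A
  match s x = [ (λ _ → nay , []) , (λ (y , ys) → both (proj₁ s) (eq x y) , ys) ]′ (unconsF (proj₂ s))

  eqList : List A → List A → Test
  eqList xs ys = let b , zs = foldl match (yea , ys) xs in both b ([ (λ _ → yea) , (λ _ → nay) ]′ (unconsF zs))

  private
    fails : ∀ xs ys → proj₁ (foldl match (nay , ys) xs) ≡ nay
    fails []       ys       = refl
    fails (x ∷ xs) []       = fails xs []
    fails (x ∷ xs) (y ∷ ys) = fails xs ys

  eqList⁻ : (∀ {x y} → eq x y ≡ yea → x ≡ y) → ∀ xs ys → eqList xs ys ≡ yea → xs ≡ ys
  eqList⁻ sound []       []       e = refl
  eqList⁻ sound (x ∷ xs) []       e rewrite fails xs [] with e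
  ... | ()
  eqList⁻ sound (x ∷ xs) (y ∷ ys) e with eq x y in x≡y
  ... | yea = cong₂ _∷_ (sound x≡y) (eqList⁻ sound xs ys e)
  ... | nay rewrite fails xs ys with e
  ...   | ()

  eqList-refl : (∀ x → eq x x ≡ yea) → ∀ xs → eqList xs xs ≡ yea
  eqList-refl r []       = refl
  eqList-refl r (x ∷ xs) rewrite r x = eqList-refl r xs

  match-suffix : ∀ xs b ys → ∃[ zs ] ys ≡ zs ++ proj₂ (foldl match (b , ys) xs)
  match-suffix []       b ys       = [] , refl
  match-suffix (x ∷ xs) b []       = match-suffix xs nay []
  match-suffix (x ∷ xs) b (y ∷ ys) = let zs , e = match-suffix xs (both b (eq x y)) ys in y ∷ zs , cong (y ∷_) e

opaque
  pt-eqList : ∀ {Γ α eq xs ys} → PT (α ⊗ α) (unit ⊕ unit) (λ z → eq (proj₁ z) (proj₂ z)) →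
    PT Γ (list α) xs → PT Γ (list α) ys → PT Γ (unit ⊕ unit) (λ γ → eqList eq (xs γ) (ys γ))
  pt-eqList {Γ} {α} {eq} {xs} {ys} p q r = pt-foldl
    (pt-case (pt-fst ⨟ pt-snd ⨟ pt-uncons) ⟨ pt-inj₂ pt-tt , pt-nil ⟩
      ⟨ pt-both (pt-snd ⨟ pt-fst ⨟ pt-fst) (⟨ pt-snd ⨟ pt-snd ⨟ pt-fst , pt-fst ⨟ pt-fst ⟩ ⨟ p) , pt-fst ⨟ pt-snd ⟩)
    ⟨ pt-inj₁ pt-tt , r ⟩ q {λ γ → suc (2 + size (list α) (ys γ))} (poly-suc (poly-+ (poly-const 2) (poly-size r)))
    (λ γ us vs e → s≤s (+-mono-≤ (test-size (proj₁ (foldl (match eq) (yea , ys γ) us))) (suffix γ us)))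
    ⨟ pt-both pt-fst (pt-case (pt-snd ⨟ pt-uncons) (pt-inj₁ pt-tt) (pt-inj₂ pt-tt))
    where
    test-size : ∀ b → size (unit ⊕ unit) b ≤ 2
    test-size yea = ≤-refl
    test-size nay = ≤-refl
    suffix : ∀ γ us → size (list α) (proj₂ (foldl (match eq) (yea , ys γ) us)) ≤ size (list α) (ys γ)
    suffix γ us with match-suffix eq us yea (ys γ)
    ... | zs , e = subst (λ z → _ ≤ size (list α) z) (sym e) (size-suffix zs _)

-- Cheapest paths through a layered graph

-- A table holds, for every state in the universe U that is reachable at cost at
-- most b, one cheapest way to reach it.  Items are processed from right to left.
module Layered {S I D : Set} (eq : S → S → Test) (U : List S) (b : ℕ)
               (step : I → S → List (S × (ℕ × D))) where

  Entry : Set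
  Entry = S × (ℕ × List D)

  extend : Entry → S × (ℕ × D) → Entry
  extend (_ , c , ds) (s , c′ , d) = s , c + c′ , d ∷ ds

  expand : I → List Entry → List Entry
  expand i = concatMap (λ e → map (extend e) (step i (proj₁ e)))

  accepts : S → Entry → Test
  accepts u e = both (eq (proj₁ e) u) (leq (proj₁ (proj₂ e)) b)

  costOf : Entry → ℕ
  costOf e = proj₁ (proj₂ e)

  best : List Entry → S → List Entry
  best es u = argmin costOf (select (accepts u) es)

  -- At most one entry per state and none above the budget: a table is never longer than the
  -- universe, however many options a step offers.
  trim : List Entry → List Entry
  trim es = concatMap (best es) U

  table : List S → List I → List Entry
  table init = foldr (λ i es → trim (expand i es)) (trim (map (λ s → s , 0 , []) init))

  module _ (eq⁻ : ∀ {x y} → eq x y ≡ yea → x ≡ y) where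

    ∈-trim⁻ : ∀ {s c ds} es → (s , c , ds) ∈ trim es → (s , c , ds) ∈ es × s ∈ U × c ≤ b
    ∈-trim⁻ es e∈ with ∈-concatMap-elim (best es) U e∈
    ... | u , u∈ , e∈′ with ∈-select⁻ (accepts u) es (∈-argmin costOf (select (accepts u) es) e∈′)
    ...   | acc , e∈″ with both⁻ acc
    ...     | e≡u , c≤b = e∈″ , subst (_∈ U) (sym (eq⁻ e≡u)) u∈ , leq⁻ c≤b

    -- Stated for an arbitrary invariant `P`, because it serves three times: for the sizes of
    -- entries, for stages and for chains.
    table-sound : ∀ {init} (P : List I → S → ℕ → List D → Set) → (∀ {s} → s ∈ init → P [] s 0 []) →
      (∀ {i is s c ds s′ c′ d} → s ∈ U → P is s c ds → (s′ , c′ , d) ∈ step i s → P (i ∷ is) s′ (c + c′) (d ∷ ds)) →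
      ∀ is {s c ds} → (s , c , ds) ∈ table init is → P is s c ds × s ∈ U × c ≤ b
    table-sound {init} P base advance [] e∈ with ∈-trim⁻ (map (λ s → s , 0 , []) init) e∈
    ... | e∈′ , rest with ∈-map⁻ (λ s → s , 0 , []) e∈′
    ...   | s , s∈ , refl = base s∈ , rest
    table-sound {init} P base advance (i ∷ is) e∈ with ∈-trim⁻ (expand i (table init is)) e∈
    ... | e∈′ , rest with ∈-concatMap-elim (λ e → map (extend e) (step i (proj₁ e))) (table init is) e∈′
    ...   | f , f∈ , e∈″ with ∈-map⁻ (extend f) e∈″ | table-sound P base advance is f∈
    ...     | o , o∈ , refl | p , s∈U , _ = advance s∈U p o∈ , rest

  length-trim : ∀ es → length (trim es) ≤ length U
  length-trim es = go U
    where
    go : ∀ us → length (concatMap (best es) us) ≤ length us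
    go []       = z≤n
    go (u ∷ us) = ≤-trans (≤-reflexive (length-++ (best es u)))
      (+-mono-≤ (length-argmin costOf (select (accepts u) es)) (go us))

  length-table : ∀ init is → length (table init is) ≤ length U
  length-table init []       = length-trim (map (λ s → s , 0 , []) init)
  length-table init (i ∷ is) = length-trim (expand i (table init is))

  -- Only an upper bound on the stored cost: the table may know a cheaper way to the same state.
  Has : List S → List I → S → ℕ → Set
  Has init is s c = ∃[ c′ ] ∃[ ds ] (s , c′ , ds) ∈ table init is × c′ ≤ c

  module _ (eq-refl : ∀ x → eq x x ≡ yea) (eq⁻ : ∀ {x y} → eq x y ≡ yea → x ≡ y) where

    ∈-trim⁺ : ∀ {s c ds es} → (s , c , ds) ∈ es → s ∈ U → c ≤ b →
              ∃[ c′ ] ∃[ ds′ ] (s , c′ , ds′) ∈ trim es × c′ ≤ c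
    ∈-trim⁺ {s} {c} {ds} {es} e∈ s∈U c≤b
      with argmin-≤ costOf (∈-select⁺ (accepts s) (both⁺ (eq-refl s) (leq⁺ c≤b)) e∈)
    ... | (s′ , c′ , ds′) , f∈ , f≡ , c′≤c with both⁻ {eq s′ s} (proj₁ (∈-select⁻ (accepts s) es f∈))
    ...   | s′≡s , _ rewrite eq⁻ s′≡s = c′ , ds′ , ∈-concatMap-intro (best es) s∈U (subst (_ ∈_) (sym f≡) (here refl)) , c′≤c

    has-init : ∀ {init s} → s ∈ init → s ∈ U → Has init [] s 0
    has-init s∈ s∈U = ∈-trim⁺ (∈-map⁺ (λ s → s , 0 , []) s∈) s∈U z≤n

    -- The principle of optimality: what a step offers depends on the state alone, so the cheapest
    -- way stored for `s` can be extended as well.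
    has-step : ∀ {init i is s c s′ c′ d} → Has init is s c → (s′ , c′ , d) ∈ step i s → s′ ∈ U → c + c′ ≤ b →
               Has init (i ∷ is) s′ (c + c′)
    has-step {s = s} {c′ = c′} (c₁ , ds , e∈ , c₁≤c) o∈ s′∈U c≤b
      with ∈-trim⁺ (∈-concatMap-intro (λ e → map (extend e) (step _ (proj₁ e))) e∈ (∈-map⁺ (extend (s , c₁ , ds)) o∈)) s′∈U (≤-trans (+-monoˡ-≤ c′ c₁≤c) c≤b)
    ... | c₂ , ds₂ , f∈ , c₂≤ = c₂ , ds₂ , f∈ , ≤-trans c₂≤ (+-monoˡ-≤ c′ c₁≤c)

module _ {Γ S I D : Ty} {eq : ⟦ S ⟧ → ⟦ S ⟧ → Test} (eq⁻ : ∀ {x y} → eq x y ≡ yea → x ≡ y)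
         (pt-eq : PT (S ⊗ S) (unit ⊕ unit) (λ z → eq (proj₁ z) (proj₂ z)))
         {U init : ⟦ Γ ⟧ → List ⟦ S ⟧} {b : ⟦ Γ ⟧ → ℕ} {items : ⟦ Γ ⟧ → List ⟦ I ⟧}
         {f : ⟦ S ⊗ (I ⊗ Γ) ⟧ → ⟦ list (S ⊗ (nat ⊗ D)) ⟧}
         (pt-step : PT (S ⊗ (I ⊗ Γ)) (list (S ⊗ (nat ⊗ D))) f)
         (pt-U : PT Γ (list S) U) (pt-b : PT Γ nat b) (pt-init : PT Γ (list S) init) (pt-items : PT Γ (list I) items) where

  private
    E : Ty
    E = S ⊗ (nat ⊗ list D)

    module L (γ : ⟦ Γ ⟧) = Layered eq (U γ) (b γ) (λ i s → f (s , i , γ))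

    opaque
      pt-trim : ∀ {Δ es} {g : ⟦ Δ ⟧ → ⟦ Γ ⟧} → PT Δ Γ g → PT Δ (list E) es → PT Δ (list E) (λ δ → L.trim (g δ) (es δ))
      pt-trim q p = pt-concatMap (pt-argmin (pt-fst ⨟ pt-snd ⨟ pt-fst) (pt-select
        (pt-both (⟨ pt-fst ⨟ pt-fst , pt-snd ⨟ pt-fst ⟩ ⨟ pt-eq)
                 (pt-leq (pt-fst ⨟ pt-snd ⨟ pt-fst) (wk (wk q) ⨟ pt-b))) (wk p))) (q ⨟ pt-U)

      pt-expand : PT (list E ⊗ (I ⊗ Γ)) (list E) (λ z → L.expand (proj₂ (proj₂ z)) (proj₁ (proj₂ z)) (proj₁ z))
      pt-expand = pt-concatMap (pt-map
        ⟨ pt-fst ⨟ pt-fst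
        , ⟨ pt-arith add (pt-snd ⨟ pt-fst ⨟ pt-snd ⨟ pt-fst) (pt-fst ⨟ pt-snd ⨟ pt-fst)
          , pt-cons (pt-fst ⨟ pt-snd ⨟ pt-snd) (pt-snd ⨟ pt-fst ⨟ pt-snd ⨟ pt-snd) ⟩ ⟩
        (⟨ pt-fst ⨟ pt-fst , wk pt-snd ⟩ ⨟ pt-step)) pt-fst

    SU SI Bd Be Bt : ⟦ Γ ⟧ → ℕ
    SU γ = size (list S) (U γ)
    SI γ = size (list I) (items γ)
    Bd γ = (2 + suc (SU γ + suc (SI γ + size Γ γ))) ^ PT.degree pt-step
    Be γ = suc (SU γ + suc (bits (b γ) + suc (SI γ * suc (Bd γ))))
    Bt γ = suc (SU γ * suc (Be γ))

    poly-Bt : Poly (size Γ) Bt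
    poly-Bt = poly-suc (poly-* {g = SU} {λ γ → suc (Be γ)} (poly-size pt-U) (poly-suc poly-Be))
      where
      poly-Bd : Poly (size Γ) Bd
      poly-Bd = poly-time pt-step (poly-suc (poly-+ (poly-size pt-U) (poly-suc (poly-+ (poly-size pt-items) poly-measure))))
      poly-Be : Poly (size Γ) Be
      poly-Be = poly-suc (poly-+ (poly-size pt-U) (poly-suc (poly-+ (poly-size pt-b) (poly-suc
        (poly-* {g = SI} {λ γ → suc (Bd γ)} (poly-size pt-items) (poly-suc poly-Bd))))))

    -- A decision is bounded through the step that emits it: `Bd` bounds the output of that step on
    -- a state of the universe and one of the given items, whence the premise on `is`.
    Traced : ∀ γ → List ⟦ I ⟧ → ⟦ S ⟧ → ℕ → List ⟦ D ⟧ → Set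
    Traced γ is s c ds = (∀ {i} → i ∈ is → i ∈ items γ) → length ds ≡ length is × (∀ {d} → d ∈ ds → size D d ≤ Bd γ)

    traced-step : ∀ γ {i is s c ds s′ c′ d} → s ∈ U γ → Traced γ is s c ds → (s′ , c′ , d) ∈ f (s , i , γ) →
                  Traced γ (i ∷ is) s′ (c + c′) (d ∷ ds)
    traced-step γ {i} {s = s} {s′ = s′} {c′} {d} s∈ p o∈ ⊆items with p (⊆items ∘ there)
    ... | len , bnd = cong suc len , λ where
        (here refl) → begin
          size D d                                 ≤⟨ m≤n+m _ (bits c′) ⟩
          bits c′ + size D d                       ≤⟨ m≤n+m _ (2 + size S s′) ⟩
          2 + size S s′ + (bits c′ + size D d)     ≡⟨ cong suc (+-suc (size S s′) _) ⟨
          size (S ⊗ (nat ⊗ D)) (s′ , c′ , d)       ≤⟨ size-∈ o∈ ⟩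
          size (list (S ⊗ (nat ⊗ D))) (f (s , i , γ)) ≤⟨ size-result pt-step (s , i , γ) ⟩
          (2 + suc (size S s + suc (size I i + size Γ γ))) ^ PT.degree pt-step
            ≤⟨ ^-monoˡ-≤ (PT.degree pt-step) (s≤s (s≤s (s≤s (+-mono-≤ (size-∈ s∈) (s≤s (+-monoˡ-≤ (size Γ γ) (size-∈ (⊆items (here refl))))))))) ⟩
          Bd γ                                     ∎
        (there d∈) → bnd d∈
      where open ≤-Reasoning

    trace-bound : ∀ γ is {s c ds} → (s , c , ds) ∈ L.table γ (init γ) is → (∀ {i} → i ∈ is → i ∈ items γ) →
      (length ds ≡ length is × (∀ {d} → d ∈ ds → size D d ≤ Bd γ)) × s ∈ U γ × c ≤ b γ
    trace-bound γ is e∈ ⊆items with L.table-sound γ eq⁻ {init γ} (Traced γ) (λ _ _ → refl , λ ()) (λ {i} {is} {s} {c} {ds} → traced-step γ {i} {is} {s} {c} {ds}) is e∈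
    ... | p , rest = p ⊆items , rest

    table-bound : ∀ γ us vs → items γ ≡ us ++ vs → size (list E) (L.table γ (init γ) vs) ≤ Bt γ
    table-bound γ us vs e = ≤-trans (size≤length* {E} (L.table γ (init γ) vs) entry)
      (s≤s (*-monoˡ-≤ (suc (Be γ)) (≤-trans (L.length-table γ (init γ) vs) (length≤size (U γ)))))
      where
      entry : ∀ {x} → x ∈ L.table γ (init γ) vs → size E x ≤ Be γ
      entry {s , c , ds} x∈ with trace-bound γ vs x∈ (λ i∈ → subst (_ ∈_) (sym e) (∈-++⁺ʳ us i∈))
      ... | (len , bnd) , s∈ , c≤b = s≤s (+-mono-≤ (size-∈ s∈) (s≤s (+-mono-≤ (bits-mono c≤b)
        (≤-trans (size≤length* ds bnd) (s≤s (*-monoˡ-≤ (suc (Bd γ))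
          (≤-trans (≤-reflexive len) (≤-trans (length≤size vs) (subst (λ z → size (list I) vs ≤ size (list I) z) (sym e) (size-suffix us vs))))))))))

  opaque
    pt-table : PT Γ (list E) (λ γ → Layered.table eq (U γ) (b γ) (λ i s → f (s , i , γ)) (init γ) (items γ))
    pt-table = pt-foldr {f = λ z → L.trim (proj₂ (proj₂ z)) (L.expand (proj₂ (proj₂ z)) (proj₁ (proj₂ z)) (proj₁ z))}
      (pt-trim (wk pt-snd) pt-expand)
      (pt-trim {g = id} pt-id (pt-map ⟨ pt-fst , ⟨ pt-lit 0 , pt-nil ⟩ ⟩ pt-init)) pt-items poly-Bt table-bound

-- Numbers in unary and powers of two

powersUpTo : ℕ → List ℕ
powersUpTo zero    = 1 ∷ []
powersUpTo (suc n) = 2 ^ suc n ∷ powersUpTo n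

∈-powersUpTo : ∀ {i n} → i ≤ n → 2 ^ i ∈ powersUpTo n
∈-powersUpTo {zero}  {zero}  _ = here refl
∈-powersUpTo {i}     {suc n} i≤ with i ≟ suc n
... | yes refl = here refl
... | no i≢    = there (∈-powersUpTo (≤-pred (≤∧≢⇒< i≤ i≢)))

powersUpTo-∈ : ∀ n {x} → x ∈ powersUpTo n → ∃[ i ] i ≤ n × x ≡ 2 ^ i
powersUpTo-∈ zero    (here refl) = 0 , z≤n , refl
powersUpTo-∈ (suc n) (here refl) = suc n , ≤-refl , refl
powersUpTo-∈ (suc n) (there x∈)  = let i , i≤ , eq = powersUpTo-∈ n x∈ in i , m≤n⇒m≤1+n i≤ , eq

opaque
  pt-powers : ∀ {Γ α xs} → PT Γ (list α) xs → PT Γ (list nat) (λ γ → powersUpTo (length (xs γ)))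
  pt-powers {Γ} {α} {xs} q = pt-ext (λ γ → cong proj₂ (powers (xs γ))) (pt-foldr
    ⟨ double , pt-cons double (pt-fst ⨟ pt-snd) ⟩ ⟨ pt-lit 1 , pt-cons (pt-lit 1) pt-nil ⟩ q
    {λ γ → suc (suc (S γ) + suc (suc (S γ) * suc (suc (S γ))))}
    (poly-suc (poly-+ (poly-suc (poly-size q)) (poly-suc (poly-* {g = λ γ → suc (S γ)} {λ γ → suc (suc (S γ))}
      (poly-suc (poly-size q)) (poly-suc (poly-suc (poly-size q))))))) bound ⨟ pt-snd)
    where
    S : ⟦ Γ ⟧ → ℕ
    S γ = size (list α) (xs γ)
    double : PT ((nat ⊗ list nat) ⊗ (α ⊗ Γ)) nat (λ z → 2 * proj₁ (proj₁ z))
    double = pt-arith mul (pt-lit 2) (pt-fst ⨟ pt-fst)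
    push : ⟦ α ⟧ → ℕ × List ℕ → ℕ × List ℕ
    push _ s = 2 * proj₁ s , 2 * proj₁ s ∷ proj₂ s
    powers : ∀ xs → foldr push (1 , 1 ∷ []) xs ≡ (2 ^ length xs , powersUpTo (length xs))
    powers []       = refl
    powers (x ∷ xs) rewrite powers xs = refl
    length-powers : ∀ n → length (powersUpTo n) ≡ suc n
    length-powers zero    = refl
    length-powers (suc n) = cong suc (length-powers n)
    bound : ∀ γ us vs → xs γ ≡ us ++ vs → size (nat ⊗ list nat) (foldr push (1 , 1 ∷ []) vs) ≤
            suc (suc (S γ) + suc (suc (S γ) * suc (suc (S γ))))
    bound γ us vs eq rewrite powers vs = s≤s (+-mono-≤ (bits≤ ≤-refl)
      (≤-trans (size≤length* {nat} (powersUpTo (length vs)) λ {x} x∈ → let i , i≤ , e = powersUpTo-∈ (length vs) x∈ in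
          ≤-trans (≤-reflexive (cong bits e)) (bits≤ i≤))
        (s≤s (*-monoˡ-≤ (suc (suc (S γ))) (≤-trans (≤-reflexive (length-powers (length vs))) (s≤s len))))))
      where
      len : length vs ≤ S γ
      len = ≤-trans (length≤size vs) (subst (λ z → size (list α) vs ≤ size (list α) z) (sym eq) (size-suffix us vs))
      bits≤ : ∀ {i} → i ≤ length vs → bits (2 ^ i) ≤ suc (S γ)
      bits≤ {i} i≤ = ≤-trans (bits-≤ (≤-refl {2 ^ i})) (s≤s (≤-trans i≤ len))

-- Bit lengths in unary

size-units : ∀ k → size (list unit) (List.replicate k tt) ≤ suc (2 * k)
size-units k = ≤-trans (size≤length* {unit} (List.replicate k tt) (λ _ → ≤-refl))
  (s≤s (≤-trans (≤-reflexive (cong (_* 2) (length-replicate k))) (≤-reflexive (*-comm k 2))))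

⌊n/2⌋≡n/2 : ∀ n → ⌊ n /2⌋ ≡ n / 2
⌊n/2⌋≡n/2 zero          = refl
⌊n/2⌋≡n/2 (suc zero)    = refl
⌊n/2⌋≡n/2 (suc (suc n)) = sym (trans (+-distrib-/-∣ˡ {2} n {2} (divides 1 refl)) (cong suc (sym (⌊n/2⌋≡n/2 n))))

module _ where

  private
    St : Ty
    St = nat ⊗ list unit

    halve : ℕ × List ⊤ → (ℕ × List ⊤) ⊎ List ⊤
    halve (n , us) = ite (leq n 1) (inj₂ (tt ∷ us)) (inj₁ (n / 2 , tt ∷ us))

    units : ℕ → List ⊤
    units k = List.replicate k tt

    B : ℕ → ℕ
    B n = suc (bits n + suc (2 * bits n))

    HalvingLoop : ℕ → ℕ → Set
    HalvingLoop N n = ∀ k → bits n + k ≤ bits N →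
      Loop halve (λ z → size St z ≤ B N) (n , units k) (units (bits n + k)) ⌊log₂ n ⌋

    halving : ∀ N n → HalvingLoop N n
    halving N = <-rec _ go
      where
      fits : ∀ n k → bits n + k ≤ bits N → size St (n , units k) ≤ B N
      fits n k k≤ = s≤s (+-mono-≤ (≤-trans (m≤m+n _ k) k≤)
        (≤-trans (size-units k) (s≤s (*-monoʳ-≤ 2 (≤-trans (m≤n+m k (bits n)) k≤)))))
      go : ∀ n → (∀ {m} → m < n → HalvingLoop N m) → HalvingLoop N n
      go 0 _ k k≤ = stop (fits 0 k k≤) refl
      go 1 _ k k≤ = stop (fits 1 k k≤) refl
      go n@(suc (suc m)) rec k k≤ = subst (Loop halve (λ z → size St z ≤ B N) (n , units k) (units (bits n + k))) (suc-injective bits-half)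
        (next (fits n k k≤) (cong (λ q → inj₁ (q , units (suc k))) (sym (⌊n/2⌋≡n/2 n)))
          (subst (λ j → Loop halve (λ z → size St z ≤ B N) (⌊ n /2⌋ , units (suc k)) (units j) ⌊log₂ ⌊ n /2⌋ ⌋) shift-k
            (rec (⌊n/2⌋<n (suc m)) (suc k) (≤-trans (≤-reflexive shift-k) k≤))))
        where
        bits-half : suc (bits ⌊ n /2⌋) ≡ bits n
        bits-half = cong (2 +_) (⌊log₂⌊n/2⌋⌋≡⌊log₂n⌋∸1 n)
        shift-k : bits ⌊ n /2⌋ + suc k ≡ bits n + k
        shift-k = trans (+-suc (bits ⌊ n /2⌋) k) (cong (_+ k) bits-half)

  opaque
    -- The bit length, not the number itself: it tells how often a scale has to double to reach the
    -- number, and in unary it is still linear in the input.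
    pt-bits : PT nat (list unit) (λ n → List.replicate (bits n) tt)
    pt-bits = pt-iterate {σ = St} {f = halve} ⟨ pt-id , pt-nil ⟩
      (pt-ite (pt-leq pt-fst (pt-lit 1)) (pt-inj₂ (pt-cons pt-tt pt-snd))
        (pt-inj₁ ⟨ pt-arith quot pt-fst (pt-lit 2) , pt-cons pt-tt pt-snd ⟩))
      {B} (poly-suc (poly-+ poly-measure (poly-suc (poly-* (poly-const 2) poly-measure)))) poly-measure λ n →
      ⌊log₂ n ⌋ , subst (λ k → Loop halve (λ z → size St z ≤ B n) (n , []) (units k) ⌊log₂ n ⌋) (+-identityʳ (bits n))
        (halving n n 0 (≤-reflexive (+-identityʳ (bits n)))) , n≤1+n _

zipL : ∀ {A B : Set} → List A → List B → List (A × B)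
zipL []       _        = []
zipL (x ∷ xs) []       = []
zipL (x ∷ xs) (y ∷ ys) = (x , y) ∷ zipL xs ys

opaque
  pt-zip : ∀ {Γ α β xs ys} → PT Γ (list α) xs → PT Γ (list β) ys → PT Γ (list (α ⊗ β)) (λ γ → zipL (xs γ) (ys γ))
  pt-zip {Γ} {α} {β} {xs} {ys} p q = pt-ext (λ γ → reversed γ)
    (pt-reverse (pt-foldl {f = λ z → pick (proj₁ z) (proj₁ (proj₂ z))}
      (pt-case (pt-fst ⨟ pt-fst ⨟ pt-uncons) ⟨ pt-nil , wk pt-fst ⨟ pt-snd ⟩
        ⟨ pt-fst ⨟ pt-snd , pt-cons ⟨ pt-snd ⨟ pt-snd ⨟ pt-fst , pt-fst ⨟ pt-fst ⟩ (pt-snd ⨟ pt-fst ⨟ pt-snd) ⟩)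
      ⟨ q , pt-nil ⟩ p {λ γ → suc (size (list β) (ys γ) + 1 + size (list α) (xs γ))}
      (poly-suc (poly-+ (poly-+ (poly-size q) (poly-const 1)) (poly-size p)))
      (λ γ us vs e → ≤-trans (bounded us (ys γ) []) (s≤s (+-monoʳ-≤ (size (list β) (ys γ) + 1)
        (subst (λ z → size (list α) us ≤ size (list α) z) (sym e) (size-prefix us vs)))))
      ⨟ pt-snd))
    where
    pick : List ⟦ β ⟧ × List (⟦ α ⟧ × ⟦ β ⟧) → ⟦ α ⟧ → List ⟦ β ⟧ × List (⟦ α ⟧ × ⟦ β ⟧)
    pick s x = [ (λ _ → [] , proj₂ s) , (λ (y , ys) → ys , (x , y) ∷ proj₂ s) ]′ (unconsF (proj₁ s))
    zipped : ∀ xs ys acc → proj₂ (foldl pick (ys , acc) xs) ≡ zipL xs ys ʳ++ acc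
    zipped []       ys       acc = refl
    zipped (x ∷ xs) []       acc = exhausted xs
      where
      exhausted : ∀ xs → proj₂ (foldl pick ([] , acc) xs) ≡ acc
      exhausted []       = refl
      exhausted (_ ∷ xs) = exhausted xs
    zipped (x ∷ xs) (y ∷ ys) acc = zipped xs ys ((x , y) ∷ acc)
    reversed : ∀ γ → reverse (proj₂ (foldl pick (ys γ , []) (xs γ))) ≡ zipL (xs γ) (ys γ)
    reversed γ = trans (cong reverse (zipped (xs γ) (ys γ) [])) (trans (ʳ++-ʳ++ (zipL (xs γ) (ys γ))) (++-identityʳ _))
    bounded : ∀ us ys acc → size (list β ⊗ list (α ⊗ β)) (foldl pick (ys , acc) us) ≤
              suc (size (list β) ys + size (list (α ⊗ β)) acc + size (list α) us)
    bounded []       ys acc = s≤s (m≤m+n _ 1)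
    bounded (u ∷ us) [] acc = ≤-trans (bounded us [] acc) (s≤s (+-monoʳ-≤ (1 + size (list (α ⊗ β)) acc) (size-suffix (u ∷ []) us)))
    bounded (u ∷ us) (y ∷ ys) acc = ≤-trans (bounded us ys ((u , y) ∷ acc))
      (≤-reflexive (cong suc (lemma (size α u) (size β y) (fold′ β ys) (fold′ (α ⊗ β) acc) (fold′ α us))))
      where
      fold′ : ∀ τ → List ⟦ τ ⟧ → ℕ
      fold′ τ = foldr (λ x n → suc (size τ x + n)) 0
      lemma : ∀ u y ys acc us → suc ys + suc (suc (suc (u + y) + acc)) + suc us ≡ suc (suc (y + ys)) + suc acc + suc (suc (u + us))
      lemma = solve-∀

-- The algorithm

infixl 10 _⟨1⟩ _⟨2⟩

_⟨1⟩ : ∀ {Γ σ τ f} → PT Γ (σ ⊗ τ) f → PT Γ σ (λ γ → proj₁ (f γ))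
p ⟨1⟩ = p ⨟ pt-fst

_⟨2⟩ : ∀ {Γ σ τ f} → PT Γ (σ ⊗ τ) f → PT Γ τ (λ γ → proj₂ (f γ))
p ⟨2⟩ = p ⨟ pt-snd

either : Test → Test → Test
either b c = ite b yea c

SlotTy StateTy ViewTy DecisionTy : Ty
SlotTy     = nat ⊗ nat
StateTy    = list SlotTy ⊗ nat
ViewTy     = nat ⊗ (nat ⊗ (nat ⊗ (nat ⊗ (nat ⊗ (nat ⊗ nat)))))
DecisionTy = nat ⊗ (SideTy ⊗ (nat ⊗ (nat ⊗ nat)))

-- A parallel job as seen by a stage whose two ends have fixed sides: sorting
-- key; release time, processing time and tail on the server; completion time
-- and completion time plus tail on the cloud; cost of the cloud.
View : Set
View = ⟦ ViewTy ⟧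

key release work tail cloudEnd cloudSpan price : View → ℕ
key       v = proj₁ v
release   v = proj₁ (proj₂ v)
work      v = proj₁ (proj₂ (proj₂ v))
tail      v = proj₁ (proj₂ (proj₂ (proj₂ v)))
cloudEnd  v = proj₁ (proj₂ (proj₂ (proj₂ (proj₂ v))))
cloudSpan v = proj₁ (proj₂ (proj₂ (proj₂ (proj₂ (proj₂ v)))))
price     v = proj₂ (proj₂ (proj₂ (proj₂ (proj₂ (proj₂ v)))))

Slot State Decision : Set
Slot     = ⟦ SlotTy ⟧
State    = ⟦ StateTy ⟧
Decision = ⟦ DecisionTy ⟧

position-of : Decision → ℕ
position-of d = proj₁ d

place : Decision → ⟦ SideTy ⊗ nat ⟧
place d = proj₁ (proj₂ d) , proj₁ (proj₂ (proj₂ (proj₂ d)))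

-- Dropping whatever overlaps a used slot also drops the slot itself, unless it
-- is empty: jobs of length 0 can share an empty slot.
clear : Slot → List Slot → List Slot
clear s = select (λ s′ → either (leq (proj₂ s) (proj₁ s′)) (leq (proj₂ s′) (proj₁ s)))

toCloud toEnd : ℕ → ℕ × View → State → List (State × (ℕ × Decision))
toCloud L (i , v) s = guard (leq (cloudSpan v) L)
  -- The 0 is a dummy start, since starts are inspected for server decisions only.
  ((s , price v , i , nay , 0 , cloudEnd v , price v) ∷ [])
-- The job starts at the maximum of load and release time.
toEnd L (i , v) (sl , load) = guard (leq (load + (release v ∸ load) + work v + tail v) L)
  (((sl , load + (release v ∸ load) + work v) , 0 , i , yea , load + (release v ∸ load) , load + (release v ∸ load) + work v , 0) ∷ [])

-- A slot is guessed as the exact interval of a job, so starting at its left end loses nothing.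
toSlot : ℕ → ℕ × View → State → Slot → List (State × (ℕ × Decision))
toSlot L (i , v) (sl , load) s = guard (both (leq (release v) (proj₁ s)) (both (leq (proj₁ s + work v) (proj₂ s)) (leq (proj₁ s + work v + tail v) L)))
  (((clear s sl , load) , 0 , i , yea , proj₁ s , proj₁ s + work v , 0) ∷ [])

options : ℕ → ℕ × View → State → List (State × (ℕ × Decision))
options L it st = toCloud L it st ++ (toEnd L it st ++ concatMap (toSlot L it st) (proj₁ st))

eqSlot : Slot → Slot → Test
eqSlot s s′ = both (eqℕ (proj₁ s) (proj₁ s′)) (eqℕ (proj₂ s) (proj₂ s′))

eqState : State → State → Test
eqState st st′ = both (eqList eqSlot (proj₁ st) (proj₁ st′)) (eqℕ (proj₂ st) (proj₂ st′))

-- The recursion on the number of slots takes place outside the programming language. For fixed `k`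
-- the result has polynomially many elements, with two times of `R` for each slot.
slotLists : ℕ → List ℕ → List (List Slot)
slotLists zero    R = [] ∷ []
slotLists (suc k) R = [] ∷ concatMap (λ x → concatMap (λ y → map ((x , y) ∷_) (slotLists k R)) R) R

-- All guesses of slots and load are tried at once. The initial load is the time from which jobs
-- without a slot may run, so slots that end later are dropped.
universe initial : ℕ → List ℕ → List State
universe K R = concatMap (λ sl → map (sl ,_) R) (slotLists K R)
initial  K R = map (λ st → select (λ s → leq (proj₂ s) (proj₂ st)) (proj₁ st) , proj₂ st) (universe K R)

itemKey : ℕ × View → ℕ
itemKey it = key (proj₂ it)

StageEntryTy : Ty
StageEntryTy = StateTy ⊗ (nat ⊗ list DecisionTy)

stageTable : ℕ → ℕ → List ℕ → ℕ → List (ℕ × View) → List ⟦ StageEntryTy ⟧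
stageTable K b R L its = Layered.table eqState (universe K R) b (options L) (initial K R) (sort itemKey its)

-- Decisions come in sorted order; the recorded positions bring them back into the order of the
-- jobs. For the traces of a stage table the default never applies.
placeOf : List Decision → ℕ → ⟦ SideTy ⊗ nat ⟧
placeOf ds i = [ (λ _ → yea , 0) , (λ (d , _) → place d) ]′ (unconsF (select (λ d → eqℕ (position-of d) i) ds))

gap : ⟦ SideTy ⟧ → ⟦ SideTy ⟧ → ℕ → ℕ
gap a b c = ite a (ite b 0 c) (ite b c 0)

viewOf : (ℕ → ℕ) → ⟦ SideTy ⟧ → ⟦ SideTy ⟧ → ℕ → ⟦ ParallelJobTy ⟧ → View
viewOf h a b L ((ps , pc) , (cᵢₙ , cₒᵤₜ)) =
  -- If the next chain job is on the server, tails vanish and release times decide. Otherwise `L`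
  -- minus the tail is a due date, and ordering by due dates is Jackson's rule.
  ite b (gap a yea (h cᵢₙ)) (L ∸ gap yea b (h cₒᵤₜ)) ,
  gap a yea (h cᵢₙ) , h ps , gap yea b (h cₒᵤₜ) ,
  gap a nay (h cᵢₙ) + h pc , gap a nay (h cᵢₙ) + h pc + gap nay b (h cₒᵤₜ) , pc

Places : Set
Places = List ⟦ SideTy ⊗ nat ⟧

stageItems : (ℕ → ℕ) → ⟦ SideTy ⟧ → ⟦ SideTy ⟧ → ℕ → List ⟦ ParallelJobTy ⟧ → List (ℕ × View)
stageItems h a b L js = map (λ ij → proj₁ ij , viewOf h a b L (proj₂ ij)) (enum js)

-- One table for each length `L` of the stage, because the due dates depend on it.
parallelOptions : ℕ → (ℕ → ℕ) → ℕ → List ℕ → ⟦ SideTy ⟧ → ⟦ SideTy ⟧ → List ⟦ ParallelJobTy ⟧ → List (ℕ × (ℕ × Places))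
parallelOptions K h B R a b js = concatMap (λ L →
  map (λ e → L , proj₁ (proj₂ e) , map (λ ij → placeOf (proj₂ (proj₂ e)) (proj₁ ij)) (enum js))
      (stageTable K B R L (stageItems h a b L js))) R

stageOptions : ℕ → (ℕ → ℕ) → ℕ → List ℕ → ⟦ SideTy ⟧ → ⟦ SideTy ⟧ → ⟦ LinkTy ⟧ → List (ℕ × (ℕ × Places))
stageOptions K h B R a b l =
  [ (λ c → map (λ L → L , 0 , []) (select (λ L → leq (gap a b (h c)) L) R))
  , (λ jjs → parallelOptions K h B R a b (proj₁ jjs ∷ proj₂ jjs)) ]′ l

ChainItemTy ChainDecisionTy ChainEntryTy : Ty
ChainItemTy     = LinkTy ⊗ (nat ⊗ list nat)
ChainDecisionTy = (SideTy ⊗ nat) ⊗ list (SideTy ⊗ nat)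
ChainEntryTy    = (SideTy ⊗ nat) ⊗ (nat ⊗ list ChainDecisionTy)

choices : (ℕ → ℕ) → ⟦ nat ⊗ list nat ⟧ → List ⟦ SideTy ⊗ (nat ⊗ nat) ⟧
choices h job = (yea , h (proj₁ job) , 0) ∷ map (λ pc → nay , h pc , pc) (proj₂ job)

-- The state after a link is the side and the starting time of its left end.
advance : ℕ → ⟦ SideTy ⊗ (nat ⊗ nat) ⟧ → ℕ × (ℕ × Places) → List (⟦ SideTy ⊗ nat ⟧ × (ℕ × ⟦ ChainDecisionTy ⟧))
advance S (a , p , c) (L , c′ , pl) = guard (leq (p + L) S)
  (((a , S ∸ (p + L)) , c + c′ , (a , S ∸ L) , map (λ x → proj₁ x , S ∸ L + proj₂ x) pl) ∷ [])

chainStep : ℕ → (ℕ → ℕ) → ℕ → List ℕ → ⟦ ChainItemTy ⟧ → ⟦ SideTy ⊗ nat ⟧ → List (⟦ SideTy ⊗ nat ⟧ × (ℕ × ⟦ ChainDecisionTy ⟧))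
chainStep K h B R (l , job) (b , S) =
  concatMap (λ ch → concatMap (advance S ch) (stageOptions K h B R (proj₁ ch) b l)) (choices h job)

eqTest : Test → Test → Test
eqTest b c = ite b c (ite c nay yea)

eqChainState : ⟦ SideTy ⊗ nat ⟧ → ⟦ SideTy ⊗ nat ⟧ → Test
eqChainState s s′ = both (eqTest (proj₁ s) (proj₁ s′)) (eqℕ (proj₂ s) (proj₂ s′))

chainUniverse : List ℕ → List ⟦ SideTy ⊗ nat ⟧
chainUniverse R = concatMap (λ S → (yea , S) ∷ (nay , S) ∷ []) R

opaque
  chainTable : ℕ → (ℕ → ℕ) → ℕ → List ℕ → ℕ → List ⟦ ChainItemTy ⟧ → List ⟦ ChainEntryTy ⟧
  chainTable K h B R T its = Layered.table eqChainState (chainUniverse R) B (chainStep K h B R) ((yea , T) ∷ []) its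

-- ⌈ x / δ ⌉, for δ > 0.
scale : ℕ → ℕ → ℕ
scale δ x = arith quot (x + (δ ∸ 1)) δ

output : ℕ → ℕ → List ⟦ ChainDecisionTy ⟧ → Places
output δ T ds = map (λ x → proj₁ x , δ * proj₂ x) (concatMap (λ D → proj₁ D ∷ proj₂ D) ds ++ (yea , T) ∷ [])

-- The empty list of cloud times keeps the source off the cloud, where its processing time is
-- infinite. The sink is not an item but the initial state of the table.
chainItems : ⟦ ChainTy ⟧ → List ⟦ ChainItemTy ⟧
chainItems X = zipL (proj₂ X) ((0 , []) ∷ map (λ j → proj₁ j , proj₂ j ∷ []) (proj₁ X))

-- In unary, a bound on what rounding adds to the length of a plan.
weights : List ⟦ LinkTy ⟧ → List ⊤
weights = concatMap (λ l → [ (λ _ → tt ∷ tt ∷ tt ∷ tt ∷ []) , (λ jjs → tt ∷ tt ∷ tt ∷ tt ∷ map (λ _ → tt) (proj₁ jjs ∷ proj₂ jjs)) ]′ l)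

units : ℕ → List ⊤
units n = List.replicate (bits n) tt

-- The length bounds each single bit length, so at the last scale every server processing time
-- rounds to at most 1.
serverBits : ⟦ ChainTy ⟧ → List ⊤
serverBits X = concatMap (λ j → units (proj₁ j)) (proj₁ X) ++
  concatMap (λ l → [ (λ _ → []) , (λ jjs → concatMap (λ j → units (proj₁ (proj₁ j))) (proj₁ jjs ∷ proj₂ jjs)) ]′ l) (proj₂ X)

InTy : Ty
InTy = (ChainTy ⊗ nat) ⊗ list unit

-- One element more than the largest makespan considered, because `range` stops just below the
-- length.
horizon : ⟦ InTy ⟧ → List ⊤
horizon ((X , _) , us) = tt ∷ (weights (proj₂ X) ++ concatMap (λ _ → concatMap (λ _ → tt ∷ tt ∷ []) us) (tt ∷ weights (proj₂ X)))

times : ⟦ InTy ⟧ → List ℕ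
times I = range (horizon I)

scales : ⟦ InTy ⟧ → List ℕ
scales ((X , _) , _) = powersUpTo (length (serverBits X))

-- Entries are accepted whatever the starting time of the source, as a schedule that begins late is
-- still a schedule.
candidates : ℕ → ⟦ InTy ⟧ → List (ℕ × Places)
candidates K I = concatMap (λ δ → concatMap (λ T → map (λ e → δ * T , output δ T (proj₂ (proj₂ e)))
    (chainTable K (scale δ) (proj₂ (proj₁ I)) (times I) T (chainItems (proj₁ (proj₁ I))))) (times I)) (scales I)

opaque
  solve : ℕ → ⟦ InTy ⟧ → Places
  solve K I = [ (λ _ → []) , (λ x → proj₂ (proj₁ x)) ]′ (unconsF (argmin proj₁ (candidates K I)))

-- The algorithm runs in polynomial time

opaque
  pt-either : ∀ {Γ b c} → PT Γ (unit ⊕ unit) b → PT Γ (unit ⊕ unit) c → PT Γ (unit ⊕ unit) (λ γ → either (b γ) (c γ))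
  pt-either p q = pt-ite p (pt-inj₁ pt-tt) q

  pt-one : ∀ {Γ α f} → PT Γ α f → PT Γ (list α) (λ γ → f γ ∷ [])
  pt-one p = pt-cons p pt-nil

  pt-+ : ∀ {Γ f g} → PT Γ nat f → PT Γ nat g → PT Γ nat (λ γ → f γ + g γ)
  pt-+ = pt-arith add

  pt-∸ : ∀ {Γ f g} → PT Γ nat f → PT Γ nat g → PT Γ nat (λ γ → f γ ∸ g γ)
  pt-∸ = pt-arith monus

  pt-yea : ∀ {Γ} → PT Γ (unit ⊕ unit) (λ _ → yea)
  pt-yea = pt-inj₁ pt-tt

  pt-nay : ∀ {Γ} → PT Γ (unit ⊕ unit) (λ _ → nay)
  pt-nay = pt-inj₂ pt-tt

opaque
  pt-clear : ∀ {Γ s sl} → PT Γ SlotTy s → PT Γ (list SlotTy) sl → PT Γ (list SlotTy) (λ γ → clear (s γ) (sl γ))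
  pt-clear s sl = pt-select (pt-either (pt-leq (wk s ⟨2⟩) (pt-fst ⟨1⟩)) (pt-leq (pt-fst ⟨2⟩) (wk s ⟨1⟩))) sl

private
  ViewPart : (View → ℕ) → Set
  ViewPart f = ∀ {Δ v} → PT Δ ViewTy v → PT Δ nat (λ δ → f (v δ))

opaque
  pt-key : ViewPart key
  pt-key v = v ⟨1⟩

  pt-release : ViewPart release
  pt-release v = v ⟨2⟩ ⟨1⟩

  pt-work : ViewPart work
  pt-work v = v ⟨2⟩ ⟨2⟩ ⟨1⟩

  pt-tail : ViewPart tail
  pt-tail v = v ⟨2⟩ ⟨2⟩ ⟨2⟩ ⟨1⟩

  pt-cloudEnd : ViewPart cloudEnd
  pt-cloudEnd v = v ⟨2⟩ ⟨2⟩ ⟨2⟩ ⟨2⟩ ⟨1⟩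

  pt-cloudSpan : ViewPart cloudSpan
  pt-cloudSpan v = v ⟨2⟩ ⟨2⟩ ⟨2⟩ ⟨2⟩ ⟨2⟩ ⟨1⟩

  pt-price : ViewPart price
  pt-price v = v ⟨2⟩ ⟨2⟩ ⟨2⟩ ⟨2⟩ ⟨2⟩ ⟨2⟩

module _ {Γ L it st} (pL : PT Γ nat L) (pit : PT Γ (nat ⊗ ViewTy) it) (pst : PT Γ StateTy st) where
  private
    opaque
      v : PT Γ ViewTy (λ γ → proj₂ (it γ))
      v = pit ⟨2⟩
    opaque
      cloud′ : PT Γ (list (StateTy ⊗ (nat ⊗ DecisionTy))) (λ γ → toCloud (L γ) (it γ) (st γ))
      cloud′ = pt-guard (pt-leq (pt-cloudSpan v) pL)
        (pt-one ⟨ pst , ⟨ pt-price v , ⟨ pit ⟨1⟩ , ⟨ pt-nay , ⟨ pt-lit 0 , ⟨ pt-cloudEnd v , pt-price v ⟩ ⟩ ⟩ ⟩ ⟩ ⟩)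
    opaque
      from : PT Γ nat (λ γ → proj₂ (st γ) + (release (proj₂ (it γ)) ∸ proj₂ (st γ)))
      from = pt-+ (pst ⟨2⟩) (pt-∸ (pt-release v) (pst ⟨2⟩))
    opaque
      end : PT Γ (list (StateTy ⊗ (nat ⊗ DecisionTy))) (λ γ → toEnd (L γ) (it γ) (st γ))
      end = pt-guard (pt-leq (pt-+ (pt-+ from (pt-work v)) (pt-tail v)) pL)
        (pt-one ⟨ ⟨ pst ⟨1⟩ , pt-+ from (pt-work v) ⟩ , ⟨ pt-lit 0 , ⟨ pit ⟨1⟩ , ⟨ pt-yea , ⟨ from , ⟨ pt-+ from (pt-work v) , pt-lit 0 ⟩ ⟩ ⟩ ⟩ ⟩ ⟩)
    opaque
      till : PT (SlotTy ⊗ Γ) nat (λ z → proj₁ (proj₁ z) + work (proj₂ (it (proj₂ z))))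
      till = pt-+ (pt-fst ⟨1⟩) (pt-work (wk v))
    opaque
      slot : PT (SlotTy ⊗ Γ) (list (StateTy ⊗ (nat ⊗ DecisionTy))) (λ z → toSlot (L (proj₂ z)) (it (proj₂ z)) (st (proj₂ z)) (proj₁ z))
      slot = pt-guard (pt-both (pt-leq (pt-release (wk v)) (pt-fst ⟨1⟩)) (pt-both (pt-leq till (pt-fst ⟨2⟩)) (pt-leq (pt-+ till (pt-tail (wk v))) (wk pL))))
        (pt-one ⟨ ⟨ pt-clear pt-fst (wk pst ⟨1⟩) , wk pst ⟨2⟩ ⟩ , ⟨ pt-lit 0 , ⟨ wk pit ⟨1⟩ , ⟨ pt-yea , ⟨ pt-fst ⟨1⟩ , ⟨ till , pt-lit 0 ⟩ ⟩ ⟩ ⟩ ⟩ ⟩)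
  opaque
    pt-options : PT Γ (list (StateTy ⊗ (nat ⊗ DecisionTy))) (λ γ → options (L γ) (it γ) (st γ))
    pt-options = pt-++ cloud′ (pt-++ end (pt-concatMap slot (pst ⟨1⟩)))

opaque
  pt-eqSlot : PT (SlotTy ⊗ SlotTy) (unit ⊕ unit) (λ z → eqSlot (proj₁ z) (proj₂ z))
  pt-eqSlot = pt-both (pt-eqℕ (pt-fst ⟨1⟩) (pt-snd ⟨1⟩)) (pt-eqℕ (pt-fst ⟨2⟩) (pt-snd ⟨2⟩))

  pt-eqState : PT (StateTy ⊗ StateTy) (unit ⊕ unit) (λ z → eqState (proj₁ z) (proj₂ z))
  pt-eqState = pt-both (pt-eqList {eq = eqSlot} pt-eqSlot (pt-fst ⟨1⟩) (pt-snd ⟨1⟩)) (pt-eqℕ (pt-fst ⟨2⟩) (pt-snd ⟨2⟩))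

  pt-slotLists : ∀ K {Γ R} → PT Γ (list nat) R → PT Γ (list (list SlotTy)) (λ γ → slotLists K (R γ))
  pt-slotLists zero    r = pt-one pt-nil
  pt-slotLists (suc K) r = pt-cons pt-nil (pt-concatMap (pt-concatMap (pt-map
    (pt-cons ⟨ wk (wk pt-fst) , wk pt-fst ⟩ pt-fst) (wk (wk (pt-slotLists K r)))) (wk r)) r)

  pt-universe : ∀ K {Γ R} → PT Γ (list nat) R → PT Γ (list StateTy) (λ γ → universe K (R γ))
  pt-universe K r = pt-concatMap (pt-map ⟨ wk pt-fst , pt-fst ⟩ (wk r)) (pt-slotLists K r)

  pt-initial : ∀ K {Γ R} → PT Γ (list nat) R → PT Γ (list StateTy) (λ γ → initial K (R γ))
  pt-initial K r = pt-map ⟨ pt-select (pt-leq (pt-fst ⟨2⟩) (wk pt-fst ⟨2⟩)) (pt-fst ⟨1⟩) , pt-fst ⟨2⟩ ⟩ (pt-universe K r)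

eqSlot⁻ : ∀ {s s′} → eqSlot s s′ ≡ yea → s ≡ s′
eqSlot⁻ {s} {s′} e with both⁻ {eqℕ (proj₁ s) (proj₁ s′)} e
... | p , q = cong₂ _,_ (eqℕ⁻ p) (eqℕ⁻ q)

eqSlot-refl : ∀ s → eqSlot s s ≡ yea
eqSlot-refl s = both⁺ (eqℕ-refl (proj₁ s)) (eqℕ-refl (proj₂ s))

eqState⁻ : ∀ {s s′} → eqState s s′ ≡ yea → s ≡ s′
eqState⁻ {s} {s′} e with both⁻ {eqList eqSlot (proj₁ s) (proj₁ s′)} e
... | p , q = cong₂ _,_ (eqList⁻ eqSlot eqSlot⁻ (proj₁ s) (proj₁ s′) p) (eqℕ⁻ q)

eqState-refl : ∀ s → eqState s s ≡ yea
eqState-refl s = both⁺ (eqList-refl eqSlot eqSlot-refl (proj₁ s)) (eqℕ-refl (proj₂ s))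

eqChainState⁻ : ∀ {s s′} → eqChainState s s′ ≡ yea → s ≡ s′
eqChainState⁻ {s} {s′} e with both⁻ {eqTest (proj₁ s) (proj₁ s′)} e
... | p , q = cong₂ _,_ (eqTest⁻ (proj₁ s) (proj₁ s′) p) (eqℕ⁻ q)
  where
  eqTest⁻ : ∀ b c → eqTest b c ≡ yea → b ≡ c
  eqTest⁻ yea yea _ = refl
  eqTest⁻ nay nay _ = refl

eqChainState-refl : ∀ s → eqChainState s s ≡ yea
eqChainState-refl (yea , n) = eqℕ-refl n
eqChainState-refl (nay , n) = eqℕ-refl n

opaque
  pt-stageTable : ∀ K {Γ b R L its} → PT Γ nat b → PT Γ (list nat) R → PT Γ nat L → PT Γ (list (nat ⊗ ViewTy)) its →
                  PT Γ (list StageEntryTy) (λ γ → stageTable K (b γ) (R γ) (L γ) (its γ))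
  pt-stageTable K {L = L} pb pR pL pits = pt-table {eq = eqState} eqState⁻ pt-eqState
    {f = λ z → options (L (proj₂ (proj₂ z))) (proj₁ (proj₂ z)) (proj₁ z)}
    (pt-options (wk (wk pL)) (pt-snd ⟨1⟩) pt-fst) (pt-universe K pR) pb (pt-initial K pR)
    (pt-sort {κ = itemKey} (pt-key pt-snd) pits)

  pt-placeOf : ∀ {Γ ds i} → PT Γ (list DecisionTy) ds → PT Γ nat i → PT Γ (SideTy ⊗ nat) (λ γ → placeOf (ds γ) (i γ))
  pt-placeOf p q = pt-case (pt-select (pt-eqℕ (pt-fst ⟨1⟩) (wk q)) p ⨟ pt-uncons) ⟨ pt-yea , pt-lit 0 ⟩
    ⟨ pt-fst ⟨1⟩ ⟨2⟩ ⟨1⟩ , pt-fst ⟨1⟩ ⟨2⟩ ⟨2⟩ ⟨2⟩ ⟨1⟩ ⟩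

  pt-gap : ∀ {Γ a b c} → PT Γ SideTy a → PT Γ SideTy b → PT Γ nat c → PT Γ nat (λ γ → gap (a γ) (b γ) (c γ))
  pt-gap a b c = pt-ite a (pt-ite b (pt-lit 0) c) (pt-ite b c (pt-lit 0))

  pt-scale : ∀ {Γ δ x} → PT Γ nat δ → PT Γ nat x → PT Γ nat (λ γ → scale (δ γ) (x γ))
  pt-scale d x = pt-arith quot (pt-+ x (pt-∸ d (pt-lit 1))) d

  pt-viewOf : ∀ {Γ δ a b L j} → PT Γ nat δ → PT Γ SideTy a → PT Γ SideTy b → PT Γ nat L → PT Γ ParallelJobTy j →
              PT Γ ViewTy (λ γ → viewOf (scale (δ γ)) (a γ) (b γ) (L γ) (j γ))
  pt-viewOf {Γ} {δ} {a} {j = j} pd pa pb pL pj =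
    ⟨ pt-ite pb (pt-gap pa pt-yea cin) (pt-∸ pL (pt-gap pt-yea pb cout))
    , ⟨ pt-gap pa pt-yea cin , ⟨ pt-scale pd (pj ⟨1⟩ ⟨1⟩) , ⟨ pt-gap pt-yea pb cout
    , ⟨ end , ⟨ pt-+ end (pt-gap pt-nay pb cout) , pj ⟨1⟩ ⟨2⟩ ⟩ ⟩ ⟩ ⟩ ⟩ ⟩
    where
    cin : PT Γ nat (λ γ → scale (δ γ) (proj₁ (proj₂ (j γ))))
    cin = pt-scale pd (pj ⟨2⟩ ⟨1⟩)
    cout : PT Γ nat (λ γ → scale (δ γ) (proj₂ (proj₂ (j γ))))
    cout = pt-scale pd (pj ⟨2⟩ ⟨2⟩)
    end : PT Γ nat (λ γ → gap (a γ) nay (scale (δ γ) (proj₁ (proj₂ (j γ)))) + scale (δ γ) (proj₂ (proj₁ (j γ))))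
    end = pt-+ (pt-gap pa pt-nay cin) (pt-scale pd (pj ⟨1⟩ ⟨2⟩))

  pt-stageItems : ∀ {Γ δ a b L js} → PT Γ nat δ → PT Γ SideTy a → PT Γ SideTy b → PT Γ nat L → PT Γ (list ParallelJobTy) js →
                  PT Γ (list (nat ⊗ ViewTy)) (λ γ → stageItems (scale (δ γ)) (a γ) (b γ) (L γ) (js γ))
  pt-stageItems pd pa pb pL pjs = pt-map ⟨ pt-fst ⟨1⟩ , pt-viewOf (wk pd) (wk pa) (wk pb) (wk pL) (pt-fst ⟨2⟩) ⟩ (pt-enum pjs)

  pt-stageOptions : ∀ K {Γ δ B R a b l} → PT Γ nat δ → PT Γ nat B → PT Γ (list nat) R → PT Γ SideTy a → PT Γ SideTy b → PT Γ LinkTy l →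
    PT Γ (list (nat ⊗ (nat ⊗ list (SideTy ⊗ nat)))) (λ γ → stageOptions K (scale (δ γ)) (B γ) (R γ) (a γ) (b γ) (l γ))
  pt-stageOptions K pd pB pR pa pb pl = pt-case pl
    (pt-map ⟨ pt-fst , ⟨ pt-lit 0 , pt-nil ⟩ ⟩ (pt-select (pt-leq (wk (pt-gap (wk pa) (wk pb) (pt-scale (wk pd) pt-fst))) pt-fst) (wk pR)))
    (pt-concatMap
      (pt-map ⟨ wk pt-fst , ⟨ pt-fst ⟨2⟩ ⟨1⟩ , pt-map (pt-placeOf (wk pt-fst ⟨2⟩ ⟨2⟩) (pt-fst ⟨1⟩)) (pt-enum (wk (wk jobs))) ⟩ ⟩
        (pt-stageTable K (wk (wk pB)) (wk (wk pR)) pt-fst (pt-stageItems (wk (wk pd)) (wk (wk pa)) (wk (wk pb)) pt-fst (wk jobs))))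
      (wk pR))
    where
    jobs : ∀ {Δ} → PT ((ParallelJobTy ⊗ list ParallelJobTy) ⊗ Δ) (list ParallelJobTy) (λ z → proj₁ (proj₁ z) ∷ proj₂ (proj₁ z))
    jobs = pt-cons (pt-fst ⟨1⟩) (pt-fst ⟨2⟩)

  pt-choices : ∀ {Γ δ job} → PT Γ nat δ → PT Γ (nat ⊗ list nat) job → PT Γ (list (SideTy ⊗ (nat ⊗ nat))) (λ γ → choices (scale (δ γ)) (job γ))
  pt-choices pd pj = pt-cons ⟨ pt-yea , ⟨ pt-scale pd (pj ⟨1⟩) , pt-lit 0 ⟩ ⟩
    (pt-map ⟨ pt-nay , ⟨ pt-scale (wk pd) pt-fst , pt-fst ⟩ ⟩ (pj ⟨2⟩))

  pt-advance : ∀ {Γ S ch o} → PT Γ nat S → PT Γ (SideTy ⊗ (nat ⊗ nat)) ch → PT Γ (nat ⊗ (nat ⊗ list (SideTy ⊗ nat))) o →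
    PT Γ (list ((SideTy ⊗ nat) ⊗ (nat ⊗ ChainDecisionTy))) (λ γ → advance (S γ) (ch γ) (o γ))
  pt-advance {Γ} {ch = ch} {o} pS pch po = pt-guard (pt-leq span pS) (pt-one ⟨ ⟨ pch ⟨1⟩ , pt-∸ pS span ⟩ , ⟨ pt-+ (pch ⟨2⟩ ⟨2⟩) (po ⟨2⟩ ⟨1⟩) ,
    ⟨ ⟨ pch ⟨1⟩ , pt-∸ pS (po ⟨1⟩) ⟩ , pt-map ⟨ pt-fst ⟨1⟩ , pt-+ (wk (pt-∸ pS (po ⟨1⟩))) (pt-fst ⟨2⟩) ⟩ (po ⟨2⟩ ⟨2⟩) ⟩ ⟩ ⟩)
    where
    span : PT Γ nat (λ γ → proj₁ (proj₂ (ch γ)) + proj₁ (o γ))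
    span = pt-+ (pch ⟨2⟩ ⟨1⟩) (po ⟨1⟩)

  pt-chainStep : ∀ K {Γ δ B R it s} → PT Γ nat δ → PT Γ nat B → PT Γ (list nat) R → PT Γ ChainItemTy it → PT Γ (SideTy ⊗ nat) s →
    PT Γ (list ((SideTy ⊗ nat) ⊗ (nat ⊗ ChainDecisionTy))) (λ γ → chainStep K (scale (δ γ)) (B γ) (R γ) (it γ) (s γ))
  pt-chainStep K pd pB pR pit ps = pt-concatMap (pt-concatMap (pt-advance (wk (wk ps) ⟨2⟩) (wk pt-fst) pt-fst)
      (pt-stageOptions K (wk pd) (wk pB) (wk pR) (pt-fst ⟨1⟩) (wk ps ⟨1⟩) (wk pit ⟨1⟩)))
    (pt-choices pd (pit ⟨2⟩))

  pt-eqChainState : PT ((SideTy ⊗ nat) ⊗ (SideTy ⊗ nat)) (unit ⊕ unit) (λ z → eqChainState (proj₁ z) (proj₂ z))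
  pt-eqChainState = pt-both (pt-ite (pt-fst ⟨1⟩) (pt-snd ⟨1⟩) (pt-ite (pt-snd ⟨1⟩) pt-nay pt-yea)) (pt-eqℕ (pt-fst ⟨2⟩) (pt-snd ⟨2⟩))

opaque
  unfolding chainTable

  pt-chainTable : ∀ K {Γ δ B R T its} → PT Γ nat δ → PT Γ nat B → PT Γ (list nat) R → PT Γ nat T → PT Γ (list ChainItemTy) its →
    PT Γ (list ChainEntryTy) (λ γ → chainTable K (scale (δ γ)) (B γ) (R γ) (T γ) (its γ))
  pt-chainTable K {δ = δ} {B} {R} pd pB pR pT pits = pt-table {eq = eqChainState} eqChainState⁻ pt-eqChainState
    {f = λ z → chainStep K (scale (δ (proj₂ (proj₂ z)))) (B (proj₂ (proj₂ z))) (R (proj₂ (proj₂ z))) (proj₁ (proj₂ z)) (proj₁ z)}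
    (pt-chainStep K (wk (wk pd)) (wk (wk pB)) (wk (wk pR)) (pt-snd ⟨1⟩) pt-fst)
    (pt-concatMap (pt-cons ⟨ pt-yea , pt-fst ⟩ (pt-one ⟨ pt-nay , pt-fst ⟩)) pR) pB (pt-one ⟨ pt-yea , pT ⟩) pits

opaque
  pt-output : ∀ {Γ δ T ds} → PT Γ nat δ → PT Γ nat T → PT Γ (list ChainDecisionTy) ds →
              PT Γ (list (SideTy ⊗ nat)) (λ γ → output (δ γ) (T γ) (ds γ))
  pt-output pd pT pds = pt-map ⟨ pt-fst ⟨1⟩ , pt-arith mul (wk pd) (pt-fst ⟨2⟩) ⟩
    (pt-++ (pt-concatMap (pt-cons (pt-fst ⟨1⟩) (pt-fst ⟨2⟩)) pds) (pt-one ⟨ pt-yea , pT ⟩))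

  pt-chainItems : ∀ {Γ X} → PT Γ ChainTy X → PT Γ (list ChainItemTy) (λ γ → chainItems (X γ))
  pt-chainItems p = pt-zip (p ⟨2⟩) (pt-cons ⟨ pt-lit 0 , pt-nil ⟩ (pt-map ⟨ pt-fst ⟨1⟩ , pt-one (pt-fst ⟨2⟩) ⟩ (p ⟨1⟩)))

  pt-weights : ∀ {Γ ls} → PT Γ (list LinkTy) ls → PT Γ (list unit) (λ γ → weights (ls γ))
  pt-weights p = pt-concatMap (pt-case pt-fst (four pt-nil) (four (pt-map pt-tt (pt-cons (pt-fst ⟨1⟩) (pt-fst ⟨2⟩))))) p
    where
    four : ∀ {Γ xs} → PT Γ (list unit) xs → PT Γ (list unit) (λ γ → tt ∷ tt ∷ tt ∷ tt ∷ xs γ)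
    four q = pt-cons pt-tt (pt-cons pt-tt (pt-cons pt-tt (pt-cons pt-tt q)))

  pt-serverBits : ∀ {Γ X} → PT Γ ChainTy X → PT Γ (list unit) (λ γ → serverBits (X γ))
  pt-serverBits p = pt-++ (pt-concatMap (pt-fst ⟨1⟩ ⨟ pt-bits) (p ⟨1⟩))
    (pt-concatMap (pt-case pt-fst pt-nil (pt-concatMap (pt-fst ⟨1⟩ ⟨1⟩ ⨟ pt-bits) (pt-cons (pt-fst ⟨1⟩) (pt-fst ⟨2⟩)))) (p ⟨2⟩))

  pt-times : PT InTy (list nat) times
  pt-times = pt-range (pt-cons pt-tt (pt-++ W (pt-concatMap (pt-concatMap (pt-cons pt-tt (pt-one pt-tt)) (wk pt-snd)) (pt-cons pt-tt W))))
    where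
    W : PT InTy (list unit) (λ I → weights (proj₂ (proj₁ (proj₁ I))))
    W = pt-weights (pt-fst ⟨1⟩ ⟨2⟩)

  pt-candidates : ∀ K → PT InTy (list (nat ⊗ list (SideTy ⊗ nat))) (candidates K)
  pt-candidates K = pt-concatMap (pt-concatMap
    (pt-map ⟨ pt-arith mul (wk (wk pt-fst)) (wk pt-fst) , pt-output (wk (wk pt-fst)) (wk pt-fst) (pt-fst ⟨2⟩ ⟨2⟩) ⟩
      (pt-chainTable K (wk pt-fst) (wk pt-snd ⟨1⟩ ⟨2⟩) (wk pt-snd ⨟ pt-times) pt-fst (pt-chainItems (wk pt-snd ⟨1⟩ ⟨1⟩))))
    (pt-snd ⨟ pt-times)) (pt-powers (pt-serverBits (pt-fst ⟨1⟩)))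

opaque
  unfolding solve

  pt-solve : ∀ K → PT InTy (list (SideTy ⊗ nat)) (solve K)
  pt-solve K = pt-case (pt-argmin (pt-fst ⟨1⟩) (pt-candidates K) ⨟ pt-uncons) pt-nil (pt-fst ⟨1⟩ ⟨2⟩)

-- Schedules of a stage

-- The numbering of `enum`, which counts from the end.
rank : ∀ {n} → Fin n → ℕ
rank {suc n} zero    = n
rank {suc n} (suc i) = rank i

rank-< : ∀ {n} (i : Fin n) → rank i < n
rank-< {suc n} zero    = ≤-refl
rank-< {suc n} (suc i) = m≤n⇒m≤1+n (rank-< i)

rank-injective : ∀ {n} {i j : Fin n} → rank i ≡ rank j → i ≡ j
rank-injective {suc n} {zero}  {zero}  eq = refl
rank-injective {suc n} {zero}  {suc j} eq = ⊥-elim (<-irrefl (sym eq) (rank-< j))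
rank-injective {suc n} {suc i} {zero}  eq = ⊥-elim (<-irrefl eq (rank-< i))
rank-injective {suc n} {suc i} {suc j} eq = cong suc (rank-injective eq)

enum-tabulate : ∀ {A : Set} {n} (f : Fin n → A) → enum (tabulate f) ≡ map (λ i → rank i , f i) (allFin n)
enum-tabulate {n = zero}  f = refl
enum-tabulate {n = suc n} f = cong₂ _∷_ (cong (_, f zero) (length-tabulate (f ∘ suc))) (begin
  enum (tabulate (f ∘ suc))                           ≡⟨ enum-tabulate (f ∘ suc) ⟩
  map (λ i → rank i , f (suc i)) (allFin n)           ≡⟨ map-∘ (allFin n) ⟩
  map (λ i → rank i , f i) (map suc (allFin n))       ≡⟨ cong (map _) (map-tabulate id suc) ⟩
  map (λ i → rank i , f i) (tabulate suc)             ∎)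
  where open ≡-Reasoning

Job : Set
Job = ⟦ ParallelJobTy ⟧

psOf pcOf inOf outOf : Job → ℕ
psOf  j = proj₁ (proj₁ j)
pcOf  j = proj₂ (proj₁ j)
inOf  j = proj₁ (proj₂ j)
outOf j = proj₂ (proj₂ j)

processingOf : ⟦ SideTy ⟧ → Job → ℕ
processingOf b j = ite b (psOf j) (pcOf j)

-- Schedules of the jobs between two chain jobs on the sides a and b, of which
-- the second starts L after the completion of the first; h scales all times.
record Stage (h : ℕ → ℕ) (a b : ⟦ SideTy ⟧) (L : ℕ) {n} (J : Fin n → Job) : Set where
  field
    side   : Fin n → ⟦ SideTy ⟧
    end    : Fin n → ℕ
    begins : ∀ i → gap a (side i) (h (inOf (J i))) + h (processingOf (side i) (J i)) ≤ end i
    ends   : ∀ i → end i + gap (side i) b (h (outOf (J i))) ≤ L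
    apart  : ∀ {i j} → i ≢ j → side i ≡ yea → side j ≡ yea →
             end i + h (psOf (J j)) ≤ end j ⊎ end j + h (psOf (J i)) ≤ end i

  priceOf : Fin n → ℕ
  priceOf i = ite (side i) 0 (pcOf (J i))

  stageCost : ℕ
  stageCost = sum (map priceOf (allFin n))

AllPairs-∈ : ∀ {A : Set} {R : A → A → Set} {xs x y} → AllPairs R xs → x ∈ xs → y ∈ xs → x ≡ y ⊎ R x y ⊎ R y x
AllPairs-∈ (r ∷ rs) (here refl) (here refl) = inj₁ refl
AllPairs-∈ (r ∷ rs) (here refl) (there y∈)  = inj₂ (inj₁ (All.lookup r y∈))
AllPairs-∈ (r ∷ rs) (there x∈)  (here refl) = inj₂ (inj₂ (All.lookup r x∈))
AllPairs-∈ (r ∷ rs) (there x∈)  (there y∈)  = AllPairs-∈ rs x∈ y∈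

-- Soundness of the stage table

sideOf : Decision → ⟦ SideTy ⟧
sideOf d = proj₁ (proj₂ d)

startOf endOf paidFor : Decision → ℕ
startOf d = proj₁ (proj₂ (proj₂ d))
endOf   d = proj₁ (proj₂ (proj₂ (proj₂ d)))
paidFor d = proj₂ (proj₂ (proj₂ (proj₂ d)))

Disjoint : Slot → Slot → Set
Disjoint (x , y) (x′ , y′) = y ≤ x′ ⊎ y′ ≤ x

either⁻ : ∀ {b c} → either b c ≡ yea → b ≡ yea ⊎ c ≡ yea
either⁻ {yea} _ = inj₁ refl
either⁻ {nay} e = inj₂ e

∈-guarded : ∀ {A : Set} {b} {x y : A} → x ∈ guard b (y ∷ []) → b ≡ yea × x ≡ y
∈-guarded {b = yea} (here eq) = refl , eq

module _ (L : ℕ) where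

  OnServer OnCloud : View → Decision → Set
  OnServer v d = release v ≤ startOf d × endOf d ≡ startOf d + work v × endOf d + tail v ≤ L × paidFor d ≡ 0
  OnCloud  v d = endOf d ≡ cloudEnd v × cloudSpan v ≤ L × paidFor d ≡ price v

  Fits : ℕ × View → Decision → Set
  Fits (i , v) d = position-of d ≡ i × ((sideOf d ≡ yea × OnServer v d) ⊎ (sideOf d ≡ nay × OnCloud v d))

  Exclusive : Decision → Decision → Set
  Exclusive d d′ = sideOf d ≡ yea → sideOf d′ ≡ yea → endOf d ≤ startOf d′ ⊎ endOf d′ ≤ startOf d

  -- The two ways of placing a server job rest on different fields: a job at the end comes after all
  -- else by `before` and `slots`, and a job in a slot avoids what is already placed by `free`.
  record Partial (its : List (ℕ × View)) (st : State) (c : ℕ) (ds : List Decision) : Set where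
    field
      fits      : Pointwise Fits its ds
      paid      : c ≡ sum (map paidFor ds)
      exclusive : AllPairs Exclusive ds
      before    : ∀ {d} → d ∈ ds → sideOf d ≡ yea → startOf d ≤ endOf d × endOf d ≤ proj₂ st
      free      : ∀ {d s} → d ∈ ds → sideOf d ≡ yea → s ∈ proj₁ st → Disjoint (startOf d , endOf d) s
      slots     : ∀ {s} → s ∈ proj₁ st → proj₂ s ≤ proj₂ st

  open Partial

  partial-initial : ∀ {K R st} → st ∈ initial K R → Partial [] st 0 []
  partial-initial {K} {R} st∈ with ∈-map⁻ _ st∈
  ... | st , _ , refl = record
    { fits = [] ; paid = refl ; exclusive = [] ; before = λ () ; free = λ ()
    ; slots = λ s∈ → leq⁻ (proj₁ (∈-select⁻ (λ s → leq (proj₂ s) (proj₂ st)) (proj₁ st) s∈)) }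

  private
    addCost : ∀ {c c′} ds (d : Decision) → c ≡ sum (map paidFor ds) → c′ ≡ paidFor d → c + c′ ≡ sum (map paidFor (d ∷ ds))
    addCost {c} {c′} ds d refl refl = +-comm c c′

  module _ {its : List (ℕ × View)} {sl : List Slot} {load c : ℕ} {ds : List Decision} (p : Partial its (sl , load) c ds)
           (i : ℕ) (v : View) where

    partial-cloud : cloudSpan v ≤ L →
      Partial ((i , v) ∷ its) (sl , load) (c + price v) ((i , nay , 0 , cloudEnd v , price v) ∷ ds)
    partial-cloud fit = record
      { fits = (refl , inj₂ (refl , refl , fit , refl)) ∷ fits p
      ; paid = addCost ds (i , nay , 0 , cloudEnd v , price v) (paid p) refl
      ; exclusive = All.tabulate (λ _ ()) ∷ exclusive p
      ; before = λ { (here refl) () ; (there d∈) → before p d∈ }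
      ; free = λ { (here refl) () ; (there d∈) → free p d∈ }
      ; slots = slots p }

    partial-server : ∀ {sl′ load′} x → release v ≤ x → x + work v + tail v ≤ L →
      (∀ {d} → d ∈ ds → sideOf d ≡ yea → endOf d ≤ x ⊎ x + work v ≤ startOf d) →
      x + work v ≤ load′ → load ≤ load′ → (∀ {s} → s ∈ sl′ → Disjoint (x , x + work v) s) → (∀ {s} → s ∈ sl′ → s ∈ sl) →
      Partial ((i , v) ∷ its) (sl′ , load′) (c + 0) ((i , yea , x , x + work v , 0) ∷ ds)
    partial-server {sl′} {load′} x released fit others end≤ load≤ cleared ⊆sl = record
      { fits = (refl , inj₁ (refl , released , refl , fit , refl)) ∷ fits p
      ; paid = addCost ds (i , yea , x , x + work v , 0) (paid p) refl
      ; exclusive = All.tabulate (λ d∈ _ eq → swap (others d∈ eq)) ∷ exclusive p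
      ; before = λ { (here refl) _ → m≤m+n x (work v) , end≤
                   ; (there d∈) eq → let q , q′ = before p d∈ eq in q , ≤-trans q′ load≤ }
      ; free = λ { (here refl) _ s∈ → cleared s∈ ; (there d∈) eq s∈ → free p d∈ eq (⊆sl s∈) }
      ; slots = λ s∈ → ≤-trans (slots p (⊆sl s∈)) load≤ }

    partial-slot : ∀ {x y} → (x , y) ∈ sl → release v ≤ x → x + work v ≤ y → x + work v + tail v ≤ L →
      Partial ((i , v) ∷ its) (clear (x , y) sl , load) (c + 0) ((i , yea , x , x + work v , 0) ∷ ds)
    partial-slot {x} {y} s∈ released end≤y fit = partial-server x released fit others
      (≤-trans end≤y (slots p s∈)) ≤-refl (λ s′∈ → cleared (proj₁ (∈-select⁻ disjoint? sl s′∈)))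
      (λ s′∈ → proj₂ (∈-select⁻ disjoint? sl s′∈))
      where
      disjoint? : Slot → Test
      disjoint? s′ = either (leq y (proj₁ s′)) (leq (proj₂ s′) x)
      others : ∀ {d} → d ∈ ds → sideOf d ≡ yea → endOf d ≤ x ⊎ x + work v ≤ startOf d
      others d∈ eq with free p d∈ eq s∈
      ... | inj₁ e≤x = inj₁ e≤x
      ... | inj₂ y≤s = inj₂ (≤-trans end≤y y≤s)
      cleared : ∀ {s′} → disjoint? s′ ≡ yea → Disjoint (x , x + work v) s′
      cleared {x′ , y′} e with either⁻ {leq y x′} e
      ... | inj₁ y≤ = inj₁ (≤-trans end≤y (leq⁻ y≤))
      ... | inj₂ ≤x = inj₂ (leq⁻ ≤x)

    partial-end : load + (release v ∸ load) + work v + tail v ≤ L →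
      Partial ((i , v) ∷ its) (sl , load + (release v ∸ load) + work v) (c + 0)
        ((i , yea , load + (release v ∸ load) , load + (release v ∸ load) + work v , 0) ∷ ds)
    partial-end fit = partial-server (load + (release v ∸ load)) (m≤n+m∸n (release v) load) fit
      (λ d∈ eq → inj₁ (≤-trans (proj₂ (before p d∈ eq)) (m≤m+n load _))) ≤-refl
      (≤-trans (m≤m+n load (release v ∸ load)) (m≤m+n _ (work v)))
      (λ s∈ → inj₂ (≤-trans (slots p s∈) (m≤m+n load _))) id

  Extends : List (ℕ × View) → ℕ → List Decision → State × (ℕ × Decision) → Set
  Extends its c ds (st , c′ , d) = Partial its st (c + c′) (d ∷ ds)

  partial-step : ∀ {its st c ds} (it : ℕ × View) {o} → Partial its st c ds → o ∈ options L it st → Extends (it ∷ its) c ds o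
  partial-step {its} {sl , load} {c} {ds} (i , v) {o} p o∈ =
    [ onCloud , [ atEnd , inSlot ∘ ∈-concatMap-elim (toSlot L (i , v) (sl , load)) sl ]′ ∘ ∈-++⁻ (toEnd L (i , v) (sl , load)) ]′
      (∈-++⁻ (toCloud L (i , v) (sl , load)) o∈)
    where
    goal : State × (ℕ × Decision) → Set
    goal = Extends ((i , v) ∷ its) c ds
    onCloud : o ∈ toCloud L (i , v) (sl , load) → goal o
    onCloud o∈′ = let fit , eq = ∈-guarded o∈′ in subst goal (sym eq) (partial-cloud p i v (leq⁻ fit))
    atEnd : o ∈ toEnd L (i , v) (sl , load) → goal o
    atEnd o∈′ = let fit , eq = ∈-guarded o∈′ in subst goal (sym eq) (partial-end p i v (leq⁻ fit))
    inSlot : (∃[ s ] s ∈ sl × o ∈ toSlot L (i , v) (sl , load) s) → goal o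
    inSlot ((x , y) , s∈ , o∈′) =
      let fit , eq = ∈-guarded o∈′
          fit₁ , fit₂₃ = both⁻ {leq (release v) x} fit
          fit₂ , fit₃ = both⁻ {leq (x + work v) y} fit₂₃
      in subst goal (sym eq) (partial-slot p i v s∈ (leq⁻ fit₁) (leq⁻ fit₂) (leq⁻ fit₃))

module _ (K B : ℕ) (R : List ℕ) {h : ℕ → ℕ} {a b : ⟦ SideTy ⟧} {L n : ℕ} (J : Fin n → Job) where

  private
    view : Fin n → View
    view i = viewOf h a b L (J i)

    tag : Fin n → ℕ × View
    tag i = rank i , view i

  items≡ : stageItems h a b L (tabulate J) ≡ map tag (allFin n)
  items≡ = trans (cong (map _) (enum-tabulate J)) (sym (map-∘ (allFin n)))

  -- The jobs in the order in which the table treats them, last one first.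
  ordering : ∃[ ord ] sort itemKey (stageItems h a b L (tabulate J)) ≡ map tag ord × ord ↭ allFin n
  ordering with ↭-map-inv tag (subst (_↭ sort itemKey (stageItems h a b L (tabulate J))) items≡ (↭-sym (sort-↭ itemKey _)))
  ... | ord , eq , p = ord , eq , ↭-sym p

  ordering-unique : ∀ {ord} → ord ↭ allFin n → Unique ord
  ordering-unique p = AllPairs-resp-↭ (setoid (Fin n)) (λ x≢y y≡x → x≢y (sym y≡x)) ((λ { refl x → x }) , (λ { refl x → x }))
    (↭⇒↭ₛ (↭-sym p)) (allFin⁺ n)

  module FromTrace {ord : List (Fin n)} (ord↭ : ord ↭ allFin n) {c : ℕ} {ds : List Decision}
                   (fits : Pointwise (Fits L) (map tag ord) ds) (paid : c ≡ sum (map paidFor ds)) (exclusive : AllPairs (Exclusive L) ds) where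

    unique : Unique ord
    unique = ordering-unique ord↭

    aligned : ∀ {ord ds i} → Pointwise (Fits L) (map tag ord) ds → i ∈ ord → ∃[ d ] d ∈ ds × Fits L (tag i) d
    aligned {_ ∷ _} (f ∷ fs) (here refl) = _ , here refl , f
    aligned {_ ∷ _} (f ∷ fs) (there i∈)  = let d , d∈ , f′ = aligned fs i∈ in d , there d∈ , f′

    job : ∀ {ord ds d} → Pointwise (Fits L) (map tag ord) ds → d ∈ ds → ∃[ j ] j ∈ ord × Fits L (tag j) d
    job {_ ∷ _} (f ∷ fs) (here refl) = _ , here refl , f
    job {_ ∷ _} (f ∷ fs) (there d∈)  = let j , j∈ , f′ = job fs d∈ in j , there j∈ , f′

    -- Distinct jobs have distinct ranks, which makes the look-up of decisions by position
    -- unambiguous.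
    positions : ∀ {ord ds} → Unique ord → Pointwise (Fits L) (map tag ord) ds → AllPairs (λ d d′ → position-of d ≢ position-of d′) ds
    positions {[]}    _        []       = []
    positions {_ ∷ _} (u ∷ us) (f ∷ fs) = All.tabulate (λ d∈ eq → let j , j∈ , f′ = job fs d∈ in
      All.lookup u j∈ (rank-injective (trans (sym (proj₁ f)) (trans eq (proj₁ f′))))) ∷ positions us fs

    same : ∀ {d d′} → d ∈ ds → d′ ∈ ds → position-of d ≡ position-of d′ → d ≡ d′
    same d∈ d′∈ eq with AllPairs-∈ (positions unique fits) d∈ d′∈
    ... | inj₁ d≡        = d≡
    ... | inj₂ (inj₁ ≢)  = ⊥-elim (≢ eq)
    ... | inj₂ (inj₂ ≢)  = ⊥-elim (≢ (sym eq))

    i∈ord : ∀ i → i ∈ ord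
    i∈ord i = ∈-resp-↭ (↭-sym ord↭) (∈-allFin i)

    D : Fin n → Decision
    D i = proj₁ (aligned fits (i∈ord i))
    D∈ : ∀ i → D i ∈ ds
    D∈ i = proj₁ (proj₂ (aligned fits (i∈ord i)))
    D-fits : ∀ i → Fits L (tag i) (D i)
    D-fits i = proj₂ (proj₂ (aligned fits (i∈ord i)))

    D-unique : ∀ {d} i → d ∈ ds → position-of d ≡ rank i → D i ≡ d
    D-unique i d∈ eq = same (D∈ i) d∈ (trans (proj₁ (D-fits i)) (sym eq))

    traced : ∀ {ord ds′} → (∀ {d} → d ∈ ds′ → d ∈ ds) → Pointwise (Fits L) (map tag ord) ds′ → ds′ ≡ map D ord
    traced {[]}    ⊆ds []       = refl
    traced {i ∷ _} ⊆ds (f ∷ fs) = cong₂ _∷_ (sym (D-unique i (⊆ds (here refl)) (proj₁ f))) (traced (⊆ds ∘ there) fs)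

    placed : ∀ i → placeOf ds (rank i) ≡ (sideOf (D i) , endOf (D i))
    placed i = lookup (select at ds) refl
      where
      at : Decision → Test
      at d = eqℕ (position-of d) (rank i)
      lookup : ∀ xs → select at ds ≡ xs → [ (λ _ → yea , 0) , (λ (d , _) → place d) ]′ (unconsF xs) ≡ (sideOf (D i) , endOf (D i))
      lookup [] eq with () ← subst (D i ∈_) eq (∈-select⁺ at (trans (cong (eqℕ (position-of (D i))) (sym (proj₁ (D-fits i)))) (eqℕ-refl (position-of (D i)))) (D∈ i))
      lookup (d ∷ _) eq with ∈-select⁻ at ds (subst (d ∈_) (sym eq) (here refl))
      ... | at-i , d∈ = cong place (sym (D-unique i d∈ (eqℕ⁻ at-i)))

    side-nay : ∀ {d : Decision} → sideOf d ≡ nay → sideOf d ≢ yea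
    side-nay p q with () ← trans (sym p) q

    fits-begins : ∀ {k j} d → Fits L (k , viewOf h a b L j) d →
                  gap a (sideOf d) (h (inOf j)) + h (processingOf (sideOf d) j) ≤ endOf d
    fits-begins (_ , yea , _) (_ , inj₁ (_ , r≤ , refl , _)) = +-monoˡ-≤ _ r≤
    fits-begins (_ , nay , _) (_ , inj₂ (_ , refl , _))      = ≤-refl

    fits-ends : ∀ {k j} d → Fits L (k , viewOf h a b L j) d → endOf d + gap (sideOf d) b (h (outOf j)) ≤ L
    fits-ends (_ , yea , _) (_ , inj₁ (_ , _ , _ , ≤L , _)) = ≤L
    fits-ends (_ , nay , _) (_ , inj₂ (_ , refl , ≤L , _))  = ≤L

    fits-price : ∀ {k j} d → Fits L (k , viewOf h a b L j) d → ite (sideOf d) 0 (pcOf j) ≡ paidFor d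
    fits-price (_ , yea , _) (_ , inj₁ (_ , _ , _ , _ , refl)) = refl
    fits-price (_ , nay , _) (_ , inj₂ (_ , _ , _ , refl))     = refl

    server-end : ∀ {i} → sideOf (D i) ≡ yea → endOf (D i) ≡ startOf (D i) + h (psOf (J i))
    server-end {i} eq with D-fits i
    ... | _ , inj₁ (_ , _ , e≡ , _) = e≡
    ... | _ , inj₂ (s , _)          = ⊥-elim (side-nay {D i} s eq)

    ordered : ∀ {i j} → sideOf (D j) ≡ yea → endOf (D i) ≤ startOf (D j) → endOf (D i) + h (psOf (J j)) ≤ endOf (D j)
    ordered sj ≤j = ≤-trans (+-monoˡ-≤ _ ≤j) (≤-reflexive (sym (server-end sj)))

    apart′ : ∀ {i j} → i ≢ j → sideOf (D i) ≡ yea → sideOf (D j) ≡ yea →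
             endOf (D i) + h (psOf (J j)) ≤ endOf (D j) ⊎ endOf (D j) + h (psOf (J i)) ≤ endOf (D i)
    apart′ {i} {j} i≢j si sj =
      [ (λ eq → ⊥-elim (i≢j (rank-injective (trans (sym (proj₁ (D-fits i))) (trans (cong position-of eq) (proj₁ (D-fits j)))))))
      , [ (λ ex → Sum.map (ordered sj) (ordered si) (ex si sj)) , (λ ex → Sum.map (ordered sj) (ordered si) (swap (ex sj si))) ]′ ]′
      (AllPairs-∈ exclusive (D∈ i) (D∈ j))

    σ : Stage h a b L J
    σ = record { side = λ i → sideOf (D i) ; end = λ i → endOf (D i) ; begins = λ i → fits-begins (D i) (D-fits i)
               ; ends = λ i → fits-ends (D i) (D-fits i) ; apart = apart′ }

    price≡ : ∀ i → Stage.priceOf σ i ≡ paidFor (D i)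
    price≡ i = fits-price (D i) (D-fits i)

    cost≡ : Stage.stageCost σ ≡ c
    cost≡ = begin
      sum (map (Stage.priceOf σ) (allFin n))   ≡⟨ cong sum (map-cong price≡ (allFin n)) ⟩
      sum (map (λ i → paidFor (D i)) (allFin n)) ≡⟨ sum-↭ (map⁺ (λ i → paidFor (D i)) ord↭) ⟨
      sum (map (λ i → paidFor (D i)) ord)      ≡⟨ cong sum (map-∘ ord) ⟩
      sum (map paidFor (map D ord))            ≡⟨ cong (λ ds → sum (map paidFor ds)) (traced id fits) ⟨
      sum (map paidFor ds)                     ≡⟨ paid ⟨
      c                                        ∎
      where open ≡-Reasoning

  stage-sound : ∀ {st c ds} → (st , c , ds) ∈ stageTable K B R L (stageItems h a b L (tabulate J)) →
    Σ[ σ ∈ Stage h a b L J ] (Stage.stageCost σ ≡ c × (∀ i → placeOf ds (rank i) ≡ (Stage.side σ i , Stage.end σ i)))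
  stage-sound {st} {c} {ds} e∈ = σ , cost≡ , placed
    where
    part : Partial L (map tag (proj₁ ordering)) st c ds
    part = subst (λ its → Partial L its st c ds) (proj₁ (proj₂ ordering))
      (proj₁ (Layered.table-sound eqState (universe K R) B (options L) eqState⁻ (Partial L) (partial-initial L {K} {R})
        (λ _ → partial-step L _) (sort itemKey (stageItems h a b L (tabulate J))) e∈))
    open FromTrace (proj₂ (proj₂ ordering)) (Partial.fits part) (Partial.paid part) (Partial.exclusive part)

-- Completeness of the stage table

sum-partition : ∀ {A : Set} {P : A → Set} (P? : Decidable P) (f : A → ℕ) xs →
  sum (map f xs) ≡ sum (map f (List.filter P? xs)) + sum (map f (List.filter (λ x → ¬? (P? x)) xs))
sum-partition P? f [] = refl
sum-partition P? f (x ∷ xs) with P? x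
... | yes _ = trans (cong (f x +_) (sum-partition P? f xs)) (sym (+-assoc (f x) _ _))
... | no _  = trans (cong (f x +_) (sum-partition P? f xs)) (move (f x) (sum (map f (List.filter P? xs))) _)
  where
  move : ∀ a b c → a + (b + c) ≡ b + (a + c)
  move = solve-∀

Within : ℕ → ℕ → Slot → Set
Within E D (x , y) = E ≤ x × x ≤ y × y ≤ D

extent : Slot → ℕ
extent (x , y) = y ∸ x

-- Any one of the intervals splits the others into those before and those after it.
packing : ∀ {E D} xs → AllPairs Disjoint xs → All (Within E D) xs → E ≤ D → E + sum (map extent xs) ≤ D
packing xs = go (length xs) xs ≤-refl
  where
  -- `k` bounds the length: the recursion is on filtered lists, which are not structural parts.
  go : ∀ k {E D} xs → length xs ≤ k → AllPairs Disjoint xs → All (Within E D) xs → E ≤ D → E + sum (map extent xs) ≤ D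
  go k {E} [] _ _ _ E≤D = ≤-trans (≤-reflexive (+-identityʳ E)) E≤D
  go (suc k) {E} {D} ((x , y) ∷ xs) (s≤s len) (d ∷ ds) ((E≤x , x≤y , y≤D) ∷ ws) E≤D = begin
    E + (y ∸ x + sum (map extent xs))         ≡⟨ cong (λ s → E + (y ∸ x + s)) (sum-partition left? extent xs) ⟩
    E + (y ∸ x + (sum (map extent left) + sum (map extent right))) ≡⟨ arrange E (y ∸ x) (sum (map extent left)) _ ⟩
    E + sum (map extent left) + (y ∸ x) + sum (map extent right) ≤⟨ +-monoˡ-≤ _ (+-monoˡ-≤ (y ∸ x)
      (go k left (≤-trans (length-filter left? xs) len) (AllPairs.filter⁺ left? ds) left-within E≤x)) ⟩
    x + (y ∸ x) + sum (map extent right)      ≡⟨ cong (_+ sum (map extent right)) (m+[n∸m]≡n x≤y) ⟩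
    y + sum (map extent right)                ≤⟨ go k right (≤-trans (length-filter right? xs) len) (AllPairs.filter⁺ right? ds) right-within y≤D ⟩
    D                                         ∎
    where
    open ≤-Reasoning
    left? : Decidable (λ (s : Slot) → proj₂ s ≤ x)
    left? s = proj₂ s ≤? x
    right? : Decidable (λ (s : Slot) → ¬ proj₂ s ≤ x)
    right? s = ¬? (left? s)
    left right : List Slot
    left = List.filter left? xs
    right = List.filter right? xs
    arrange : ∀ a b c d → a + (b + (c + d)) ≡ a + c + b + d
    arrange = solve-∀
    left-within : All (Within E x) left
    left-within = All.map (λ ((E≤ , ≤y , _) , ≤x) → E≤ , ≤y , ≤x) (All.zip (All.filter⁺ left? ws , All.all-filter left? xs))
    right-within : All (Within y D) right
    right-within = All.map (λ ((dis , (_ , ≤y , ≤D)) , ≰x) → [ id , (λ ≤x → ⊥-elim (≰x ≤x)) ]′ dis , ≤y , ≤D)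
      (All.zip (All.filter⁺ right? (All.zip (d , ws)) , All.all-filter right? xs))

-- Capping by `L` provides a value also when `P` holds nowhere.
least : ∀ {n} {P : Fin n → Set} (P? : Decidable P) (f : Fin n → ℕ) L →
  ∃[ E ] E ≤ L × (∀ i → P i → E ≤ f i) × (∀ x → x ≤ L → (∀ i → P i → x ≤ f i) → x ≤ E)
least {zero}  P? f L = L , ≤-refl , (λ ()) , λ x x≤ _ → x≤
least {suc n} P? f L with least (P? ∘ suc) (f ∘ suc) L | P? zero
... | E , E≤ , low , high | no ¬p = E , E≤ ,
  (λ { zero p → ⊥-elim (¬p p) ; (suc i) p → low i p }) , λ x x≤ all → high x x≤ (λ i → all (suc i))
... | E , E≤ , low , high | yes p = E ⊓ f zero , ≤-trans (m⊓n≤m E _) E≤ ,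
  (λ { zero _ → m⊓n≤n E _ ; (suc i) q → ≤-trans (m⊓n≤m E _) (low i q) }) ,
  λ x x≤ all → ⊓-glb (high x x≤ (λ i → all (suc i))) (all zero p)

∈-slotLists : ∀ K R sl → length sl ≤ K → All (λ s → proj₁ s ∈ R × proj₂ s ∈ R) sl → sl ∈ slotLists K R
∈-slotLists zero    R []             _         _ = here refl
∈-slotLists (suc K) R []             _         _ = here refl
∈-slotLists (suc K) R ((x , y) ∷ sl) (s≤s len) ((x∈ , y∈) ∷ ∈s) = there
  (∈-concatMap-intro (λ x → concatMap (λ y → map ((x , y) ∷_) (slotLists K R)) R) x∈
    (∈-concatMap-intro (λ y → map ((x , y) ∷_) (slotLists K R)) y∈ (∈-map⁺ ((x , y) ∷_) (∈-slotLists K R sl len ∈s))))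

∈-universe : ∀ {K R sl load} → sl ∈ slotLists K R → load ∈ R → (sl , load) ∈ universe K R
∈-universe {R = R} {sl} sl∈ load∈ = ∈-concatMap-intro (λ sl → map (sl ,_) R) sl∈ (∈-map⁺ (sl ,_) load∈)

yea? : (b : ⟦ SideTy ⟧) → Dec (b ≡ yea)
yea? yea = yes refl
yea? nay = no λ ()

side-cases : (b : ⟦ SideTy ⟧) → b ≡ yea ⊎ b ≡ nay
side-cases yea = inj₁ refl
side-cases nay = inj₂ refl

module _ {h : ℕ → ℕ} {a b : ⟦ SideTy ⟧} {L n : ℕ} {J : Fin n → Job} (σ : Stage h a b L J) where
  open Stage σ

  private
    view : Fin n → View
    view i = viewOf h a b L (J i)

  start : Fin n → ℕ
  start i = end i ∸ h (psOf (J i))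

  work≤end : ∀ {i} → side i ≡ yea → h (psOf (J i)) ≤ end i
  work≤end {i} s = ≤-trans (m≤n+m _ _) (subst (λ y → gap a y (h (inOf (J i))) + h (processingOf y (J i)) ≤ end i) s (begins i))

  start+work : ∀ {i} → side i ≡ yea → start i + h (psOf (J i)) ≡ end i
  start+work s = m∸n+n≡m (work≤end s)

  release≤start : ∀ {i} → side i ≡ yea → gap a yea (h (inOf (J i))) ≤ start i
  release≤start {i} s = ≤-trans (≤-reflexive (sym (m+n∸n≡m _ (h (psOf (J i))))))
    (∸-monoˡ-≤ (h (psOf (J i))) (subst (λ y → gap a y (h (inOf (J i))) + h (processingOf y (J i)) ≤ end i) s (begins i)))

  end+tail≤L : ∀ {i} → side i ≡ yea → end i + gap yea b (h (outOf (J i))) ≤ L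
  end+tail≤L {i} s = subst (λ y → end i + gap y b (h (outOf (J i))) ≤ L) s (ends i)

  end≤L : ∀ i → end i ≤ L
  end≤L i = ≤-trans (m≤m+n (end i) _) (ends i)

  start≤L : ∀ i → start i ≤ L
  start≤L i = ≤-trans (m∸n≤m (end i) (h (psOf (J i)))) (end≤L i)

  span≤L : ∀ {i} → side i ≡ nay → cloudSpan (view i) ≤ L
  span≤L {i} s = ≤-trans (+-monoˡ-≤ _ (subst (λ y → gap a y (h (inOf (J i))) + h (processingOf y (J i)) ≤ end i) s (begins i)))
    (subst (λ y → end i + gap y b (h (outOf (J i))) ≤ L) s (ends i))

  intervals-disjoint : ∀ {i j} → i ≢ j → side i ≡ yea → side j ≡ yea → Disjoint (start i , end i) (start j , end j)
  intervals-disjoint {i} {j} i≢j si sj = Sum.map (m+n≤o⇒m≤o∸n (end i)) (m+n≤o⇒m≤o∸n (end j)) (apart i≢j si sj)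

  -- Early jobs run in reserved intervals, one for each class that has any;
  -- the others follow, in the order in which the table treats them.
  record Reservation (K : ℕ) : Set₁ where
    field
      Class   : Set
      classes : List Class
      few     : length classes ≤ K
      InClass : Class → Fin n → Set
      inClass? : ∀ c → Decidable (InClass c)

    Early : Fin n → Set
    Early i = Any (λ c → InClass c i) classes

    Late : Fin n → Set
    Late i = side i ≡ yea × ¬ Early i

    field
      -- A single slot can serve a class only if its server jobs share one interval. Several jobs do
      -- so when they have length 0.
      coincide : ∀ {c i j} → InClass c i → InClass c j → side i ≡ yea → side j ≡ yea → start i ≡ start j × end i ≡ end j
      separate : ∀ {i j} → Early i → side i ≡ yea → Late j → end i ≤ start j
      -- The premise on keys says that the table treats `j` before `i`. By the first half, idling
      -- until `j` is released holds up no job treated later. By the second, jobs already treated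
      -- are at least as urgent as the next one, so its due date bounds them as well.
      in-order : ∀ {i j} → Late i → Late j → key (view j) ≤ key (view i) →
                 release (view j) ≤ start i × tail (view i) ≤ tail (view j)

    early? : Decidable Early
    early? i = Any.any? (λ c → inClass? c i) classes

    late? : Decidable Late
    late? i = yea? (side i) ×-dec ¬? (early? i)

module _ {K B : ℕ} {R : List ℕ} {h : ℕ → ℕ} {a b : ⟦ SideTy ⟧} {L n : ℕ} {J : Fin n → Job} (σ : Stage h a b L J)
         (R∋ : ∀ {x} → x ≤ L → x ∈ R) (cheap : Stage.stageCost σ ≤ B) (reservation : Reservation σ K) where

  open Stage σ
  open Reservation reservation

  private
    view : Fin n → View
    view i = viewOf h a b L (J i)

    tag : Fin n → ℕ × View
    tag i = rank i , view i

    work′ : Fin n → ℕ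
    work′ i = h (psOf (J i))

    interval : Fin n → Slot
    interval i = start σ i , end i

    open module DP = Layered eqState (universe K R) B (options L) using (Has; has-step; has-init)

    slot-of : ∀ {c} → Dec (∃[ i ] side i ≡ yea × InClass c i) → List Slot
    slot-of (yes (i , _)) = interval i ∷ []
    slot-of (no _)        = []

    server? : ∀ i → Dec (side i ≡ yea)
    server? i = yea? (side i)

    slot : Class → List Slot
    slot c = slot-of (any? (λ i → server? i ×-dec inClass? c i))

    slots₀ : List Slot
    slots₀ = concatMap slot classes

    length-slot : ∀ {c} (d : Dec (∃[ i ] side i ≡ yea × InClass c i)) → length (slot-of d) ≤ 1
    length-slot (yes _) = ≤-refl
    length-slot (no _)  = z≤n

    length-slots : ∀ cs → length (concatMap slot cs) ≤ length cs
    length-slots []       = z≤n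
    length-slots (c ∷ cs) = ≤-trans (≤-reflexive (length-++ (slot c))) (+-mono-≤ (length-slot (any? (λ i → server? i ×-dec inClass? c i))) (length-slots cs))

    slot-source : ∀ {c s} (d : Dec (∃[ i ] side i ≡ yea × InClass c i)) → s ∈ slot-of d → ∃[ i ] s ≡ interval i
    slot-source (yes (i , _)) (here eq) = i , eq

    slots-inR : ∀ {s} → s ∈ slots₀ → proj₁ s ∈ R × proj₂ s ∈ R
    slots-inR s∈ = let c , _ , s∈c = ∈-concatMap-elim slot classes s∈
                       i , eq = slot-source (any? (λ i → server? i ×-dec inClass? c i)) s∈c
      in subst (λ s → proj₁ s ∈ R × proj₂ s ∈ R) (sym eq) (R∋ (start≤L σ i) , R∋ (end≤L σ i))

    slot-hit : ∀ {c i} (d : Dec (∃[ i ] side i ≡ yea × InClass c i)) → side i ≡ yea → InClass c i → interval i ∈ slot-of d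
    slot-hit (yes (j , sj , jc)) si ic = let p , q = coincide ic jc si sj in here (cong₂ _,_ p q)
    slot-hit (no ¬∃) si ic = ⊥-elim (¬∃ (_ , si , ic))

    slots-hit : ∀ {i cs} → side i ≡ yea → Any (λ c → InClass c i) cs → interval i ∈ concatMap slot cs
    slots-hit si (here {x = c} ic) = ∈-++⁺ˡ (slot-hit (any? (λ i → server? i ×-dec inClass? c i)) si ic)
    slots-hit {cs = c ∷ _} si (there e) = ∈-++⁺ʳ (slot c) (slots-hit si e)

    -- The initial load to be guessed: the first start of a late job, or `L` if there is none. Early
    -- server jobs end by then, since it is the greatest lower bound.
    threshold : ∃[ E ] E ≤ L × (∀ i → Late i → E ≤ start σ i) × (∀ x → x ≤ L → (∀ i → Late i → x ≤ start σ i) → x ≤ E)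
    threshold = least late? (start σ) L

    E₀ : ℕ
    E₀ = proj₁ threshold

    initially : Slot → Test
    initially s = leq (proj₂ s) E₀

    -- The load is tight: it is E plus the total work of the late jobs Q, all of
    -- which (and all later ones) start at E or afterwards.
    record Reached (zs : List (Fin n)) : Set where
      field
        slots    : List Slot
        load     : ℕ
        has      : Has (initial K R) (map tag zs) (slots , load) (sum (map priceOf zs))
        small    : length slots ≤ K
        inR      : ∀ {s} → s ∈ slots → proj₁ s ∈ R × proj₂ s ∈ R
        reserved : ∀ {i} → i ∉ zs → side i ≡ yea → Early i → interval i ∈ slots
        origin   : ℕ
        Q        : List (Fin n)
        load≡    : load ≡ origin + sum (map work′ Q)
        Q⊆       : ∀ {i} → i ∈ Q → i ∈ zs × Late i × origin ≤ start σ i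
        Q-unique : Unique Q
        future   : ∀ {i} → i ∉ zs → Late i → origin ≤ start σ i
        load≤L   : load ≤ L

    initially-reached : Reached []
    initially-reached = record
      { slots = sl ; load = E₀
      ; has = has-init eqState-refl eqState⁻ (∈-map⁺ (λ st → select (λ s → leq (proj₂ s) (proj₂ st)) (proj₁ st) , proj₂ st)
          (∈-universe (∈-slotLists K R slots₀ small₀ (All.tabulate slots-inR)) (R∋ E₀≤L)))
          (∈-universe (∈-slotLists K R sl small₁ (All.tabulate inR₁)) (R∋ E₀≤L))
      ; small = small₁ ; inR = inR₁
      ; reserved = λ {i} _ si e → ∈-select⁺ initially (leq⁺ (proj₂ (proj₂ (proj₂ threshold)) (end i) (end≤L σ i) (λ j l → separate e si l))) (slots-hit si e)
      ; origin = E₀ ; Q = [] ; load≡ = sym (+-identityʳ E₀) ; Q⊆ = λ () ; Q-unique = []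
      ; future = λ {i} _ l → proj₁ (proj₂ (proj₂ threshold)) i l
      ; load≤L = E₀≤L }
      where
      E₀≤L : E₀ ≤ L
      E₀≤L = proj₁ (proj₂ threshold)
      sl : List Slot
      sl = select initially slots₀
      small₀ : length slots₀ ≤ K
      small₀ = ≤-trans (length-slots classes) few
      small₁ : length sl ≤ K
      small₁ = ≤-trans (length-select initially slots₀) small₀
      inR₁ : ∀ {s} → s ∈ sl → proj₁ s ∈ R × proj₂ s ∈ R
      inR₁ s∈ = slots-inR (proj₂ (∈-select⁻ initially slots₀ s∈))

    module Next {j : Fin n} {zs : List (Fin n)} (r : Reached zs) (j∉ : j ∉ zs)
                (sorted : ∀ {k} → k ∈ zs → key (view k) ≤ key (view j))
                (sorted′ : ∀ {i} → i ∉ j ∷ zs → key (view j) ≤ key (view i))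
                (affordable : sum (map priceOf (j ∷ zs)) ≤ B) where
      open Reached r

      in-universe : ∀ {sl′ load′} → length sl′ ≤ K → (∀ {s} → s ∈ sl′ → proj₁ s ∈ R × proj₂ s ∈ R) → load′ ≤ L →
                    (sl′ , load′) ∈ universe K R
      in-universe small′ inR′ ≤L = ∈-universe (∈-slotLists K R _ small′ (All.tabulate inR′)) (R∋ ≤L)

      go : ∀ {sl′ load′ c d} → priceOf j ≡ c → ((sl′ , load′) , c , d) ∈ options L (tag j) (slots , load) →
           (sl′ , load′) ∈ universe K R → Has (initial K R) (map tag (j ∷ zs)) (sl′ , load′) (sum (map priceOf (j ∷ zs)))
      go {c = c} {d} refl o∈ u∈ = subst (Has (initial K R) (map tag (j ∷ zs)) _) (+-comm (sum (map priceOf zs)) (priceOf j))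
        (has-step eqState-refl eqState⁻ {init = initial K R} {i = tag j} {map tag zs} {d = d} has o∈ u∈ (≤-trans (≤-reflexive (+-comm (sum (map priceOf zs)) (priceOf j))) affordable))

      ∉tail : ∀ {i} → i ∉ j ∷ zs → i ∉ zs
      ∉tail i∉ i∈ = i∉ (there i∈)

      on-cloud : side j ≡ nay → Reached (j ∷ zs)
      on-cloud sj = record
        { slots = slots ; load = load
        ; has = go (cong (λ y → ite y 0 (pcOf (J j))) sj) (∈-++⁺ˡ (∈-guard⁺ (leq⁺ (span≤L σ sj)) (here refl))) (in-universe small inR load≤L)
        ; small = small ; inR = inR ; reserved = λ i∉ → reserved (∉tail i∉)
        ; origin = origin ; Q = Q ; load≡ = load≡ ; Q⊆ = λ i∈ → let p , q = Q⊆ i∈ in there p , q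
        ; Q-unique = Q-unique ; future = λ i∉ → future (∉tail i∉) ; load≤L = load≤L }

      free : side j ≡ yea → priceOf j ≡ 0
      free sj = cong (λ y → ite y 0 (pcOf (J j))) sj

      in-slot : side j ≡ yea → Early j → Reached (j ∷ zs)
      in-slot sj e = record
        { slots = clear (interval j) slots ; load = load
        ; has = go (free sj) (∈-++⁺ʳ (toCloud L (tag j) (slots , load)) (∈-++⁺ʳ (toEnd L (tag j) (slots , load))
            (∈-concatMap-intro (toSlot L (tag j) (slots , load)) (reserved j∉ sj e) (∈-guard⁺ fits (here refl)))))
            (in-universe (≤-trans (length-select disjoint? slots) small) (λ s∈ → inR (proj₂ (∈-select⁻ disjoint? slots s∈))) load≤L)
        ; small = ≤-trans (length-select disjoint? slots) small
        ; inR = λ s∈ → inR (proj₂ (∈-select⁻ disjoint? slots s∈))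
        ; reserved = λ {i} i∉ si ei → ∈-select⁺ disjoint? (kept i i∉ si) (reserved (∉tail i∉) si ei)
        ; origin = origin ; Q = Q ; load≡ = load≡ ; Q⊆ = λ i∈ → let p , q = Q⊆ i∈ in there p , q
        ; Q-unique = Q-unique ; future = λ i∉ → future (∉tail i∉) ; load≤L = load≤L }
        where
        disjoint? : Slot → Test
        disjoint? s′ = either (leq (end j) (proj₁ s′)) (leq (proj₂ s′) (start σ j))
        fits : both (leq (release (view j)) (start σ j)) (both (leq (start σ j + work′ j) (end j)) (leq (start σ j + work′ j + tail (view j)) L)) ≡ yea
        fits = both⁺ (leq⁺ (release≤start σ sj)) (both⁺ (leq⁺ (≤-reflexive (start+work σ sj)))
          (leq⁺ (≤-trans (+-monoˡ-≤ _ (≤-reflexive (start+work σ sj))) (end+tail≤L σ sj))))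
        either⁺ : ∀ {b c} → b ≡ yea ⊎ c ≡ yea → either b c ≡ yea
        either⁺ {yea} _ = refl
        either⁺ {nay} (inj₂ e) = e
        kept : ∀ i → i ∉ j ∷ zs → side i ≡ yea → disjoint? (interval i) ≡ yea
        kept i i∉ si = either⁺ (Sum.map leq⁺ leq⁺ (intervals-disjoint σ (λ { refl → i∉ (here refl) }) sj si))

      -- Jackson's argument: `j` and the jobs of `Q′` all run between `origin′` and the due date of
      -- `j`, because those of `Q′` are at least as urgent. By `packing` their total work fits
      -- there, and the load, being tight, meets the due date.
      append : Late j → ∀ origin′ Q′ → load + (release (view j) ∸ load) ≡ origin′ + sum (map work′ Q′) →
               (∀ {i} → i ∈ Q′ → i ∈ zs × Late i × origin′ ≤ start σ i) → Unique Q′ →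
               origin′ ≤ start σ j → (∀ {i} → i ∉ j ∷ zs → Late i → origin′ ≤ start σ i) → Reached (j ∷ zs)
      append late@(sj , _) origin′ Q′ from≡ Q′⊆ unique′ origin≤ future′ = record
        { slots = slots ; load = load + (release (view j) ∸ load) + work′ j
        ; has = go (free sj) (∈-++⁺ʳ (toCloud L (tag j) (slots , load)) (∈-++⁺ˡ (∈-guard⁺ (leq⁺ fits) (here refl)))) (in-universe small inR new≤L)
        ; small = small ; inR = inR ; reserved = λ i∉ → reserved (∉tail i∉)
        ; origin = origin′ ; Q = j ∷ Q′
        ; load≡ = load′≡
        ; Q⊆ = λ { (here refl) → here refl , late , origin≤ ; (there i∈) → let p , q = Q′⊆ i∈ in there p , q }
        ; Q-unique = All.tabulate (λ i∈ j≡i → j∉ (subst (_∈ zs) (sym j≡i) (proj₁ (Q′⊆ i∈)))) ∷ unique′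
        ; future = future′
        ; load≤L = new≤L }
        where
        D : ℕ
        D = L ∸ tail (view j)
        load′≡ : load + (release (view j) ∸ load) + work′ j ≡ origin′ + sum (map work′ (j ∷ Q′))
        load′≡ = trans (cong (_+ work′ j) from≡) (trans (+-assoc origin′ _ (work′ j)) (cong (origin′ +_) (+-comm _ (work′ j))))
        end≤D : end j ≤ D
        end≤D = m+n≤o⇒m≤o∸n (end j) (end+tail≤L σ sj)
        within : ∀ {i} → i ∈ j ∷ Q′ → Within origin′ D (interval i)
        within (here refl) = origin≤ , m∸n≤m (end j) (work′ j) , end≤D
        within {i} (there i∈) = let i∈zs , (si , ¬e) , ≤i = Q′⊆ i∈ in ≤i , m∸n≤m (end i) (work′ i) ,
          m+n≤o⇒m≤o∸n (end i) (≤-trans (+-monoʳ-≤ (end i) (proj₂ (in-order late (si , ¬e) (sorted i∈zs)))) (end+tail≤L σ si))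
        serves : ∀ {i} → i ∈ j ∷ Q′ → side i ≡ yea
        serves (here refl) = sj
        serves (there i∈)  = proj₁ (proj₁ (proj₂ (Q′⊆ i∈)))
        disjoint : ∀ qs → (∀ {i} → i ∈ qs → side i ≡ yea) → Unique qs → AllPairs Disjoint (map interval qs)
        disjoint []       _   []       = []
        disjoint (q ∷ qs) srv (u ∷ us) = All.map⁺ (All.tabulate (λ i∈ → intervals-disjoint σ (All.lookup u i∈) (srv (here refl)) (srv (there i∈))))
          ∷ disjoint qs (srv ∘ there) us
        extents : ∀ qs → (∀ {i} → i ∈ qs → side i ≡ yea) → sum (map extent (map interval qs)) ≡ sum (map work′ qs)
        extents []       _   = refl
        extents (q ∷ qs) srv = cong₂ _+_ (m∸[m∸n]≡n (work≤end σ (srv (here refl)))) (extents qs (srv ∘ there))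
        unique : Unique (j ∷ Q′)
        unique = All.tabulate (λ i∈ j≡i → j∉ (subst (_∈ zs) (sym j≡i) (proj₁ (Q′⊆ i∈)))) ∷ unique′
        new≤D : load + (release (view j) ∸ load) + work′ j ≤ D
        new≤D = ≤-trans (≤-reflexive (trans load′≡ (cong (origin′ +_) (sym (extents (j ∷ Q′) serves)))))
          (packing (map interval (j ∷ Q′)) (disjoint (j ∷ Q′) serves unique) (All.map⁺ (All.tabulate within))
            (≤-trans origin≤ (≤-trans (m∸n≤m (end j) (work′ j)) end≤D)))
        new≤L : load + (release (view j) ∸ load) + work′ j ≤ L
        new≤L = ≤-trans new≤D (m∸n≤m L (tail (view j)))
        fits : load + (release (view j) ∸ load) + work′ j + tail (view j) ≤ L
        fits = ≤-trans (+-monoˡ-≤ _ new≤D) (≤-reflexive (m∸n+n≡m (≤-trans (m≤n+m _ (end j)) (end+tail≤L σ sj))))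

      at-end : Late j → Reached (j ∷ zs)
      at-end late@(sj , _) = [ waiting , idle ]′ (≤-total (release (view j)) load)
        where
        waiting : release (view j) ≤ load → Reached (j ∷ zs)
        waiting r≤ = append late origin Q (trans (cong (load +_) (m≤n⇒m∸n≡0 r≤)) (trans (+-identityʳ load) load≡))
          Q⊆ Q-unique (future j∉ late) (λ i∉ → future (∉tail i∉))
        -- The server waits for the release of `j`, and a new busy period begins there with `Q`
        -- empty. No late job still to come starts before this time, by the first half of
        -- `in-order`.
        idle : load ≤ release (view j) → Reached (j ∷ zs)
        idle ≤r = append late (release (view j)) [] (trans (m+[n∸m]≡n ≤r) (sym (+-identityʳ _))) (λ ()) []
          (release≤start σ sj) (λ i∉ li → proj₁ (in-order li late (sorted′ i∉)))

      next-reached : Reached (j ∷ zs)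
      next-reached = [ (λ sj → dec sj (early? j)) , on-cloud ]′ (side-cases (side j))
        where
        dec : side j ≡ yea → Dec (Early j) → Reached (j ∷ zs)
        dec sj (yes e) = in-slot sj e
        dec sj (no ¬e) = at-end (sj , ¬e)

    -- The premise on jobs outside `zs` is what remains of `zs` being a suffix of the sorted order.
    reach : ∀ zs → Unique zs → AllPairs (λ i k → key (view k) ≤ key (view i)) zs →
            (∀ {i k} → i ∉ zs → k ∈ zs → key (view k) ≤ key (view i)) → sum (map priceOf zs) ≤ B → Reached zs
    reach []       _        _        _      _      = initially-reached
    reach (j ∷ zs) (u ∷ us) (s ∷ ss) sorted afford = Next.next-reached
      (reach zs us ss (λ {i} i∉ k∈ → later i k∈ i∉ (i ≟ᶠ j)) (≤-trans (m≤n+m _ (priceOf j)) afford))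
      (λ j∈ → All.lookup u j∈ refl) (All.lookup s) (λ i∉ → sorted i∉ (here refl)) afford
      where
      later : ∀ i {k} → k ∈ zs → i ∉ zs → Dec (i ≡ j) → key (view k) ≤ key (view i)
      later i k∈ i∉ (yes refl) = All.lookup s k∈
      later i k∈ i∉ (no i≢j)   = sorted (λ { (here eq) → i≢j eq ; (there i∈) → i∉ i∈ }) (there k∈)

  stage-complete : ∃[ st ] ∃[ c ] ∃[ ds ] (st , c , ds) ∈ stageTable K B R L (stageItems h a b L (tabulate J)) × c ≤ stageCost
  stage-complete =
    let ord , eq , ord↭ = ordering K B R {h} {a} {b} {L} J
        total : sum (map priceOf ord) ≡ stageCost
        total = sum-↭ (map⁺ priceOf ord↭)
        sorted = AllPairs.map⁻ (subst (AllPairs (λ x y → itemKey y ≤ itemKey x)) eq (sort-sorted itemKey (stageItems h a b L (tabulate J))))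
        r = reach ord (ordering-unique K B R {h} {a} {b} {L} J ord↭) sorted
              (λ {i} i∉ _ → ⊥-elim (i∉ (∈-resp-↭ (↭-sym ord↭) (∈-allFin i)))) (≤-trans (≤-reflexive total) cheap)
        c , ds , e∈ , c≤ = Reached.has r
        st = Reached.slots r , Reached.load r
    in st , c , ds , subst (λ its → (st , c , ds) ∈ Layered.table eqState (universe K R) B (options L) (initial K R) its) (sym eq) e∈ ,
       ≤-trans c≤ (≤-reflexive total)

-- Reservations exist under each of the three conditions

earliest : ∀ {n} {P : Fin n → Set} (P? : Decidable P) (f : Fin n → ℕ) → ∃[ i ] P i →
           ∃[ i ] P i × (∀ j → P j → f i ≤ f j)
earliest {suc n} {P} P? f (k , pk) with any? (P? ∘ suc) | P? zero
... | no ¬∃ | no ¬p = ⊥-elim (none k pk)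
  where
  none : ∀ k → ¬ P k
  none zero    p = ¬p p
  none (suc k) p = ¬∃ (k , p)
... | no ¬∃ | yes p = zero , p , λ { zero _ → ≤-refl ; (suc j) q → ⊥-elim (¬∃ (j , q)) }
... | yes ∃ | no ¬p with earliest (P? ∘ suc) (f ∘ suc) ∃
...   | i , pi , min = suc i , pi , λ { zero p → ⊥-elim (¬p p) ; (suc j) q → min j q }
earliest {suc n} {P} P? f (k , pk) | yes ∃ | yes p with earliest (P? ∘ suc) (f ∘ suc) ∃
... | i , pi , min with f zero ≤? f (suc i)
...   | yes f≤ = zero , p , λ { zero _ → ≤-refl ; (suc j) q → ≤-trans f≤ (min j q) }
...   | no f≰  = suc i , pi , λ { zero _ → <⇒≤ (≰⇒> f≰) ; (suc j) q → min j q }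

-- Truncated subtraction from `L` reflects the order only up to `L`. The tail of `i` stays below, as
-- `i` runs on the server and its tail ends within the stage.
tails : ∀ {h a L n} {J : Fin n → Job} (σ : Stage h a nay L J) {i j} → Stage.side σ i ≡ yea → L ∸ h (outOf (J j)) ≤ L ∸ h (outOf (J i)) → h (outOf (J i)) ≤ h (outOf (J j))
tails {h} {L = L} {J = J} σ {i} {j} si le = begin
  q            ≡⟨ m∸[m∸n]≡n (≤-trans (m≤n+m q (Stage.end σ i)) (end+tail≤L σ si)) ⟨
  L ∸ (L ∸ q)  ≤⟨ ∸-monoʳ-≤ L le ⟩
  L ∸ (L ∸ q′) ≤⟨ m∸[m∸n]≤n L q′ ⟩
  q′           ∎
  where
  open ≤-Reasoning hiding (start)
  q = h (outOf (J i))
  q′ = h (outOf (J j))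
  m∸[m∸n]≤n : ∀ m n → m ∸ (m ∸ n) ≤ n
  m∸[m∸n]≤n m n = m≤n+o⇒m∸n≤o m (m ∸ n) (≤-trans (m≤n+m∸n m n) (≤-reflexive (+-comm n (m ∸ n))))

-- What the three conditions say about release times on the server. In the first they are compared
-- with server processing times because the length of the first job is what the others wait for.
Condition : ℕ → ∀ {n} → (Fin n → Job) → Set
Condition cmax J = (∀ i k → inOf (J k) ≤ psOf (J i)) ⊎ (∀ i → inOf (J i) ≤ cmax) ⊎ (∀ i k → inOf (J i) ≡ inOf (J k))

-- Two slots for each start below `cmax`, and one more so that the first job has a slot even if
-- `cmax` is 0.
slotBound : ℕ → ℕ
slotBound cmax = suc (cmax + cmax)

module _ {h : ℕ → ℕ} (h-mono : ∀ {x y} → x ≤ y → h x ≤ h y) (h≤ : ∀ x → h x ≤ x) (cmax : ℕ) where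

  private
    noClasses : ∀ {a b L n} {J : Fin n → Job} (σ : Stage h a b L J) →
      (∀ {i j} → Stage.side σ i ≡ yea → Stage.side σ j ≡ yea → key (viewOf h a b L (J j)) ≤ key (viewOf h a b L (J i)) →
         gap a yea (h (inOf (J j))) ≤ start σ i × gap yea b (h (outOf (J i))) ≤ gap yea b (h (outOf (J j)))) →
      Reservation σ (slotBound cmax)
    noClasses σ ord = record
      { Class = ⊥ ; classes = [] ; few = z≤n ; InClass = λ () ; inClass? = λ () ; coincide = λ {c} → ⊥-elim c
      ; separate = λ () ; in-order = λ (si , _) (sj , _) → ord si sj }

  module BetweenClouds {L n} {J : Fin n → Job} (σ : Stage h nay nay L J) where
    open Stage σ

    -- A server job starts no earlier than its own release time, hence no earlier than anyone's.
    sameRelease : (∀ i k → h (inOf (J k)) ≤ h (inOf (J i))) → Reservation σ (slotBound cmax)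
    sameRelease eq = noClasses σ λ {i} {j} si sj le → ≤-trans (eq i j) (release≤start σ si) , tails σ si le

    server? : ∀ i → Dec (side i ≡ yea)
    server? i = yea? (side i)

    -- If some rounded server processing time is 0, all rounded release times are. Otherwise every
    -- server job after the first starts no earlier than the length of the first, and that length
    -- dominates all release times.
    firstJob : (∀ i k → inOf (J k) ≤ psOf (J i)) → Reservation σ (slotBound cmax)
    firstJob dom with any? (λ i → h (psOf (J i)) ≟ 0)
    ... | yes (i , z) = sameRelease λ _ k → ≤-trans (≤-trans (h-mono (dom i k)) (≤-reflexive z)) z≤n
    ... | no positive with any? server?
    ...   | no ¬∃ = noClasses σ λ {i} si _ _ → ⊥-elim (¬∃ (i , si))
    ...   | yes ∃ with earliest server? end ∃
    ...     | f , sf , first = record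
      { Class = ⊤ ; classes = tt ∷ [] ; few = s≤s z≤n ; InClass = λ _ i → i ≡ f ; inClass? = λ _ i → i ≟ᶠ f
      ; coincide = λ { refl refl _ _ → refl , refl }
      ; separate = λ { (here refl) _ (sj , ¬e) → f-before sj (λ { refl → ¬e (here refl) }) }
      ; in-order = λ {i} {j} (si , ¬e) _ le → ≤-trans (h-mono (dom f j)) (≤-trans (work≤end σ sf)
          (f-before si (λ { refl → ¬e (here refl) }))) , tails σ si le }
      where
      f-before : ∀ {j} → side j ≡ yea → f ≢ j → end f ≤ start σ j
      f-before {j} sj f≢j = [ id , (λ ≤f → ⊥-elim (positive (f , f-zero ≤f))) ]′ (intervals-disjoint σ f≢j sf sj)
        where
        f-zero : end j ≤ start σ f → h (psOf (J f)) ≡ 0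
        f-zero ≤f = n≤0⇒n≡0 (+-cancelˡ-≤ (start σ f) _ 0 (begin
          start σ f + h (psOf (J f)) ≡⟨ start+work σ sf ⟩
          end f                      ≤⟨ first j sj ⟩
          end j                      ≤⟨ ≤f ⟩
          start σ f                  ≡⟨ +-identityʳ _ ⟨
          start σ f + 0              ∎))
          where open ≤-Reasoning hiding (start)

    -- By `h≤`, rounding keeps release times below `cmax`, so whatever starts at `cmax` or later
    -- finds all jobs released. Two jobs of positive length with the same start would overlap, hence
    -- one slot per start suffices for these, and an empty one for all jobs of length 0.
    boundedRelease : (∀ i → inOf (J i) ≤ cmax) → Reservation σ (slotBound cmax)
    boundedRelease small = record
      { Class = Bool × ℕ ; classes = classes ; few = few ; InClass = InClass ; inClass? = inClass?
      ; coincide = λ {c} → coincide c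
      ; separate = λ {i} {j} e si (sj , ¬e) → [ id , (λ ≤i → ⊥-elim (<-irrefl refl (begin-strict
            start σ j ≤⟨ m∸n≤m (end j) (h (psOf (J j))) ⟩
            end j     ≤⟨ ≤i ⟩
            start σ i <⟨ early⇒< e ⟩
            cmax      ≤⟨ late⇒≥ ¬e ⟩
            start σ j ∎))) ]′ (intervals-disjoint σ (λ { refl → ¬e e }) si sj)
      ; in-order = λ {i} {j} (si , ¬e) _ le → ≤-trans (h≤ _) (≤-trans (small j) (late⇒≥ ¬e)) , tails σ si le }
      where
      open ≤-Reasoning hiding (start)
      half : Bool → List (Bool × ℕ)
      half t = map (t ,_) (upTo cmax)
      classes : List (Bool × ℕ)
      classes = half true ++ half false
      few : length classes ≤ slotBound cmax
      few = ≤-trans (≤-reflexive (trans (length-++ (half true)) (cong₂ _+_ (len true) (len false)))) (n≤1+n _)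
        where
        len : ∀ t → length (half t) ≡ cmax
        len t = trans (length-map _ (upTo cmax)) (length-upTo cmax)
      Kind : Bool → ℕ → Set
      Kind true  w = w ≡ 0
      Kind false w = w ≢ 0
      kind? : ∀ t w → Dec (Kind t w)
      kind? true  w = w ≟ 0
      kind? false w = ¬? (w ≟ 0)
      InClass : Bool × ℕ → Fin n → Set
      InClass (t , x) i = start σ i ≡ x × Kind t (h (psOf (J i)))
      inClass? : ∀ c → Decidable (InClass c)
      inClass? (t , x) i = (start σ i ≟ x) ×-dec kind? t _
      end≡ : ∀ {i} → side i ≡ yea → h (psOf (J i)) ≡ 0 → end i ≡ start σ i
      end≡ {i} si z = trans (sym (start+work σ si)) (trans (cong (start σ i +_) z) (+-identityʳ _))
      no-overlap : ∀ {i j} → side i ≡ yea → h (psOf (J i)) ≢ 0 → start σ i ≡ start σ j → ¬ end i ≤ start σ j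
      no-overlap {i} {j} si nz s≡ le = nz (n≤0⇒n≡0 (+-cancelˡ-≤ (start σ i) _ 0 (begin
        start σ i + h (psOf (J i)) ≡⟨ start+work σ si ⟩
        end i                      ≤⟨ le ⟩
        start σ j                  ≡⟨ s≡ ⟨
        start σ i                  ≡⟨ +-identityʳ _ ⟨
        start σ i + 0              ∎)))
      coincide : ∀ c {i j} → InClass c i → InClass c j → side i ≡ yea → side j ≡ yea → start σ i ≡ start σ j × end i ≡ end j
      coincide (true , _) (p , z) (q , z′) si sj = trans p (sym q) , trans (end≡ si z) (trans (trans p (sym q)) (sym (end≡ sj z′)))
      coincide (false , _) {i} {j} (p , nz) (q , nz′) si sj = dec (i ≟ᶠ j)
        where
        dec : Dec (i ≡ j) → start σ i ≡ start σ j × end i ≡ end j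
        dec (yes refl) = refl , refl
        dec (no i≢j)   = ⊥-elim ([ no-overlap si nz (trans p (sym q)) , no-overlap sj nz′ (trans q (sym p)) ]′ (intervals-disjoint σ i≢j si sj))
      in-range : ∀ {t i} → Any (λ c → InClass c i) (half t) → start σ i < cmax
      in-range {t} {i} e = let x , x∈ , p , _ = find (Any.map⁻ e) in ≤-trans (s≤s (≤-reflexive p)) (∈-upTo⁻ x∈)
      early⇒< : ∀ {i} → Any (λ c → InClass c i) classes → start σ i < cmax
      early⇒< e = [ in-range , in-range ]′ (Any.++⁻ (half true) e)
      late⇒≥ : ∀ {i} → ¬ Any (λ c → InClass c i) classes → cmax ≤ start σ i
      late⇒≥ {i} ¬e = ≮⇒≥ λ lt → ¬e (hit lt (h (psOf (J i)) ≟ 0))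
        where
        hit : start σ i < cmax → Dec (h (psOf (J i)) ≡ 0) → Any (λ c → InClass c i) classes
        hit lt (yes z) = Any.++⁺ˡ (lose (∈-map⁺ (true ,_) (∈-upTo⁺ lt)) (refl , z))
        hit lt (no nz) = Any.++⁺ʳ (half true) (lose (∈-map⁺ (false ,_) (∈-upTo⁺ lt)) (refl , nz))

  reserve : ∀ {a b L n} {J : Fin n → Job} → Condition cmax J → (σ : Stage h a b L J) → Reservation σ (slotBound cmax)
  -- Here keys are release times and tails are 0; in the next clause release times are 0 and keys
  -- are due dates.
  reserve {a}   {yea} c σ = noClasses σ λ si _ le → ≤-trans le (release≤start σ si) , ≤-refl
  reserve {yea} {nay} c σ = noClasses σ λ si _ le → z≤n , tails σ si le
  reserve {nay} {nay} (inj₁ c)        σ = BetweenClouds.firstJob σ c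
  reserve {nay} {nay} (inj₂ (inj₁ c)) σ = BetweenClouds.boundedRelease σ c
  reserve {nay} {nay} (inj₂ (inj₂ c)) σ = BetweenClouds.sameRelease σ λ i k → ≤-reflexive (cong h (c k i))

-- Links

jobOf : (l : Link) → Fin (length (parallelJobs l)) → Job
jobOf l i = encodeParallelJob (List.lookup (parallelJobs l) i)

-- A chain edge becomes a stage without jobs whose length is at least the delay, so that both kinds
-- of link are treated alike.
record LinkStage (h : ℕ → ℕ) (a b : ⟦ SideTy ⟧) (L : ℕ) (l : Link) : Set where
  field
    edge-delay : ∀ {c} → l ≡ edge c → gap a b (h c) ≤ L
    stage      : Stage h a b L (jobOf l)

  open Stage stage public

  places : ℕ → Places
  places C = map (λ i → side i , C + end i) (allFin _)

encoded-jobs : ∀ j js → encodeParallelJob j ∷ map encodeParallelJob js ≡ tabulate (jobOf (parallel (j ∷ js)))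
encoded-jobs j js = trans (cong (map encodeParallelJob) (sym (tabulate-lookup (j ∷ js)))) (map-tabulate (List.lookup (j ∷ js)) encodeParallelJob)

module _ (K B : ℕ) (R : List ℕ) (h : ℕ → ℕ) (a b : ⟦ SideTy ⟧) where

  SoundOption : ∀ {n} → (Fin n → Job) → ℕ × (ℕ × Places) → Set
  SoundOption J (L , c , pl) = Σ[ σ ∈ Stage h a b L J ] Stage.stageCost σ ≡ c × pl ≡ map (λ i → Stage.side σ i , Stage.end σ i) (allFin _)

  parallel-sound : ∀ {n} (J : Fin n → Job) {o} → o ∈ parallelOptions K h B R a b (tabulate J) → SoundOption J o
  parallel-sound {n} J o∈ =
    let L , _ , o∈′ = ∈-concatMap-elim option R o∈
        (st , c , ds) , e∈ , eq = ∈-map⁻ (result L) o∈′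
        σ , cost≡ , placed = stage-sound K B R J e∈
    in subst (SoundOption J) (sym eq) (σ , cost≡ , (begin
      map (λ ij → placeOf ds (proj₁ ij)) (enum (tabulate J))       ≡⟨ cong (map _) (enum-tabulate J) ⟩
      map (λ ij → placeOf ds (proj₁ ij)) (map (λ i → rank i , J i) (allFin n)) ≡⟨ map-∘ (allFin n) ⟨
      map (λ i → placeOf ds (rank i)) (allFin n)                   ≡⟨ map-cong placed (allFin n) ⟩
      map (λ i → Stage.side σ i , Stage.end σ i) (allFin n)        ∎))
    where
    open ≡-Reasoning
    result : ℕ → ⟦ StageEntryTy ⟧ → ℕ × (ℕ × Places)
    result L e = L , proj₁ (proj₂ e) , map (λ ij → placeOf (proj₂ (proj₂ e)) (proj₁ ij)) (enum (tabulate J))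
    option : ℕ → List (ℕ × (ℕ × Places))
    option L = map (result L) (stageTable K B R L (stageItems h a b L (tabulate J)))

  SoundLink : Link → ℕ × (ℕ × Places) → Set
  SoundLink l (L , c , pl) = Σ[ s ∈ LinkStage h a b L l ] LinkStage.stageCost s ≡ c × pl ≡ map (λ i → LinkStage.side s i , LinkStage.end s i) (allFin _)

  options-sound : ∀ l {o} → o ∈ stageOptions K h B R a b (encodeLink l) → SoundLink l o
  options-sound (edge c) o∈ =
    let L , L∈ , eq = ∈-map⁻ (λ L → L , 0 , []) o∈
        fits = leq⁻ (proj₁ (∈-select⁻ (λ L → leq (gap a b (h c)) L) R L∈))
    in subst (SoundLink (edge c)) (sym eq) (record
      { edge-delay = λ { refl → fits }
      ; stage = record { side = λ () ; end = λ () ; begins = λ () ; ends = λ () ; apart = λ {i} → λ { } } } , refl , refl)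
  options-sound (parallel (j ∷ js)) {o} o∈ =
    let σ , rest = parallel-sound (jobOf (parallel (j ∷ js))) (subst (λ js → o ∈ parallelOptions K h B R a b js) (encoded-jobs j js) o∈)
    in record { edge-delay = λ () ; stage = σ } , rest

  module _ {cmax : ℕ} (K≡ : K ≡ slotBound cmax) (h-mono : ∀ {x y} → x ≤ y → h x ≤ h y) (h≤ : ∀ x → h x ≤ x) where

    CheapOption : List (ℕ × (ℕ × Places)) → ℕ → ℕ → Set
    CheapOption os L c = ∃[ c′ ] ∃[ pl ] (L , c′ , pl) ∈ os × c′ ≤ c

    parallel-complete : ∀ {L n} {J : Fin n → Job} → Condition cmax J → (σ : Stage h a b L J) → (∀ {x} → x ≤ L → x ∈ R) →
      Stage.stageCost σ ≤ B → CheapOption (parallelOptions K h B R a b (tabulate J)) L (Stage.stageCost σ)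
    parallel-complete {L} {n} {J} cond σ R∋ cheap =
      let st , c , ds , e∈ , c≤ = stage-complete {K} {B} {R} σ R∋ cheap (subst (Reservation σ) (sym K≡) (reserve h-mono h≤ cmax cond σ))
      in c , _ , ∈-concatMap-intro option (R∋ ≤-refl) (∈-map⁺ (result L) e∈) , c≤
      where
      result : ℕ → ⟦ StageEntryTy ⟧ → ℕ × (ℕ × Places)
      result L e = L , proj₁ (proj₂ e) , map (λ ij → placeOf (proj₂ (proj₂ e)) (proj₁ ij)) (enum (tabulate J))
      option : ℕ → List (ℕ × (ℕ × Places))
      option L = map (result L) (stageTable K B R L (stageItems h a b L (tabulate J)))

    options-complete : ∀ {L} l → Condition cmax (jobOf l) → (s : LinkStage h a b L l) → (∀ {x} → x ≤ L → x ∈ R) →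
      LinkStage.stageCost s ≤ B → CheapOption (stageOptions K h B R a b (encodeLink l)) L (LinkStage.stageCost s)
    options-complete {L} (edge c) _ s R∋ _ = 0 , [] ,
      ∈-map⁺ (λ L → L , 0 , []) (∈-select⁺ (λ L → leq (gap a b (h c)) L) (leq⁺ (LinkStage.edge-delay s refl)) (R∋ ≤-refl)) , z≤n
    options-complete {L} (parallel (j ∷ js)) cond s R∋ cheap =
      subst (λ js → CheapOption (parallelOptions K h B R a b js) L (LinkStage.stageCost s)) (sym (encoded-jobs j js))
        (parallel-complete cond (LinkStage.stage s) R∋ cheap)

-- Rounding plans

module _ {A : Set} {P Q : A → Set} (P? : Decidable P) (Q? : Decidable Q) where

  filter-length-mono : ∀ xs → (∀ {x} → P x → Q x) → length (List.filter P? xs) ≤ length (List.filter Q? xs)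
  filter-length-mono [] P⊆Q = z≤n
  filter-length-mono (x ∷ xs) P⊆Q with P? x | Q? x
  ... | yes _ | yes _ = s≤s (filter-length-mono xs P⊆Q)
  ... | yes p | no ¬q = ⊥-elim (¬q (P⊆Q p))
  ... | no _  | yes _ = m≤n⇒m≤1+n (filter-length-mono xs P⊆Q)
  ... | no _  | no _  = filter-length-mono xs P⊆Q

  filter-length-strict : ∀ {x xs} → (∀ {x} → P x → Q x) → x ∈ xs → Q x → ¬ P x → length (List.filter P? xs) < length (List.filter Q? xs)
  filter-length-strict {x} {_ ∷ xs} P⊆Q (here refl) q ¬p with P? x | Q? x
  ... | yes p | _     = ⊥-elim (¬p p)
  ... | no _  | no ¬q = ⊥-elim (¬q q)
  ... | no _  | yes _ = s≤s (filter-length-mono xs P⊆Q)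
  filter-length-strict {xs = y ∷ xs} P⊆Q (there x∈) q ¬p with P? y | Q? y
  ... | yes _ | yes _ = s≤s (filter-length-strict P⊆Q x∈ q ¬p)
  ... | yes p | no ¬q = ⊥-elim (¬q (P⊆Q p))
  ... | no _  | yes _ = m≤n⇒m≤1+n (filter-length-strict P⊆Q x∈ q ¬p)
  ... | no _  | no _  = filter-length-strict P⊆Q x∈ q ¬p

stage-mono : ∀ {h a b L L′ n} {J : Fin n → Job} → L ≤ L′ → Stage h a b L J → Stage h a b L′ J
stage-mono L≤ σ = record { side = side ; end = end ; begins = begins ; ends = λ i → ≤-trans (ends i) L≤ ; apart = apart }
  where open Stage σ

gap-h : ∀ {h : ℕ → ℕ} → h 0 ≡ 0 → ∀ a b c → gap a b (h c) ≡ h (gap a b c)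
gap-h h-0 yea yea c = sym h-0
gap-h h-0 yea nay c = refl
gap-h h-0 nay yea c = refl
gap-h h-0 nay nay c = sym h-0

module Rounding {h : ℕ → ℕ} {e : ℕ} (h-mono : ∀ {x y} → x ≤ y → h x ≤ h y) (h-0 : h 0 ≡ 0)
                (h-+ : ∀ x y → h x + h y ≤ h (x + y) + e) where

  module _ {a b : ⟦ SideTy ⟧} {L n : ℕ} {J : Fin n → Job} (σ : Stage id a b L J) where
    open Stage σ

    -- A server job of positive length counts itself, so its count exceeds that of every job ending
    -- before it starts. This extra unit pays for rounding its processing time.
    Counted : Fin n → Fin n → Set
    Counted j i = side i ≡ yea × psOf (J i) ≢ 0 × end i ≤ end j

    counted? : ∀ j → Decidable (Counted j)
    counted? j i = yea? (side i) ×-dec ¬? (psOf (J i) ≟ 0) ×-dec (end i ≤? end j)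

    count : Fin n → ℕ
    count j = length (List.filter (counted? j) (allFin n))

    count≤n : ∀ j → count j ≤ n
    count≤n j = ≤-trans (length-filter (counted? j) (allFin n)) (≤-reflexive (length-tabulate id))

    -- Every server job delays the jobs behind it by at most one unit e.
    round-stage : Stage h a b (h L + e * (2 + n)) J
    round-stage = record { side = side ; end = end′ ; begins = begins′ ; ends = ends′ ; apart = λ i≢j si sj → Sum.map (later _ _ sj) (later _ _ si) (apart i≢j si sj) }
      where
      open ≤-Reasoning
      end′ : Fin n → ℕ
      -- The unit added by `suc` pays for rounding delay and processing time separately in
      -- `begins′`; the delay after the job takes one more in `ends′`.
      end′ j = h (end j) + e * suc (count j)
      begins′ : ∀ i → gap a (side i) (h (inOf (J i))) + h (processingOf (side i) (J i)) ≤ end′ i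
      begins′ i = begin
        gap a (side i) (h (inOf (J i))) + h p     ≡⟨ cong (_+ h p) (gap-h {h} h-0 a (side i) _) ⟩
        h (gap a (side i) (inOf (J i))) + h p     ≤⟨ h-+ (gap a (side i) (inOf (J i))) p ⟩
        h (gap a (side i) (inOf (J i)) + p) + e   ≤⟨ +-mono-≤ (h-mono (begins i)) (m≤m*n e (suc (count i))) ⟩
        end′ i                                    ∎
        where p = processingOf (side i) (J i)
      ends′ : ∀ i → end′ i + gap (side i) b (h (outOf (J i))) ≤ h L + e * (2 + n)
      ends′ i = begin
        h (end i) + e * suc (count i) + gap (side i) b (h (outOf (J i))) ≡⟨ cong (end′ i +_) (gap-h {h} h-0 (side i) b _) ⟩
        h (end i) + e * suc (count i) + h g   ≡⟨ arrange (h (end i)) (e * suc (count i)) (h g) ⟩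
        h (end i) + h g + e * suc (count i)   ≤⟨ +-monoˡ-≤ _ (h-+ (end i) g) ⟩
        h (end i + g) + e + e * suc (count i) ≡⟨ +-assoc (h (end i + g)) e _ ⟩
        h (end i + g) + (e + e * suc (count i)) ≡⟨ cong (h (end i + g) +_) (*-suc e (suc (count i))) ⟨
        h (end i + g) + e * (2 + count i)     ≤⟨ +-mono-≤ (h-mono (ends i)) (*-monoʳ-≤ e (s≤s (s≤s (count≤n i)))) ⟩
        h L + e * (2 + n)                     ∎
        where
        g = gap (side i) b (outOf (J i))
        arrange : ∀ a b c → a + b + c ≡ a + c + b
        arrange = solve-∀
      later : ∀ i j → side j ≡ yea → end i + psOf (J j) ≤ end j → end′ i + h (psOf (J j)) ≤ end′ j
      later i j sj le = dec (psOf (J j) ≟ 0)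
        where
        i≤j : end i ≤ end j
        i≤j = ≤-trans (m≤m+n (end i) _) le
        dec : Dec (psOf (J j) ≡ 0) → end′ i + h (psOf (J j)) ≤ end′ j
        dec (yes z) = begin
          end′ i + h (psOf (J j))            ≡⟨ cong (λ p → end′ i + h p) z ⟩
          end′ i + h 0                       ≡⟨ cong (end′ i +_) h-0 ⟩
          end′ i + 0                         ≡⟨ +-identityʳ _ ⟩
          end′ i                             ≤⟨ +-mono-≤ (h-mono i≤j) (*-monoʳ-≤ e (s≤s (filter-length-mono (counted? i) (counted? j) (allFin n)
                                                 (λ (s , p , ≤i) → s , p , ≤-trans ≤i i≤j)))) ⟩
          end′ j                             ∎
        dec (no nz) = begin
          h (end i) + e * suc (count i) + h p   ≡⟨ arrange (h (end i)) (e * suc (count i)) (h p) ⟩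
          h (end i) + h p + e * suc (count i)   ≤⟨ +-monoˡ-≤ _ (h-+ (end i) p) ⟩
          h (end i + p) + e + e * suc (count i) ≡⟨ +-assoc (h (end i + p)) e _ ⟩
          h (end i + p) + (e + e * suc (count i)) ≡⟨ cong (h (end i + p) +_) (*-suc e (suc (count i))) ⟨
          h (end i + p) + e * (2 + count i)     ≤⟨ +-mono-≤ (h-mono le) (*-monoʳ-≤ e (s≤s (filter-length-strict (counted? i) (counted? j)
              (λ (s , q , ≤i) → s , q , ≤-trans ≤i i≤j) (∈-allFin j) (sj , nz , ≤-refl) λ (_ , _ , j≤i) → nz (n≤0⇒n≡0 (+-cancelˡ-≤ (end i) p 0
                (≤-trans le (≤-trans j≤i (≤-reflexive (sym (+-identityʳ _)))))))))) ⟩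
          end′ j                                ∎
          where
          p = psOf (J j)
          arrange : ∀ a b c → a + b + c ≡ a + c + b
          arrange = solve-∀

-- Plans for a chain

-- A link with the processing time of the chain job before it, on the server
-- and (unless it is the source) on the cloud.
ChainLink : Set
ChainLink = Link × (ℕ × List ℕ)

encodeChainLink : ChainLink → ⟦ ChainItemTy ⟧
encodeChainLink (l , job) = encodeLink l , job

data Choice : ℕ × List ℕ → ⟦ SideTy ⟧ → ℕ → ℕ → Set where
  on-server : ∀ {p pcs} → Choice (p , pcs) yea p 0
  on-cloud  : ∀ {p pcs pc} → pc ∈ pcs → Choice (p , pcs) nay pc pc

-- Plan h a S ls T κ ds: from a chain job on side a starting at time S through
-- the links ls to the sink at time T, at cost κ, with schedule ds.
data Plan (h : ℕ → ℕ) : ⟦ SideTy ⟧ → ℕ → List ChainLink → ℕ → ℕ → List ⟦ ChainDecisionTy ⟧ → Set where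
  finish : ∀ {T} → Plan h yea T [] T 0 []
  via    : ∀ {a b S S′ l job p c L ls T κ ds} → Choice job a p c → (s : LinkStage h a b L l) → S + h p + L ≡ S′ →
           Plan h b S′ ls T κ ds →
           Plan h a S ((l , job) ∷ ls) T (κ + (c + LinkStage.stageCost s)) (((a , S + h p) , LinkStage.places s (S + h p)) ∷ ds)

plan-≤ : ∀ {h a S ls T κ ds} → Plan h a S ls T κ ds → S ≤ T
plan-≤ finish = ≤-refl
plan-≤ (via _ _ refl π) = ≤-trans (≤-trans (m≤m+n _ _) (m≤m+n _ _)) (plan-≤ π)

-- The rounding error of a link: `2 + n` units inside its stage, one for adding the processing time
-- of the chain job before it and one for adding the length of the stage.
linkWeight : Link → ℕ
linkWeight l = length (parallelJobs l) + 4

planWeight : List ChainLink → ℕ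
planWeight ls = sum (map (λ l → linkWeight (proj₁ l)) ls)

linkStage-mono : ∀ {h a b L L′ l} → L ≤ L′ → LinkStage h a b L l → LinkStage h a b L′ l
linkStage-mono L≤ s = record { edge-delay = λ eq → ≤-trans (edge-delay eq) L≤ ; stage = stage-mono L≤ stage }
  where open LinkStage s using (edge-delay; stage)

module _ {h : ℕ → ℕ} {e : ℕ} (h-mono : ∀ {x y} → x ≤ y → h x ≤ h y) (h-0 : h 0 ≡ 0)
         (h-+ : ∀ x y → h x + h y ≤ h (x + y) + e) where

  open Rounding h-mono h-0 h-+

  round-link : ∀ {a b L l} (s : LinkStage id a b L l) → LinkStage h a b (h L + e * (2 + length (parallelJobs l))) l
  round-link {a} {b} s = record
    { edge-delay = λ {c} eq → ≤-trans (≤-trans (≤-reflexive (gap-h {h} h-0 a b c)) (h-mono (LinkStage.edge-delay s eq))) (m≤m+n _ _)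
    ; stage = round-stage (LinkStage.stage s) }

  -- `w` is the error accumulated so far. Each stage is stretched up to its allowance `S₁`, so the
  -- next chain job starts at a known time whatever the stage itself would need.
  round-plan : ∀ {a S ls T κ ds} → Plan id a S ls T κ ds → ∀ {S₀ w} → S₀ ≤ h S + e * w →
               ∃[ T₀ ] ∃[ ds₀ ] Plan h a S₀ ls T₀ κ ds₀ × T₀ ≤ h T + e * (w + planWeight ls)
  round-plan {T = T} finish {S₀} {w} S₀≤ = S₀ , [] , finish , ≤-trans S₀≤ (≤-reflexive (cong (λ z → h T + e * z) (sym (+-identityʳ w))))
  round-plan {S = S} {(l , job) ∷ ls} {T} (via {p = p} {L = L} ch s refl π) {S₀} {w} S₀≤ =
    let T₀ , ds₀ , π₀ , T₀≤ = round-plan π {S₁} {w + linkWeight l} ≤-refl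
    in T₀ , _ , via ch (linkStage-mono L≤ (round-link s)) (m+[n∸m]≡n (≤-trans (m≤m+n (S₀ + h p) _) fits)) π₀ ,
       ≤-trans T₀≤ (≤-reflexive (cong (λ z → h T + e * z) (+-assoc w (linkWeight l) (planWeight ls))))
    where
    n S₁ : ℕ
    n = length (parallelJobs l)
    S₁ = h (S + p + L) + e * (w + linkWeight l)
    fits : S₀ + h p + (h L + e * (2 + n)) ≤ S₁
    fits = begin
      S₀ + h p + (h L + e * (2 + n))                   ≤⟨ +-monoˡ-≤ _ (+-monoˡ-≤ (h p) S₀≤) ⟩
      h S + e * w + h p + (h L + e * (2 + n))          ≡⟨ arrange (h S) (e * w) (h p) (h L) (e * (2 + n)) ⟩
      h S + h p + h L + (e * w + e * (2 + n))          ≤⟨ +-monoˡ-≤ _ (+-monoˡ-≤ (h L) (h-+ S p)) ⟩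
      h (S + p) + e + h L + (e * w + e * (2 + n))      ≡⟨ swap-e (h (S + p)) e (h L) _ ⟩
      h (S + p) + h L + e + (e * w + e * (2 + n))      ≤⟨ +-monoˡ-≤ _ (+-monoˡ-≤ e (h-+ (S + p) L)) ⟩
      h (S + p + L) + e + e + (e * w + e * (2 + n))    ≡⟨ collect (h (S + p + L)) e w n ⟩
      S₁                                               ∎
      where
      open ≤-Reasoning
      arrange : ∀ a b c d f → a + b + c + (d + f) ≡ a + c + d + (b + f)
      arrange = solve-∀
      swap-e : ∀ a b c d → a + b + c + d ≡ a + c + b + d
      swap-e = solve-∀
      collect : ∀ a e w n → a + e + e + (e * w + e * (2 + n)) ≡ a + e * (w + (n + 4))
      collect = solve-∀
    L≤ : h L + e * (2 + n) ≤ S₁ ∸ (S₀ + h p)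
    L≤ = m+n≤o⇒m≤o∸n _ (≤-trans (≤-reflexive (+-comm _ (S₀ + h p))) fits)

-- The plan that keeps every job on the server

module _ {h : ℕ → ℕ} where

  -- Rounded processing times of at most 1 fit into unit intervals, one for each index.
  server-link : ∀ l → (∀ i → h (psOf (jobOf l i)) ≤ 1) → LinkStage h yea yea (length (parallelJobs l)) l
  server-link l ≤1 = record
    { edge-delay = λ _ → z≤n
    ; stage = record
      { side = λ _ → yea ; end = λ i → suc (toℕ i)
      ; begins = λ i → ≤-trans (≤1 i) (s≤s z≤n)
      ; ends = λ i → ≤-trans (≤-reflexive (+-identityʳ _)) (toℕ<n i)
      ; apart = λ {i} {j} i≢j _ _ → Sum.map (before i j) (before j i) (<-cmp′ (toℕ i) (toℕ j) (i≢j ∘ toℕ-injective)) } }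
    where
    before : ∀ i j → toℕ i < toℕ j → suc (toℕ i) + h (psOf (jobOf l j)) ≤ suc (toℕ j)
    before i j i<j = ≤-trans (+-monoʳ-≤ (suc (toℕ i)) (≤1 j)) (≤-trans (≤-reflexive (+-comm _ 1)) (s≤s i<j))
    <-cmp′ : ∀ m n → m ≢ n → m < n ⊎ n < m
    <-cmp′ m n m≢n = [ (λ m≤n → inj₁ (≤∧≢⇒< m≤n m≢n)) , (λ n≤m → inj₂ (≤∧≢⇒< n≤m (m≢n ∘ sym))) ]′ (≤-total m n)

  SmallOnServer : ChainLink → Set
  SmallOnServer (l , job) = h (proj₁ job) ≤ 1 × (∀ i → h (psOf (jobOf l i)) ≤ 1)

  server-cost : ∀ l ≤1 → LinkStage.stageCost (server-link l ≤1) ≡ 0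
  server-cost l ≤1 = zeros (allFin (length (parallelJobs l)))
    where
    zeros : ∀ {A : Set} (xs : List A) → sum (map (λ _ → 0) xs) ≡ 0
    zeros []       = refl
    zeros (_ ∷ xs) = zeros xs

  -- It costs nothing and hence respects every budget. At the last scale this yields a candidate for
  -- every instance.
  server-plan : ∀ ls → All SmallOnServer ls → ∀ S → ∃[ T ] ∃[ ds ] Plan h yea S ls T 0 ds × T ≤ S + planWeight ls
  server-plan [] [] S = S , [] , finish , m≤m+n S 0
  server-plan ((l , job) ∷ ls) ((p≤1 , ≤1) ∷ small) S =
    let S′ = S + h (proj₁ job) + length (parallelJobs l)
        T , ds , π , T≤ = server-plan ls small S′
        D = (yea , S + h (proj₁ job)) , LinkStage.places (server-link l ≤1) (S + h (proj₁ job))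
    in T , _ , subst (λ κ → Plan h yea S ((l , job) ∷ ls) T κ (D ∷ ds)) (server-cost l ≤1) (via on-server (server-link l ≤1) refl π) , (begin
      T                                         ≤⟨ T≤ ⟩
      S + h (proj₁ job) + n + planWeight ls     ≤⟨ +-monoˡ-≤ (planWeight ls) (+-monoˡ-≤ n (+-monoʳ-≤ S (≤-trans p≤1 (s≤s {n = 3} z≤n)))) ⟩
      S + 4 + n + planWeight ls                 ≡⟨ arrange S n (planWeight ls) ⟩
      S + (n + 4 + planWeight ls)               ∎)
    where
    open ≤-Reasoning
    n = length (parallelJobs l)
    arrange : ∀ S n w → S + 4 + n + w ≡ S + (n + 4 + w)
    arrange = solve-∀

-- Correctness of the chain table

∈-chainUniverse : ∀ {R} a {S} → S ∈ R → (a , S) ∈ chainUniverse R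
∈-chainUniverse yea S∈ = ∈-concatMap-intro (λ S → (yea , S) ∷ (nay , S) ∷ []) S∈ (here refl)
∈-chainUniverse nay S∈ = ∈-concatMap-intro (λ S → (yea , S) ∷ (nay , S) ∷ []) S∈ (there (here refl))

module _ (K B : ℕ) (R : List ℕ) (h : ℕ → ℕ) (T : ℕ) where

  private
    module DP = Layered eqChainState (chainUniverse R) B (chainStep K h B R)

    choice-sound : ∀ {job ch} → ch ∈ choices h job → ∃[ p ] Choice job (proj₁ ch) p (proj₂ (proj₂ ch)) × proj₁ (proj₂ ch) ≡ h p
    choice-sound (here refl) = _ , on-server , refl
    choice-sound {job} (there ch∈) =
      let pc , pc∈ , eq = ∈-map⁻ (λ pc → nay , h pc , pc) ch∈
      in pc , subst (λ ch → Choice job (proj₁ ch) pc (proj₂ (proj₂ ch))) (sym eq) (on-cloud pc∈) , cong (λ ch → proj₁ (proj₂ ch)) eq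

    choice-complete : ∀ {job a p c} → Choice job a p c → (a , h p , c) ∈ choices h job
    choice-complete on-server      = here refl
    choice-complete (on-cloud pc∈) = there (∈-map⁺ (λ pc → nay , h pc , pc) pc∈)

  -- The table knows encoded items only, so the links that they encode are quantified here.
  Planned : List ⟦ ChainItemTy ⟧ → ⟦ SideTy ⊗ nat ⟧ → ℕ → List ⟦ ChainDecisionTy ⟧ → Set
  Planned its (a , S) κ ds = ∀ ls → its ≡ map encodeChainLink ls → Plan h a S ls T κ ds

  private
    extend-plan : ∀ {a b S κ l job ls ds p} {hp c} (o : ℕ × (ℕ × Places)) → Choice job a p c → hp ≡ h p → SoundLink K B R h a b l o → hp + proj₁ o ≤ S →
      Plan h b S ls T κ ds →
      Plan h a (S ∸ (hp + proj₁ o)) ((l , job) ∷ ls) T (κ + (c + proj₁ (proj₂ o))) (((a , S ∸ proj₁ o) , map (λ x → proj₁ x , S ∸ proj₁ o + proj₂ x) (proj₂ (proj₂ o))) ∷ ds)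
    extend-plan {a} {S = S} {κ} {l} {job} {ls} {ds} {p} {c = c} (L , c′ , pl) ch refl (s , refl , refl) fits π =
      subst (λ C → Plan h a (S ∸ (h p + L)) ((l , job) ∷ ls) T (κ + (c + LinkStage.stageCost s)) (((a , C) , map (λ x → proj₁ x , C + proj₂ x) pl) ∷ ds)) completion
        (subst (λ pl → Plan h a (S ∸ (h p + L)) ((l , job) ∷ ls) T (κ + (c + LinkStage.stageCost s)) (((a , S ∸ (h p + L) + h p) , pl) ∷ ds)) (map-∘ (allFin _))
          (via ch s arrive π))
      where
      arrive : S ∸ (h p + L) + h p + L ≡ S
      arrive = trans (+-assoc (S ∸ (h p + L)) (h p) L) (m∸n+n≡m fits)
      completion : S ∸ (h p + L) + h p ≡ S ∸ L
      completion = trans (sym (m+n∸n≡m _ L)) (cong (_∸ L) arrive)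

    step-sound : ∀ {its b S κ ds l job o} → Planned its (b , S) κ ds → o ∈ chainStep K h B R (encodeLink l , job) (b , S) →
                 ∀ ls → its ≡ map encodeChainLink ls → (λ (s , c , d) → Plan h (proj₁ s) (proj₂ s) ((l , job) ∷ ls) T (κ + c) (d ∷ ds)) o
    step-sound {its} {b} {S} {κ} {ds} {l} {job} {o} planned o∈ ls eq =
      let ch , ch∈ , o∈₁ = ∈-concatMap-elim (λ ch → concatMap (advance S ch) (stageOptions K h B R (proj₁ ch) b (encodeLink l))) (choices h job) o∈
          p , choice , hp≡ = choice-sound {job} ch∈
          q , q∈ , o∈₂ = ∈-concatMap-elim (advance S ch) (stageOptions K h B R (proj₁ ch) b (encodeLink l)) o∈₁
          fits , o≡ = ∈-guarded o∈₂
      in subst (λ (s , c , d) → Plan h (proj₁ s) (proj₂ s) ((l , job) ∷ ls) T (κ + c) (d ∷ ds)) (sym o≡)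
           (extend-plan q choice hp≡ (options-sound K B R h (proj₁ ch) b l q∈) (leq⁻ {proj₁ (proj₂ ch) + proj₁ q} fits) (planned ls eq))

    planned-step : ∀ {it its s κ ds s′ c d} → Planned its s κ ds → (s′ , c , d) ∈ chainStep K h B R it s → Planned (it ∷ its) s′ (κ + c) (d ∷ ds)
    planned-step {s = s} {s′ = s′} {c} {d} planned o∈ ((l , job) ∷ ls) eq =
      step-sound {l = l} {job} planned (subst (λ it → (s′ , c , d) ∈ chainStep K h B R it s) (∷-injectiveˡ eq) o∈) ls (∷-injectiveʳ eq)

  opaque
    unfolding chainTable

    chain-sound : ∀ ls {a S κ ds} → ((a , S) , κ , ds) ∈ chainTable K h B R T (map encodeChainLink ls) → Plan h a S ls T κ ds × κ ≤ B
    chain-sound ls e∈ =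
      let planned , _ , κ≤ = DP.table-sound eqChainState⁻ {(yea , T) ∷ []} Planned (λ { (here refl) [] refl → finish }) (λ _ → planned-step) (map encodeChainLink ls) e∈
      in planned ls refl , κ≤

  module _ {cmax : ℕ} (K≡ : K ≡ slotBound cmax) (h-mono : ∀ {x y} → x ≤ y → h x ≤ h y) (h≤ : ∀ x → h x ≤ x)
           (R∋ : ∀ {x} → x ≤ T → x ∈ R) where

    private
      opaque
        unfolding chainTable

        has-plan : ∀ {a S ls κ ds} → All (λ l → Condition cmax (jobOf (proj₁ l))) ls → Plan h a S ls T κ ds → κ ≤ B →
                   DP.Has ((yea , T) ∷ []) (map encodeChainLink ls) (a , S) κ
        has-plan [] finish _ = DP.has-init eqChainState-refl eqChainState⁻ {(yea , T) ∷ []} (here refl) (∈-chainUniverse yea (R∋ ≤-refl))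
        has-plan {a} {S} {(l , job) ∷ ls} (cond ∷ conds) π@(via {b = b} {S′ = S′} {p = p} {c} {L} {κ = κ} choice s eq π′) afford =
          let c′ , pl , q∈ , c′≤ = options-complete K B R h a b K≡ h-mono h≤ l cond s (λ x≤ → R∋ (≤-trans x≤ L≤T))
                                    (≤-trans (m≤n+m _ c) (≤-trans (m≤n+m _ κ) afford))
              total≤ : κ + (c + c′) ≤ κ + (c + LinkStage.stageCost s)
              total≤ = +-monoʳ-≤ κ (+-monoʳ-≤ c c′≤)
              o∈ : ((a , S′ ∸ (h p + L)) , c + c′ , (a , S′ ∸ L) , map (λ x → proj₁ x , S′ ∸ L + proj₂ x) pl) ∈ chainStep K h B R (encodeLink l , job) (b , S′)
              o∈ = ∈-concatMap-intro (λ ch → concatMap (advance S′ ch) (stageOptions K h B R (proj₁ ch) b (encodeLink l))) (choice-complete choice)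
                     (∈-concatMap-intro (advance S′ (a , h p , c)) q∈ (∈-guard⁺ (leq⁺ fits) (here refl)))
              κ₁ , ds , e∈ , κ₁≤ = DP.has-step eqChainState-refl eqChainState⁻ {init = (yea , T) ∷ []} {i = encodeLink l , job} {map encodeChainLink ls}
                (has-plan conds π′ (≤-trans (m≤m+n κ _) afford)) o∈ (subst (λ z → (a , z) ∈ chainUniverse R) (sym S≡) (∈-chainUniverse a (R∋ (plan-≤ π)))) (≤-trans total≤ afford)
          in κ₁ , ds , subst (λ z → ((a , z) , κ₁ , ds) ∈ chainTable K h B R T (map encodeChainLink ((l , job) ∷ ls))) S≡ e∈ , ≤-trans κ₁≤ total≤
          where
          span≡ : S + (h p + L) ≡ S′
          span≡ = trans (sym (+-assoc S (h p) L)) eq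
          fits : h p + L ≤ S′
          fits = ≤-trans (m≤n+m _ S) (≤-reflexive span≡)
          S≡ : S′ ∸ (h p + L) ≡ S
          S≡ = trans (cong (_∸ (h p + L)) (sym span≡)) (m+n∸n≡m S (h p + L))
          L≤T : L ≤ T
          L≤T = ≤-trans (≤-trans (m≤n+m L (h p)) fits) (plan-≤ π′)

    opaque
      unfolding chainTable

      chain-complete : ∀ {a S ls κ ds} → All (λ l → Condition cmax (jobOf (proj₁ l))) ls → Plan h a S ls T κ ds → κ ≤ B →
        ∃[ κ′ ] ∃[ ds′ ] ((a , S) , κ′ , ds′) ∈ chainTable K h B R T (map encodeChainLink ls) × κ′ ≤ κ
      chain-complete = has-plan

-- Unrolled plans

chainLinks : ∀ {m} → Vec Link m → Vec (ℕ × List ℕ) m → List ChainLink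
chainLinks []       []       = []
chainLinks (l ∷ ls) (j ∷ js) = (l , j) ∷ chainLinks ls js

record StepAt (h : ℕ → ℕ) (l : Link) (job : ℕ × List ℕ) (a b : ⟦ SideTy ⟧) (S S′ : ℕ) : Set where
  field
    {p c L} : ℕ
    choice  : Choice job a p c
    link    : LinkStage h a b L l
    arrive  : S + h p + L ≡ S′

  stepCost : ℕ
  stepCost = c + LinkStage.stageCost link

  decision : ⟦ ChainDecisionTy ⟧
  decision = (a , S + h p) , LinkStage.places link (S + h p)

-- A plan indexed by position, as the jobs of the task graph are, whereas `Plan` is shaped for
-- recursion along the chain.
record Unrolled (h : ℕ → ℕ) {m} (ls : Vec Link m) (js : Vec (ℕ × List ℕ) m) (T : ℕ) : Set where
  field
    sides     : Fin (suc m) → ⟦ SideTy ⟧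
    starts    : Fin (suc m) → ℕ
    last-side : sides (fromℕ m) ≡ yea
    last      : starts (fromℕ m) ≡ T
    steps     : ∀ k → StepAt h (Vec.lookup ls k) (Vec.lookup js k) (sides (inject₁ k)) (sides (suc k)) (starts (inject₁ k)) (starts (suc k))

  totalCost : ℕ
  totalCost = sum (tabulate (λ k → StepAt.stepCost (steps k)))

  decisions : List ⟦ ChainDecisionTy ⟧
  decisions = tabulate (λ k → StepAt.decision (steps k))

roll : ∀ {h m} {ls : Vec Link m} {js T} (u : Unrolled h ls js T) →
       Plan h (Unrolled.sides u zero) (Unrolled.starts u zero) (chainLinks ls js) T (Unrolled.totalCost u) (Unrolled.decisions u)
roll {ls = []} {[]} u with Unrolled.sides u zero | Unrolled.last-side u | Unrolled.starts u zero | Unrolled.last u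
... | _ | refl | _ | refl = finish
roll {h} {ls = l ∷ ls} {j ∷ js} {T} u = subst (λ κ → Plan h (sides zero) (starts zero) (chainLinks (l ∷ ls) (j ∷ js)) T κ decisions)
    (+-comm (Unrolled.totalCost rest) _)
    (via (StepAt.choice (steps zero)) (StepAt.link (steps zero)) (StepAt.arrive (steps zero)) (roll rest))
  where
  open Unrolled u
  rest : Unrolled h ls js T
  rest = record { sides = sides ∘ suc ; starts = starts ∘ suc ; last-side = last-side ; last = last ; steps = λ k → steps (suc k) }

record UnrolledPlan (h : ℕ → ℕ) {m} (ls : Vec Link m) (js : Vec (ℕ × List ℕ) m) (a : ⟦ SideTy ⟧) (S T κ : ℕ) (ds : List ⟦ ChainDecisionTy ⟧) : Set where
  constructor unrolled
  field
    plan        : Unrolled h ls js T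
    cost≡       : Unrolled.totalCost plan ≡ κ
    decisions≡  : Unrolled.decisions plan ≡ ds
    first-side  : Unrolled.sides plan zero ≡ a
    first-start : Unrolled.starts plan zero ≡ S

unroll : ∀ {h m} (ls : Vec Link m) js {a S T κ ds} → Plan h a S (chainLinks ls js) T κ ds → UnrolledPlan h ls js a S T κ ds
unroll [] [] (finish {T}) = unrolled (record { sides = λ _ → yea ; starts = λ _ → T ; last-side = refl ; last = refl ; steps = λ () }) refl refl refl refl
unroll {h} (l ∷ ls) (j ∷ js) {a} {S} {T} (via {p = p} {c} {κ = κ} ch s arrive π) = prepend ch s arrive (unroll ls js π)
  where
  prepend : ∀ {b S′ p c L κ ds} → Choice j a p c → (s : LinkStage h a b L l) → S + h p + L ≡ S′ → UnrolledPlan h ls js b S′ T κ ds →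
            UnrolledPlan h (l ∷ ls) (j ∷ js) a S T (κ + (c + LinkStage.stageCost s)) (((a , S + h p) , LinkStage.places s (S + h p)) ∷ ds)
  prepend {κ = κ} ch s arrive (unrolled u refl refl refl refl) = unrolled (record
    { sides = sides′ ; starts = starts′ ; last-side = last-side ; last = last
    ; steps = steps′ }) (+-comm _ (Unrolled.totalCost u)) refl refl refl
    where
    open Unrolled u
    sides′ : Fin _ → ⟦ SideTy ⟧
    sides′ zero    = a
    sides′ (suc k) = sides k
    starts′ : Fin _ → ℕ
    starts′ zero    = S
    starts′ (suc k) = starts k
    steps′ : ∀ k → StepAt h (Vec.lookup (l ∷ ls) k) (Vec.lookup (j ∷ js) k) (sides′ (inject₁ k)) (sides′ (suc k)) (starts′ (inject₁ k)) (starts′ (suc k))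
    steps′ zero    = record { choice = ch ; link = s ; arrive = arrive }
    steps′ (suc k) = steps k

-- Extended chains

-- The value at infinity is a dummy: source and sink stay on the server, where it is not charged.
finite : ℕ∞ → ℕ
finite = fromMaybe 0

encodeSide-injective : ∀ {x y} → encodeSide x ≡ encodeSide y → x ≡ y
encodeSide-injective {server} {server} _ = refl
encodeSide-injective {cloud}  {cloud}  _ = refl

decodeSide : ⟦ SideTy ⟧ → Side
decodeSide yea = server
decodeSide nay = cloud

encode-decode : ∀ y → encodeSide (decodeSide y) ≡ y
encode-decode yea = refl
encode-decode nay = refl

lookup-∷ʳ-inject₁ : ∀ {A : Set} {m} (xs : Vec A m) x i → Vec.lookup (xs ∷ʳ x) (inject₁ i) ≡ Vec.lookup xs i
lookup-∷ʳ-inject₁ (_ ∷ _)  x zero    = refl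
lookup-∷ʳ-inject₁ (_ ∷ xs) x (suc i) = lookup-∷ʳ-inject₁ xs x i

sum-map-concatMap : ∀ {A B : Set} (f : B → ℕ) (g : A → List B) xs →
  sum (map f (concatMap g xs)) ≡ sum (map (λ x → sum (map f (g x))) xs)
sum-map-concatMap f g []       = refl
sum-map-concatMap f g (x ∷ xs) = trans (cong sum (map-++ f (g x) (concatMap g xs)))
  (trans (sum-++ (map f (g x)) (map f (concatMap g xs))) (cong (sum (map f (g x)) +_) (sum-map-concatMap f g xs)))

module Chains (X : ExtendedChain) where
  open ExtendedChain X
  module C = Chain X

  G : TaskGraph
  G = taskGraph X

  chainJobs : Vec (ℕ × List ℕ) (suc n)
  chainJobs = (0 , []) ∷ Vec.map (λ j → ChainJob.ps j , ChainJob.pc j ∷ []) inner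

  parIndices : ∀ k → List (Fin (length (parallelJobs (C.link k))))
  parIndices k = allFin (length (parallelJobs (C.link k)))

  price′ : C.Job → ℕ
  price′ j = finite (C.pc j)

  processing′ : ⟦ SideTy ⟧ → C.Job → ℕ
  processing′ y j = ite y (C.ps j) (price′ j)

  ps-at : ∀ k → C.ps (C.chain (inject₁ (suc k))) ≡ ChainJob.ps (Vec.lookup inner k)
  ps-at k = trans (lookup-∷ʳ-inject₁ (Vec.map ChainJob.ps inner) 0 k) (lookup-map k ChainJob.ps inner)

  pc-at : ∀ k → C.pc (C.chain (inject₁ (suc k))) ≡ ⌜ ChainJob.pc (Vec.lookup inner k) ⌝
  pc-at k = trans (lookup-∷ʳ-inject₁ (Vec.map (λ j → ⌜ ChainJob.pc j ⌝) inner) ⊤⁺ k) (lookup-map k (λ j → ⌜ ChainJob.pc j ⌝) inner)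

  job-at : ∀ k → Vec.lookup chainJobs (suc k) ≡ (ChainJob.ps (Vec.lookup inner k) , ChainJob.pc (Vec.lookup inner k) ∷ [])
  job-at k = lookup-map k (λ j → ChainJob.ps j , ChainJob.pc j ∷ []) inner

  choose : ∀ k y → (y ≡ nay → C.pc (C.chain (inject₁ k)) ≢ ⊤⁺) →
           Choice (Vec.lookup chainJobs k) y (processing′ y (C.chain (inject₁ k))) (ite y 0 (price′ (C.chain (inject₁ k))))
  choose zero yea _ = on-server
  choose zero nay ≢⊤ = ⊥-elim (≢⊤ refl refl)
  choose (suc k) y _ = go (job-at k) (ps-at k) (pc-at k) y
    where
    go : ∀ {job P Q p c} → job ≡ (p , c ∷ []) → P ≡ p → Q ≡ ⌜ c ⌝ → ∀ y → Choice job y (ite y P (finite Q)) (ite y 0 (finite Q))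
    go refl refl refl yea = on-server
    go refl refl refl nay = on-cloud (here refl)

  chosen : ∀ k {y p c} → Choice (Vec.lookup chainJobs k) y p c →
           p ≡ processing′ y (C.chain (inject₁ k)) × c ≡ ite y 0 (price′ (C.chain (inject₁ k))) × (y ≡ nay → C.pc (C.chain (inject₁ k)) ≢ ⊤⁺)
  chosen zero on-server = refl , refl , λ ()
  chosen (suc k) ch = go (job-at k) (ps-at k) (pc-at k) ch
    where
    go : ∀ {job P Q p c y p′ c′} → job ≡ (p , c ∷ []) → P ≡ p → Q ≡ ⌜ c ⌝ → Choice job y p′ c′ →
         p′ ≡ ite y P (finite Q) × c′ ≡ ite y 0 (finite Q) × (y ≡ nay → Q ≢ ⊤⁺)
    go refl refl refl on-server              = refl , refl , λ ()
    go refl refl refl (on-cloud (here refl)) = refl , refl , λ _ ()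

  module Costs (π : Schedule G) (s-side : Schedule.side π C.s ≡ server) (t-side : Schedule.side π C.t ≡ server) where
    open Schedule π

    y : C.Job → ⟦ SideTy ⟧
    y j = encodeSide (side j)

    paid : C.Job → ℕ
    paid j = ite (y j) 0 (price′ j)

    finite-on-cloud : ∀ j → side j ≡ cloud → C.pc j ≡ ⌜ price′ j ⌝
    finite-on-cloud j sj = go (C.pc j) refl
      where
      go : ∀ q → C.pc j ≡ q → q ≡ ⌜ finite q ⌝
      go ⌜ q ⌝ eq = refl
      go ⊤⁺    eq with Equivalence.to (C.pc-infinite j) eq
      ... | inj₁ refl with () ← trans (sym sj) s-side
      ... | inj₂ refl with () ← trans (sym sj) t-side

    processing≡ : ∀ j → processing π j ≡ ⌜ processing′ (y j) j ⌝
    processing≡ j with side j in eq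
    ... | server = refl
    ... | cloud  = finite-on-cloud j eq

    starts-after⁻ : ∀ {d} j → StartsAfter π d j → d + processing′ (y j) j ≤ completion j
    starts-after⁻ {d} j le with subst (λ q → ⌜ d ⌝ +∞ q ≤⁺ ⌜ completion j ⌝) (processing≡ j) le
    ... | NonStrict.[ le′ ] = le′

    starts-after⁺ : ∀ {d} j → d + processing′ (y j) j ≤ completion j → StartsAfter π d j
    starts-after⁺ {d} j le = subst (λ q → ⌜ d ⌝ +∞ q ≤⁺ ⌜ completion j ⌝) (sym (processing≡ j)) NonStrict.[ le ]

    cloudCost≡ : ∀ j → cloudCost π j ≡ ⌜ paid j ⌝
    cloudCost≡ j with side j in eq
    ... | server = refl
    ... | cloud  = finite-on-cloud j eq

    total : ∀ js → foldr (λ j c → cloudCost π j +∞ c) ⌜ 0 ⌝ js ≡ ⌜ sum (map paid js) ⌝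
    total []       = refl
    total (j ∷ js) = cong₂ _+∞_ (cloudCost≡ j) (total js)

    cost-by-stage : sum (map paid C.jobs) ≡ sum (map (λ k → paid (C.chain (inject₁ k)) + sum (map (λ i → paid (C.par k i)) (parIndices k))) (allFin (suc n)))
    cost-by-stage = begin
      sum (map paid (concatMap C.stage (allFin (suc n)) ++ C.t ∷ []))      ≡⟨ cong sum (map-++ paid (concatMap C.stage (allFin (suc n))) (C.t ∷ [])) ⟩
      sum (map paid (concatMap C.stage (allFin (suc n))) ++ paid C.t ∷ []) ≡⟨ sum-++ (map paid (concatMap C.stage (allFin (suc n)))) (paid C.t ∷ []) ⟩
      sum (map paid (concatMap C.stage (allFin (suc n)))) + (paid C.t + 0) ≡⟨ cong (λ z → sum (map paid (concatMap C.stage (allFin (suc n)))) + (z + 0)) t-free ⟩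
      sum (map paid (concatMap C.stage (allFin (suc n)))) + 0              ≡⟨ +-identityʳ _ ⟩
      sum (map paid (concatMap C.stage (allFin (suc n))))                  ≡⟨ sum-map-concatMap paid C.stage (allFin (suc n)) ⟩
      sum (map (λ k → sum (map paid (C.stage k))) (allFin (suc n)))        ≡⟨ cong sum (map-cong (λ k → cong (λ z → paid (C.chain (inject₁ k)) + sum z) (sym (map-∘ {g = paid} {f = C.par k} (parIndices k)))) (allFin (suc n))) ⟩
      _                                                                    ∎
      where
      open ≡-Reasoning
      t-free : paid C.t ≡ 0
      t-free = cong (λ z → ite (encodeSide z) 0 (price′ C.t)) t-side

-- From schedules to plans

gap-same : ∀ {x y} c → x ≡ y → gap (encodeSide x) (encodeSide y) c ≡ 0
gap-same {server} c refl = refl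
gap-same {cloud}  c refl = refl

gap-≤ : ∀ a b c → gap a b c ≤ c
gap-≤ yea yea c = z≤n
gap-≤ yea nay c = ≤-refl
gap-≤ nay yea c = ≤-refl
gap-≤ nay nay c = z≤n

side? : ∀ (x y : Side) → Dec (x ≡ y)
side? server server = yes refl
side? server cloud  = no λ ()
side? cloud  server = no λ ()
side? cloud  cloud  = yes refl

edge⊎job : ∀ l → (∃[ c ] l ≡ edge c) ⊎ Fin (length (parallelJobs l))
edge⊎job (edge c)            = inj₁ (c , refl)
edge⊎job (parallel (_ ∷ _)) = inj₂ zero

module FromSchedule (X : ExtendedChain) {b : ℕ} (z : BudgetSchedule (taskGraph X) b) where
  open Chains X
  open ExtendedChain X
  open BudgetSchedule z using (valid; withinBudget) renaming (schedule to π)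
  open Schedule π
  open Valid valid

  -- One infinite summand makes the total infinite, so a finite budget forces source and sink onto
  -- the server.
  finite-cost : ∀ j js → j ∈ js → cloudCost π j ≡ ⊤⁺ → foldr (λ j c → cloudCost π j +∞ c) ⌜ 0 ⌝ js ≡ ⊤⁺
  finite-cost j (j ∷ js) (here refl) eq = cong (_+∞ foldr (λ j c → cloudCost π j +∞ c) ⌜ 0 ⌝ js) eq
  finite-cost j (i ∷ js) (there j∈) eq = trans (cong (cloudCost π i +∞_) (finite-cost j js j∈ eq)) (absorb (cloudCost π i))
    where
    absorb : ∀ q → q +∞ ⊤⁺ ≡ ⊤⁺
    absorb ⌜ _ ⌝ = refl
    absorb ⊤⁺    = refl

  on-server′ : ∀ j → C.pc j ≡ ⊤⁺ → side j ≡ server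
  on-server′ j eq = go (side j) refl
    where
    infinite : side j ≡ cloud → cloudCost π j ≡ ⊤⁺
    infinite sj with side j
    infinite refl | cloud = eq
    go : ∀ x → side j ≡ x → x ≡ server
    go server _  = refl
    go cloud  sj with subst (_≤⁺ ⌜ b ⌝) (finite-cost j C.jobs (C.jobs-complete j) (infinite sj)) withinBudget
    ... | ()

  s-side : side C.s ≡ server
  s-side = on-server′ C.s refl

  t-side : side C.t ≡ server
  t-side = on-server′ C.t (Equivalence.from (C.pc-infinite C.t) (inj₂ refl))

  open Costs π s-side t-side

  work-of : C.Job → ℕ
  work-of j = processing′ (y j) j

  -- One inequality for both kinds of precedence, as `gap` vanishes between equal sides.
  along : ∀ {i j} (e : i C.⟶ j) → completion i + gap (y i) (y j) (C.delay e) + work-of j ≤ completion j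
  along {i} {j} e = go (side? (side i) (side j))
    where
    go : Dec (side i ≡ side j) → completion i + gap (y i) (y j) (C.delay e) + work-of j ≤ completion j
    go (yes eq) = subst (λ g → completion i + g + work-of j ≤ completion j) (sym (gap-same (C.delay e) eq))
      (subst (λ z → z + work-of j ≤ completion j) (sym (+-identityʳ _)) (starts-after⁻ j (same-side e eq)))
    go (no neq) = ≤-trans (+-monoˡ-≤ (work-of j) (+-monoʳ-≤ (completion i) (gap-≤ (y i) (y j) (C.delay e)))) (starts-after⁻ j (different-side e neq))

  start-of : Fin (2 + n) → ℕ
  start-of k = completion (C.chain k) ∸ work-of (C.chain k)

  -- Consecutive chain jobs are ordered even without an edge between them, because a parallel
  -- subgraph contains a job to pass through.
  next-starts : ∀ k → completion (C.chain (inject₁ k)) + work-of (C.chain (suc k)) ≤ completion (C.chain (suc k))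
  next-starts k = [ (λ (c , eq) → ≤-trans (+-monoˡ-≤ (work-of (C.chain (suc k))) (m≤m+n (completion (C.chain (inject₁ k))) _)) (along (C.direct k eq)))
                  , (λ i → ≤-trans (+-monoˡ-≤ _ (≤-trans (m≤m+n _ _) (≤-trans (≤-trans (m≤m+n _ _) (along (C.fork k i))) (m≤m+n _ _)))) (along (C.join k i))) ]′
                  (edge⊎job (C.link k))

  work≤completion : ∀ k → work-of (C.chain k) ≤ completion (C.chain k)
  work≤completion zero    = ≤-trans (≤-reflexive (cong (λ x → processing′ (encodeSide x) C.s) s-side)) z≤n
  work≤completion (suc k) = ≤-trans (m≤n+m _ _) (next-starts k)

  start+work-of : ∀ k → start-of k + work-of (C.chain k) ≡ completion (C.chain k)
  start+work-of k = m∸n+n≡m (work≤completion k)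

  module _ (k : Fin (suc n)) where

    private
      A S′ L : ℕ
      A = completion (C.chain (inject₁ k))
      S′ = start-of (suc k)
      L = S′ ∸ A

      A≤S′ : A ≤ S′
      A≤S′ = m+n≤o⇒m≤o∸n A (next-starts k)

      a a′ : ⟦ SideTy ⟧
      a = y (C.chain (inject₁ k))
      a′ = y (C.chain (suc k))

      into-L : ∀ {x} → A + x + work-of (C.chain (suc k)) ≤ completion (C.chain (suc k)) → x ≤ L
      into-L {x} le = m+n≤o⇒n≤o∸m x (m+n≤o⇒m≤o∸n (A + x) le)
        where
        m+n≤o⇒n≤o∸m : ∀ x → A + x ≤ S′ → x ≤ S′ ∸ A
        m+n≤o⇒n≤o∸m x le = m+n≤o⇒m≤o∸n x (≤-trans (≤-reflexive (+-comm x A)) le)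

      Cᵢ : Fin (length (parallelJobs (C.link k))) → ℕ
      Cᵢ i = completion (C.par k i)

      A≤Cᵢ : ∀ i → A ≤ Cᵢ i
      A≤Cᵢ i = ≤-trans (≤-trans (m≤m+n A _) (m≤m+n _ _)) (along (C.fork k i))

      relative : ∀ {i x} → A + x ≤ Cᵢ i → x ≤ Cᵢ i ∸ A
      relative {i} {x} le = m+n≤o⇒m≤o∸n x (≤-trans (≤-reflexive (+-comm x A)) le)

    -- Times within a stage count from the completion `A` of the chain job before it.
    stage-of : Stage id a a′ L (jobOf (C.link k))
    stage-of = record
      { side = λ i → y (C.par k i) ; end = λ i → Cᵢ i ∸ A
      ; begins = λ i → relative (≤-trans (≤-reflexive (sym (+-assoc A _ _))) (along (C.fork k i)))
      ; ends = λ i → into-L (≤-trans (≤-reflexive (cong (_+ work-of (C.chain (suc k))) (trans (sym (+-assoc A (Cᵢ i ∸ A) _)) (cong (_+ gap (y (C.par k i)) a′ (C.delay (C.join k i))) (m+[n∸m]≡n (A≤Cᵢ i)))))) (along (C.join k i)))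
      ; apart = λ {i} {j} i≢j si sj → Sum.map (shifted i j sj) (shifted j i si)
          (server-exclusive (λ { refl → i≢j refl }) (encodeSide-injective si) (encodeSide-injective sj)) }
      where
      shifted : ∀ i j → y (C.par k j) ≡ yea → StartsAfter π (Cᵢ i) (C.par k j) →
                Cᵢ i ∸ A + C.ps (C.par k j) ≤ Cᵢ j ∸ A
      shifted i j sj after = relative (≤-trans (≤-reflexive (trans (sym (+-assoc A (Cᵢ i ∸ A) _)) (cong (_+ C.ps (C.par k j)) (m+[n∸m]≡n (A≤Cᵢ i)))))
        (subst (λ v → Cᵢ i + ite v (C.ps (C.par k j)) (price′ (C.par k j)) ≤ Cᵢ j) sj (starts-after⁻ (C.par k j) after)))

    step-of : StepAt id (C.link k) (Vec.lookup chainJobs k) a a′ (start-of (inject₁ k)) S′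
    step-of = record
      { choice = choose k a (λ a≡nay eq → absurd (cong encodeSide (on-server′ (C.chain (inject₁ k)) eq)) a≡nay)
      ; link = record { edge-delay = λ {c} eq → into-L (along (C.direct k eq)) ; stage = stage-of }
      ; arrive = trans (cong (_+ L) (start+work-of (inject₁ k))) (m+[n∸m]≡n A≤S′) }
      where
      absurd : ∀ {v} → v ≡ yea → v ≡ nay → ⊥
      absurd refl ()

  plan-of : Unrolled id links chainJobs (start-of (fromℕ (suc n)))
  plan-of = record { sides = λ k → y (C.chain k) ; starts = start-of ; last-side = cong encodeSide t-side ; last = refl ; steps = step-of }

  plan-cost : Unrolled.totalCost plan-of ≤ b
  plan-cost with subst (_≤⁺ ⌜ b ⌝) (total C.jobs) withinBudget
  ... | NonStrict.[ le ] = ≤-trans (≤-reflexive (trans (cong sum (sym (map-tabulate id (λ k → StepAt.stepCost (step-of k))))) (sym cost-by-stage))) le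

  plan-makespan : start-of (fromℕ (suc n)) ≤ makespan π
  plan-makespan = m∸n≤m (completion C.t) (work-of C.t)

-- From plans to schedules

fin-mono : ∀ {m} (f : Fin (suc m) → ℕ) → (∀ k → f (inject₁ k) ≤ f (suc k)) → ∀ {k l} → toℕ k ≤ toℕ l → f k ≤ f l
fin-mono         f up {zero}  {zero}  _ = ≤-refl
fin-mono {suc m} f up {zero}  {suc l} _ = ≤-trans (up zero) (fin-mono (f ∘ suc) (up ∘ suc) {zero} {l} z≤n)
fin-mono {suc m} f up {suc k} {suc l} (s≤s k≤l) = fin-mono (f ∘ suc) (up ∘ suc) k≤l

module ToSchedule (X : ExtendedChain) {h : ℕ → ℕ} {δ : ℕ} (h-0 : h 0 ≡ 0) (≤δh : ∀ x → x ≤ δ * h x) {T : ℕ}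
                  (u : Unrolled h (ExtendedChain.links X) (Chains.chainJobs X) T) where
  open Chains X
  open ExtendedChain X
  open Unrolled u

  stage-at : ∀ k → LinkStage h (sides (inject₁ k)) (sides (suc k)) _ (C.link k)
  stage-at k = StepAt.link (steps k)

  module At k = LinkStage (stage-at k)

  sideAt : C.Job → ⟦ SideTy ⟧
  sideAt (C.chain k) = sides k
  sideAt (C.par k i) = At.side k i

  end-of : Fin (2 + n) → ℕ
  end-of k = starts k + h (processing′ (sides k) (C.chain k))

  scaledEnd : C.Job → ℕ
  scaledEnd (C.chain k) = end-of k
  scaledEnd (C.par k i) = end-of (inject₁ k) + At.end k i

  π : Schedule G
  π = record { side = decodeSide ∘ sideAt ; completion = λ j → δ * scaledEnd j }

  s-server : sides zero ≡ yea
  s-server = [ id , (λ eq → ⊥-elim (proj₂ (proj₂ (chosen zero (StepAt.choice (steps zero)))) eq refl)) ]′ (side-cases (sides zero))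

  open Costs π (cong decodeSide s-server) (cong decodeSide last-side)

  y≡ : ∀ j → y j ≡ sideAt j
  y≡ j = encode-decode (sideAt j)

  p≡ : ∀ k → StepAt.p (steps k) ≡ processing′ (sides (inject₁ k)) (C.chain (inject₁ k))
  p≡ k = proj₁ (chosen k (StepAt.choice (steps k)))

  arrive′ : ∀ k → end-of (inject₁ k) + StepAt.L (steps k) ≡ starts (suc k)
  arrive′ k = trans (cong (λ p → starts (inject₁ k) + h p + StepAt.L (steps k)) (sym (p≡ k))) (StepAt.arrive (steps k))

  end≤next : ∀ k → end-of (inject₁ k) ≤ starts (suc k)
  end≤next k = ≤-trans (m≤m+n _ _) (≤-reflexive (arrive′ k))

  starts-mono : ∀ {k l} → toℕ k ≤ toℕ l → starts k ≤ starts l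
  starts-mono = fin-mono starts (λ k → ≤-trans (m≤m+n _ _) (end≤next k))

  ends-mono : ∀ {k l} → toℕ k ≤ toℕ l → end-of k ≤ end-of l
  ends-mono = fin-mono end-of (λ k → ≤-trans (end≤next k) (m≤m+n _ _))

  end≤start : ∀ {k l} → toℕ k < toℕ l → end-of k ≤ starts l
  end≤start {k} {suc l} (s≤s k≤l) = ≤-trans (ends-mono (≤-trans k≤l (≤-reflexive (sym (toℕ-inject₁ l))))) (end≤next l)

  par-end≤ : ∀ k i → scaledEnd (C.par k i) ≤ starts (suc k)
  par-end≤ k i = ≤-trans (+-monoʳ-≤ _ (≤-trans (m≤m+n _ _) (At.ends k i))) (≤-reflexive (arrive′ k))

  hwork : C.Job → ℕ
  hwork j = h (processing′ (sideAt j) j)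

  -- Rounding up and multiplying back never shortens a time (`≤δh`), so a constraint met by rounded
  -- times is met by the given ones.
  unscale : ∀ {d g x j} → d + h g + hwork j ≤ scaledEnd j → x ≤ δ * d → x + g + processing′ (y j) j ≤ δ * scaledEnd j
  unscale {d} {g} {x} {j} le x≤ = begin
    x + g + processing′ (y j) j                              ≡⟨ cong (λ v → x + g + processing′ v j) (y≡ j) ⟩
    x + g + processing′ (sideAt j) j                         ≤⟨ +-mono-≤ (+-mono-≤ x≤ (≤δh g)) (≤δh _) ⟩
    δ * d + δ * h g + δ * hwork j                            ≡⟨ cong (_+ δ * hwork j) (*-distribˡ-+ δ d (h g)) ⟨
    δ * (d + h g) + δ * hwork j                              ≡⟨ *-distribˡ-+ δ (d + h g) (hwork j) ⟨
    δ * (d + h g + hwork j)                                  ≤⟨ *-monoʳ-≤ δ le ⟩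
    δ * scaledEnd j                                          ∎
    where open ≤-Reasoning

  along-scaled : ∀ {i j} (e : i C.⟶ j) → scaledEnd i + gap (sideAt i) (sideAt j) (h (C.delay e)) + hwork j ≤ scaledEnd j
  along-scaled (C.direct k eq) = +-monoˡ-≤ _ (≤-trans (+-monoʳ-≤ (end-of (inject₁ k)) (At.edge-delay k eq)) (≤-reflexive (arrive′ k)))
  along-scaled (C.fork k i) = ≤-trans (≤-reflexive (+-assoc (end-of (inject₁ k)) _ _)) (+-monoʳ-≤ (end-of (inject₁ k)) (At.begins k i))
  along-scaled (C.join k i) = +-monoˡ-≤ _ (≤-trans (≤-reflexive (+-assoc (end-of (inject₁ k)) _ _))
    (≤-trans (+-monoʳ-≤ (end-of (inject₁ k)) (At.ends k i)) (≤-reflexive (arrive′ k))))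

  along-real : ∀ {i j} (e : i C.⟶ j) →
               δ * scaledEnd i + gap (sideAt i) (sideAt j) (C.delay e) + processing′ (y j) j ≤ δ * scaledEnd j
  along-real {i} {j} e = unscale {g = gap (sideAt i) (sideAt j) (C.delay e)} {j = j}
    (subst (λ g → scaledEnd i + g + hwork j ≤ scaledEnd j) (gap-h {h} h-0 (sideAt i) (sideAt j) (C.delay e)) (along-scaled e)) ≤-refl

  -- Each job lies in a window from `lo` to `hi`, and windows of different rank follow one another.
  -- Only jobs of one link can therefore compete for the server.
  rankOf lo hi : C.Job → ℕ
  rankOf (C.chain k) = 2 * toℕ k
  rankOf (C.par k _) = suc (2 * toℕ k)
  lo (C.chain k) = starts k
  lo (C.par k _) = end-of (inject₁ k)
  hi (C.chain k) = end-of k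
  hi (C.par k _) = starts (suc k)

  end≤hi : ∀ j → scaledEnd j ≤ hi j
  end≤hi (C.chain k) = ≤-refl
  end≤hi (C.par k i) = par-end≤ k i

  lo+work : ∀ j → lo j + hwork j ≤ scaledEnd j
  lo+work (C.chain k) = ≤-refl
  lo+work (C.par k i) = +-monoʳ-≤ (end-of (inject₁ k)) (≤-trans (m≤n+m _ _) (At.begins k i))

  hi≤lo : ∀ i j → rankOf i < rankOf j → hi i ≤ lo j
  hi≤lo (C.chain k) (C.chain l) lt = end≤start (*-cancelˡ-< 2 (toℕ k) (toℕ l) lt)
  hi≤lo (C.chain k) (C.par l _) (s≤s le) = ends-mono (≤-trans (*-cancelˡ-≤ 2 le) (≤-reflexive (sym (toℕ-inject₁ l))))
  hi≤lo (C.par k _) (C.chain l) lt = starts-mono (*-cancelˡ-< 2 (toℕ k) (toℕ l) (<-trans (n<1+n _) lt))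
  hi≤lo (C.par k _) (C.par l _) (s≤s lt) = ≤-trans (m≤m+n _ _) (≤-trans (ends-mono {suc k} {inject₁ l}
    (≤-trans (*-cancelˡ-< 2 (toℕ k) (toℕ l) lt) (≤-reflexive (sym (toℕ-inject₁ l))))) ≤-refl)

  Precedes : C.Job → C.Job → Set
  Precedes i j = scaledEnd i + hwork j ≤ scaledEnd j

  precedes : ∀ i j → rankOf i < rankOf j → Precedes i j
  precedes i j lt = ≤-trans (+-monoˡ-≤ (hwork j) (≤-trans (end≤hi i) (hi≤lo i j lt))) (lo+work j)

  same-rank : ∀ i j → i ≢ j → sideAt i ≡ yea → sideAt j ≡ yea → rankOf i ≡ rankOf j → Precedes i j ⊎ Precedes j i
  same-rank (C.chain k) (C.chain l) i≢j _ _ eq = ⊥-elim (i≢j (cong C.chain (toℕ-injective (*-cancelˡ-≡ (toℕ k) (toℕ l) 2 eq))))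
  same-rank (C.chain k) (C.par l _) _ _ _ eq = ⊥-elim (even≢odd (toℕ k) (toℕ l) eq)
  same-rank (C.par k _) (C.chain l) _ _ _ eq = ⊥-elim (even≢odd (toℕ l) (toℕ k) (sym eq))
  same-rank (C.par k i) (C.par l j) i≢j si sj eq = go (toℕ-injective (*-cancelˡ-≡ (toℕ k) (toℕ l) 2 (suc-injective eq))) i j i≢j si sj
    where
    later : ∀ {k i j} → At.side k j ≡ yea → At.end k i + h (C.ps (C.par k j)) ≤ At.end k j → Precedes (C.par k i) (C.par k j)
    later {k} {i} {j} sj le = ≤-trans (≤-reflexive (trans (+-assoc (end-of (inject₁ k)) (At.end k i) _)
      (cong (λ v → end-of (inject₁ k) + (At.end k i + h (processing′ v (C.par k j)))) sj))) (+-monoʳ-≤ (end-of (inject₁ k)) le)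
    go : ∀ {k l} → k ≡ l → ∀ i j → C.par k i ≢ C.par l j → At.side k i ≡ yea → At.side l j ≡ yea →
         Precedes (C.par k i) (C.par l j) ⊎ Precedes (C.par l j) (C.par k i)
    go {k} refl i j i≢j si sj = Sum.map (later sj) (later si) (At.apart k (λ { refl → i≢j refl }) si sj)

  exclusive-scaled : ∀ i j → i ≢ j → sideAt i ≡ yea → sideAt j ≡ yea → Precedes i j ⊎ Precedes j i
  exclusive-scaled i j i≢j si sj with <-cmp (rankOf i) (rankOf j)
  ... | tri< lt _ _ = inj₁ (precedes i j lt)
  ... | tri≈ _ eq _ = same-rank i j i≢j si sj eq
  ... | tri> _ _ gt = inj₂ (precedes j i gt)

  precedes-real : ∀ i j → Precedes i j → StartsAfter π (δ * scaledEnd i) j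
  precedes-real i j le = starts-after⁺ j (≤-trans (≤-reflexive (cong (_+ processing′ (y j) j) (sym (+-identityʳ _))))
    (unscale {d = scaledEnd i} {g = 0} {j = j} (≤-trans (≤-reflexive (cong (_+ hwork j) (trans (cong (scaledEnd i +_) h-0) (+-identityʳ _)))) le) ≤-refl))

  decode-server : ∀ {v} → decodeSide v ≡ server → v ≡ yea
  decode-server {yea} _ = refl

  gap-different : ∀ {v w} c → decodeSide v ≢ decodeSide w → gap v w c ≡ c
  gap-different {yea} {yea} c neq = ⊥-elim (neq refl)
  gap-different {yea} {nay} c neq = refl
  gap-different {nay} {yea} c neq = refl
  gap-different {nay} {nay} c neq = ⊥-elim (neq refl)

  valid : Valid π
  valid = record
    { server-exclusive = λ {i} {j} i≢j si sj → Sum.map (precedes-real i j) (precedes-real j i)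
        (exclusive-scaled i j i≢j (decode-server si) (decode-server sj))
    ; same-side = λ {i} {j} e _ → starts-after⁺ j (≤-trans (+-monoˡ-≤ (processing′ (y j) j) (m≤m+n (δ * scaledEnd i) _)) (along-real e))
    ; different-side = λ {i} {j} e neq → starts-after⁺ j (subst (λ g → δ * scaledEnd i + g + processing′ (y j) j ≤ δ * scaledEnd j)
        (gap-different (C.delay e) neq) (along-real e)) }

  cost≡ : cost π ≡ ⌜ totalCost ⌝
  cost≡ = trans (total C.jobs) (cong ⌜_⌝ (trans cost-by-stage (trans (cong sum (map-cong stage-cost (allFin (suc n))))
    (cong sum (map-tabulate id (λ k → StepAt.stepCost (steps k)))))))
    where
    stage-cost : ∀ k → paid (C.chain (inject₁ k)) + sum (map (λ i → paid (C.par k i)) (parIndices k)) ≡ StepAt.stepCost (steps k)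
    stage-cost k = cong₂ _+_
      (trans (cong (λ v → ite v 0 (price′ (C.chain (inject₁ k)))) (y≡ (C.chain (inject₁ k)))) (sym (proj₁ (proj₂ (chosen k (StepAt.choice (steps k)))))))
      (cong sum (map-cong (λ i → cong (λ v → ite v 0 (price′ (C.par k i))) (y≡ (C.par k i))) (parIndices k)))

  end-of-t : end-of (fromℕ (suc n)) ≡ T
  end-of-t = begin
    starts (fromℕ (suc n)) + h (processing′ (sides (fromℕ (suc n))) C.t) ≡⟨ cong₂ (λ S v → S + h (processing′ v C.t)) last last-side ⟩
    T + h (C.ps C.t)                                                    ≡⟨ cong (λ p → T + h p) C.ps-t ⟩
    T + h 0                                                             ≡⟨ cong (T +_) h-0 ⟩
    T + 0                                                               ≡⟨ +-identityʳ T ⟩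
    T                                                                   ∎
    where open ≡-Reasoning

  makespan≡ : makespan π ≡ δ * T
  makespan≡ = cong (δ *_) end-of-t

  -- Both sides list each chain job together with the parallel jobs right after it, and the sink
  -- last.
  encoding : encodeSchedule G π ≡ output δ T decisions
  encoding = begin
    map (λ j → y j , δ * scaledEnd j) C.jobs                      ≡⟨ map-cong (λ j → cong (_, δ * scaledEnd j) (y≡ j)) C.jobs ⟩
    map (λ j → sideAt j , δ * scaledEnd j) C.jobs                 ≡⟨ map-∘ {g = rescale} {f = raw} C.jobs ⟩
    map rescale (map raw C.jobs)                                  ≡⟨ cong (map rescale) (map-++ raw (concatMap C.stage (allFin (suc n))) (C.t ∷ [])) ⟩
    map rescale (map raw (concatMap C.stage (allFin (suc n))) ++ raw C.t ∷ []) ≡⟨ cong₂ (λ xs x → map rescale (xs ++ x ∷ [])) stages (cong₂ _,_ last-side end-of-t) ⟩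
    output δ T decisions                                          ∎
    where
    open ≡-Reasoning
    rescale : ⟦ SideTy ⊗ nat ⟧ → ⟦ SideTy ⊗ nat ⟧
    rescale x = proj₁ x , δ * proj₂ x
    raw : C.Job → ⟦ SideTy ⊗ nat ⟧
    raw j = sideAt j , scaledEnd j
    flat : ⟦ ChainDecisionTy ⟧ → Places
    flat D = proj₁ D ∷ proj₂ D
    decide : Fin (suc n) → ⟦ ChainDecisionTy ⟧
    decide k = StepAt.decision (steps k)
    stage-raw : ∀ k → map raw (C.stage k) ≡ flat (decide k)
    stage-raw k = trans (cong (raw (C.chain (inject₁ k)) ∷_) (sym (map-∘ {g = raw} {f = C.par k} (parIndices k))))
      (cong (λ p → (sides (inject₁ k) , starts (inject₁ k) + h p) ∷ LinkStage.places (stage-at k) (starts (inject₁ k) + h p)) (sym (p≡ k)))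
    stages : map raw (concatMap C.stage (allFin (suc n))) ≡ concatMap flat decisions
    stages = begin
      map raw (concatMap C.stage (allFin (suc n)))      ≡⟨ map-concatMap raw C.stage (allFin (suc n)) ⟩
      concatMap (map raw ∘ C.stage) (allFin (suc n))    ≡⟨ concatMap-cong stage-raw (allFin (suc n)) ⟩
      concatMap (flat ∘ decide) (allFin (suc n))        ≡⟨ concatMap-map flat decide (allFin (suc n)) ⟨
      concatMap flat (map decide (allFin (suc n)))      ≡⟨ cong (concatMap flat) (map-tabulate id decide) ⟩
      concatMap flat decisions                          ∎

chainItems≡ : ∀ X → chainItems (encodeChain X) ≡ map encodeChainLink (chainLinks (ExtendedChain.links X) (Chains.chainJobs X))
chainItems≡ X = trans (cong (zipL (map encodeLink (Vec.toList links))) (cong ((0 , []) ∷_) (trans (sym (map-∘ (Vec.toList inner))) (sym (toList-map _ inner)))))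
  (zipped links (Chains.chainJobs X))
  where
  open ExtendedChain X
  zipped : ∀ {m} (ls : Vec Link m) js → zipL (map encodeLink (Vec.toList ls)) (Vec.toList js) ≡ map encodeChainLink (chainLinks ls js)
  zipped []       []       = refl
  zipped (l ∷ ls) (j ∷ js) = cong (_ ∷_) (zipped ls js)

-- Rounding up to multiples of δ

module Scale (d : ℕ) where

  private
    δ : ℕ
    δ = suc d

    h : ℕ → ℕ
    h = scale δ

  scale-mono : ∀ {x y} → x ≤ y → h x ≤ h y
  scale-mono x≤y = /-monoˡ-≤ δ (+-monoˡ-≤ d x≤y)

  scale-0 : h 0 ≡ 0
  scale-0 = m<n⇒m/n≡0 {d} {δ} ≤-refl

  scale-bound : ∀ {x q} → x ≤ q * δ → h x ≤ q
  scale-bound {x} {q} x≤ = ≤-pred (m<n*o⇒m/o<n {m = x + d} {suc q} {δ} (begin-strict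
    x + d     <⟨ +-monoʳ-< x (n<1+n d) ⟩
    x + δ     ≤⟨ +-monoˡ-≤ δ x≤ ⟩
    q * δ + δ ≡⟨ +-comm (q * δ) δ ⟩
    suc q * δ ∎))
    where open ≤-Reasoning

  scale-≤ : ∀ x → h x ≤ x
  scale-≤ x = scale-bound (m≤m*n x δ)

  ≤-scale : ∀ x → x ≤ δ * h x
  ≤-scale x = +-cancelˡ-≤ d x (δ * h x) (begin
    d + x                       ≡⟨ +-comm d x ⟩
    x + d                       ≡⟨ m≡m%n+[m/n]*n (x + d) δ ⟩
    (x + d) % δ + h x * δ       ≤⟨ +-monoˡ-≤ (h x * δ) (≤-pred (m%n<n (x + d) δ)) ⟩
    d + h x * δ                 ≡⟨ cong (d +_) (*-comm (h x) δ) ⟩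
    d + δ * h x                 ∎)
    where open ≤-Reasoning

  scale-upper : ∀ x → δ * h x ≤ x + d
  scale-upper x = ≤-trans (≤-reflexive (*-comm δ (h x))) (m/n*n≤m (x + d) δ)

  -- The two roundings add at most `d` each, together less than two multiples of `suc d`.
  scale-+ : ∀ x y → h x + h y ≤ h (x + y) + 1
  scale-+ x y = ≤-trans (≤-pred (*-cancelˡ-< δ (h x + h y) (suc (h (x + y) + 1)) (begin-strict
    δ * (h x + h y)               ≡⟨ *-distribˡ-+ δ (h x) (h y) ⟩
    δ * h x + δ * h y             ≤⟨ +-mono-≤ (scale-upper x) (scale-upper y) ⟩
    x + d + (y + d)               ≡⟨ interchange x d y d ⟩
    x + y + (d + d)               ≤⟨ +-monoˡ-≤ (d + d) (≤-scale (x + y)) ⟩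
    δ * h (x + y) + (d + d)       <⟨ +-monoʳ-< (δ * h (x + y)) (+-mono-< (n<1+n d) (n<1+n d)) ⟩
    δ * h (x + y) + (δ + δ)       ≡⟨ collect δ (h (x + y)) ⟩
    δ * suc (h (x + y) + 1)       ∎))) ≤-refl
    where
    open ≤-Reasoning
    collect : ∀ δ q → δ * q + (δ + δ) ≡ δ * suc (q + 1)
    collect = solve-∀

scale-1 : ∀ x → scale 1 x ≡ x
scale-1 x = trans (n/1≡n (x + 0)) (+-identityʳ x)

-- The conditions of an admissible chain

⊓-lower : ∀ {A : Set} (f : A → ℕ) (x : A) xs i → foldr₁ _⊓_ (List⁺.map f (x ∷ xs)) ≤ f (List.lookup (x ∷ xs) i)
⊓-lower f x []       zero    = ≤-refl
⊓-lower f x (y ∷ xs) zero    = m⊓n≤m (f x) _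
⊓-lower f x (y ∷ xs) (suc i) = ≤-trans (m⊓n≤n (f x) _) (⊓-lower f y xs i)

⊔-upper : ∀ {A : Set} (f : A → ℕ) (x : A) xs i → f (List.lookup (x ∷ xs) i) ≤ foldr₁ _⊔_ (List⁺.map f (x ∷ xs))
⊔-upper f x []       zero    = ≤-refl
⊔-upper f x (y ∷ xs) zero    = m≤m⊔n (f x) _
⊔-upper f x (y ∷ xs) (suc i) = ≤-trans (⊔-upper f y xs i) (m≤n⊔m (f x) _)

conditions : ∀ {cmax} l → (∀ {js} → l ≡ parallel js → ProcessingDominatesDelay js ⊎ DelaysAtMost js cmax ⊎ EqualInDelays js) →
             Condition cmax (jobOf l)
conditions (edge c) _ = inj₂ (inj₂ λ ())
conditions (parallel (j ∷ js)) adm with adm refl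
... | inj₁ dominated = inj₁ λ i k → begin
  cᵢₙ (List.lookup (j ∷ js) k)                     ≤⟨ m≤m⊔n _ _ ⟩
  cᵢₙ (List.lookup (j ∷ js) k) ⊔ cₒᵤₜ (List.lookup (j ∷ js) k) ≤⟨ ⊔-upper (λ j → cᵢₙ j ⊔ cₒᵤₜ j) j js k ⟩
  _                                                ≤⟨ dominated ⟩
  _                                                ≤⟨ ⊓-lower (λ j → ps j ⊓ pc j) j js i ⟩
  ps (List.lookup (j ∷ js) i) ⊓ pc (List.lookup (j ∷ js) i) ≤⟨ m⊓n≤m _ _ ⟩
  ps (List.lookup (j ∷ js) i)                      ∎
  where
  open ≤-Reasoning
  open ParallelJob
... | inj₂ (inj₁ bounded) = inj₂ (inj₁ λ i → proj₁ (bounded (∈-lookup i)))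
... | inj₂ (inj₂ alike)   = inj₂ (inj₂ λ i k → alike (∈-lookup i) (∈-lookup k))

All-chainLinks : ∀ {P : ChainLink → Set} {m} (ls : Vec Link m) js → (∀ k → P (Vec.lookup ls k , Vec.lookup js k)) → All P (chainLinks ls js)
All-chainLinks []       []       p = []
All-chainLinks (l ∷ ls) (j ∷ js) p = p zero ∷ All-chainLinks ls js (p ∘ suc)

-- Lengths of the unary lists

length-concatMap-const : ∀ {A B : Set} (f : A → List B) c xs → (∀ x → length (f x) ≡ c) → length (concatMap f xs) ≡ length xs * c
length-concatMap-const f c []       eq = refl
length-concatMap-const f c (x ∷ xs) eq = trans (length-++ (f x)) (cong₂ _+_ (eq x) (length-concatMap-const f c xs eq))

length-∈-concatMap : ∀ {A B : Set} (f : A → List B) {x xs} → x ∈ xs → length (f x) ≤ length (concatMap f xs)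
length-∈-concatMap f {x} (here refl) = ≤-trans (m≤m+n (length (f x)) _) (≤-reflexive (sym (length-++ (f x))))
length-∈-concatMap f (there {x = y} x∈) = ≤-trans (length-∈-concatMap f x∈) (≤-trans (m≤n+m _ (length (f y))) (≤-reflexive (sym (length-++ (f y)))))

length-weights : ∀ {m} (ls : Vec Link m) js → length (weights (map encodeLink (Vec.toList ls))) ≡ planWeight (chainLinks ls js)
length-weights []       []       = refl
length-weights (edge c ∷ ls) (_ ∷ js) = cong (4 +_) (length-weights ls js)
length-weights (parallel (j ∷ js′) ∷ ls) (_ ∷ js) = trans (cong (5 +_) (trans (length-++ (map (λ _ → tt) (map encodeParallelJob js′)))
    (cong₂ _+_ (trans (length-map _ (map encodeParallelJob js′)) (length-map _ js′)) (length-weights ls js))))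
  (arrange (length js′) (planWeight (chainLinks ls js)))
  where
  arrange : ∀ a b → 5 + (a + b) ≡ suc a + 4 + b
  arrange = solve-∀

module Sizes (X : ExtendedChain) (b : ℕ) (us : List ⊤) where
  open ExtendedChain X
  open Chains X

  input : ⟦ InTy ⟧
  input = (encodeChain X , b) , us

  ls : List ChainLink
  ls = chainLinks links chainJobs

  W M top : ℕ
  W = planWeight ls
  M = W + suc W * (length us * 2)
  top = length (serverBits (encodeChain X))

  length-horizon : length (horizon input) ≡ suc M
  length-horizon = cong suc (trans (length-++ ws) (cong₂ _+_ ws≡ (trans
    (length-concatMap-const (λ _ → concatMap (λ _ → tt ∷ tt ∷ []) us) (length us * 2) (tt ∷ ws) (λ _ → length-concatMap-const (λ _ → tt ∷ tt ∷ []) 2 us (λ _ → refl)))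
    (cong (λ w → suc w * (length us * 2)) ws≡))))
    where
    ws : List ⊤
    ws = weights (map encodeLink (Vec.toList links))
    ws≡ : length ws ≡ W
    ws≡ = length-weights links chainJobs

  times-∋ : ∀ {x} → x ≤ M → x ∈ times input
  times-∋ x≤ = ∈-range (horizon input) (≤-trans (s≤s x≤) (≤-reflexive (sym length-horizon)))

  lookup-∈-toList : ∀ {A : Set} {m} (xs : Vec A m) k → Vec.lookup xs k ∈ Vec.toList xs
  lookup-∈-toList (x ∷ xs) zero    = here refl
  lookup-∈-toList (x ∷ xs) (suc k) = there (lookup-∈-toList xs k)

  private
    units≤ : ∀ {p k} → length (units p) ≤ k → p ≤ 2 ^ k
    units≤ {p} {k} le = ≤-trans (<⇒≤ (n<2^bits p)) (^-monoʳ-≤ 2 (≤-trans (≤-reflexive (sym (length-replicate (bits p)))) le))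

    chainUnits : ⟦ ChainJobTy ⟧ → List ⊤
    chainUnits j = units (proj₁ j)

    linkUnits : ⟦ LinkTy ⟧ → List ⊤
    linkUnits l = [ (λ _ → []) , (λ jjs → concatMap (λ j → units (proj₁ (proj₁ j))) (proj₁ jjs ∷ proj₂ jjs)) ]′ l

    length-++ˡ : ∀ (xs ys : List ⊤) → length xs ≤ length (xs ++ ys)
    length-++ˡ xs ys = ≤-trans (m≤m+n _ _) (≤-reflexive (sym (length-++ xs)))

    length-++ʳ : ∀ (xs ys : List ⊤) → length ys ≤ length (xs ++ ys)
    length-++ʳ xs ys = ≤-trans (m≤n+m _ (length xs)) (≤-reflexive (sym (length-++ xs)))

    chain-small : ∀ k → proj₁ (Vec.lookup chainJobs k) ≤ 2 ^ top
    chain-small zero    = z≤n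
    chain-small (suc k) = ≤-trans (≤-reflexive (cong proj₁ (job-at k))) (units≤ (≤-trans
      (length-∈-concatMap chainUnits (∈-map⁺ encodeChainJob (lookup-∈-toList inner k)))
      (length-++ˡ (concatMap chainUnits (map encodeChainJob (Vec.toList inner))) _)))

    jobs-small : ∀ l → length (linkUnits (encodeLink l)) ≤ top → ∀ i → psOf (jobOf l i) ≤ 2 ^ top
    jobs-small (parallel (j ∷ js)) le i = units≤ (≤-trans
      (length-∈-concatMap (λ j → units (proj₁ (proj₁ j))) (∈-map⁺ encodeParallelJob (∈-lookup {xs = j ∷ js} i))) le)

    link-small : ∀ k i → psOf (jobOf (Vec.lookup links k) i) ≤ 2 ^ top
    link-small k = jobs-small (Vec.lookup links k) (≤-trans
      (length-∈-concatMap linkUnits (∈-map⁺ encodeLink (lookup-∈-toList links k)))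
      (length-++ʳ (concatMap chainUnits (map encodeChainJob (Vec.toList inner))) _))

  small-on-server : ∀ d → suc d ≡ 2 ^ top → All (SmallOnServer {scale (suc d)}) ls
  small-on-server d eq = All-chainLinks links chainJobs λ k → fits (chain-small k) , λ i → fits (link-small k i)
    where
    fits : ∀ {x} → x ≤ 2 ^ top → scale (suc d) x ≤ 1
    fits x≤ = Scale.scale-bound d (≤-trans x≤ (≤-reflexive (trans (sym eq) (sym (*-identityˡ (suc d))))))

-- Quality of the schedule found

-- A passage from failure to success is found by scanning alone, whether or not `P` is monotone.
first-success : ∀ {P : ℕ → Set} → Decidable P → ∀ k → P 0 ⊎ (∃[ i ] i < k × ¬ P i × P (suc i)) ⊎ ¬ P k
first-success P? zero with P? 0
... | yes p = inj₁ p
... | no ¬p = inj₂ (inj₂ ¬p)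
first-success P? (suc k) with first-success P? k | P? (suc k)
... | inj₁ p                            | _     = inj₁ p
... | inj₂ (inj₁ (i , i<k , rest))      | _     = inj₂ (inj₁ (i , m≤n⇒m≤1+n i<k , rest))
... | inj₂ (inj₂ ¬p)                    | yes p = inj₂ (inj₁ (k , ≤-refl , ¬p , p))
... | inj₂ (inj₂ _)                     | no ¬p = inj₂ (inj₂ ¬p)

power : ∀ i → ∃[ d ] suc d ≡ 2 ^ i
power i = pred (2 ^ i) , suc-pred (2 ^ i) {{m^n≢0 2 i}}

module Quality {cmax : ℕ} (I : BudgetInstance cmax) (us : List ⊤) (0<R : 0 < length us) where
  open BudgetInstance I renaming (extendedChain to X; budget to b)
  open ExtendedChain X
  open Chains X
  open Sizes X b us

  K R : ℕ
  K = slotBound cmax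
  R = length us

  conds : All (λ l → Condition cmax (jobOf (proj₁ l))) ls
  conds = All-chainLinks links chainJobs λ k → conditions (Vec.lookup links k) (admissible k)

  entries : ℕ → ℕ → List ⟦ ChainEntryTy ⟧
  entries δ T = chainTable K (scale δ) b (times input) T (chainItems (encodeChain X))

  candidate : ℕ → ℕ → ⟦ ChainEntryTy ⟧ → ℕ × Places
  candidate δ T e = δ * T , output δ T (proj₂ (proj₂ e))

  row : ℕ → ℕ → List (ℕ × Places)
  row δ T = map (candidate δ T) (entries δ T)

  entries≡ : ∀ δ T → entries δ T ≡ chainTable K (scale δ) b (times input) T (map encodeChainLink ls)
  entries≡ δ T = cong (chainTable K (scale δ) b (times input) T) (chainItems≡ X)

  Good : ℕ × Places → Set
  Good (m , out) = Σ[ y ∈ BudgetSchedule G b ] makespan (BudgetSchedule.schedule y) ≡ m × encodeSchedule G (BudgetSchedule.schedule y) ≡ out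

  entry-good : ∀ d T {a S κ ds} → ((a , S) , κ , ds) ∈ chainTable K (scale (suc d)) b (times input) T (map encodeChainLink ls) →
               Good (suc d * T , output (suc d) T ds)
  entry-good d T e∈ =
    let plan , κ≤b = chain-sound K b (times input) (scale (suc d)) T ls e∈
        unrolled u cost-u ds-u _ _ = unroll links chainJobs plan
        module S = ToSchedule X {scale (suc d)} {suc d} (Scale.scale-0 d) (Scale.≤-scale d) u
    in record { schedule = S.π ; valid = S.valid
              ; withinBudget = subst (_≤⁺ ⌜ b ⌝) (sym S.cost≡) NonStrict.[ ≤-trans (≤-reflexive cost-u) κ≤b ] } ,
       S.makespan≡ , trans S.encoding (cong (output (suc d) T) ds-u)

  candidates-good : ∀ {x} → x ∈ candidates K input → Good x
  candidates-good {x} x∈ =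
    let δ , δ∈ , x∈₁ = ∈-concatMap-elim (λ δ → concatMap (row δ) (times input)) (scales input) x∈
        T , _ , x∈₂ = ∈-concatMap-elim (row δ) (times input) x∈₁
        e , e∈ , x≡ = ∈-map⁻ (candidate δ T) x∈₂
        i , _ , δ≡ = powersUpTo-∈ top δ∈
        d , d≡ = power i
    in subst Good (sym x≡) (at-power T e (trans δ≡ (sym d≡)) e∈)
    where
    at-power : ∀ {δ d} T e → δ ≡ suc d → e ∈ entries δ T → Good (candidate δ T e)
    at-power {d = d} T e refl e∈ = entry-good d T (subst (e ∈_) (entries≡ (suc d) T) e∈)

  Reaches : ℕ → Set
  Reaches m = ∃[ out ] (m , out) ∈ candidates K input

  candidate-from : ∀ d i → suc d ≡ 2 ^ i → i ≤ top → ∀ {a S T κ ds} → Plan (scale (suc d)) a S ls T κ ds → κ ≤ b → T ≤ M → Reaches (suc d * T)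
  candidate-from d i d≡ i≤ {a} {S} {T} plan κ≤ T≤M =
    let κ₁ , ds₁ , e∈ , _ = chain-complete K b (times input) (scale (suc d)) T refl (Scale.scale-mono d) (Scale.scale-≤ d)
                              (λ x≤ → times-∋ (≤-trans x≤ T≤M)) conds plan κ≤
    in output (suc d) T ds₁ , ∈-concatMap-intro (λ δ → concatMap (row δ) (times input)) (subst (_∈ scales input) (sym d≡) (∈-powersUpTo i≤))
         (∈-concatMap-intro (row (suc d)) (times-∋ T≤M) (∈-map⁺ (candidate (suc d) T) (subst (((a , S) , κ₁ , ds₁) ∈_) (sym (entries≡ (suc d) T)) e∈)))

  top-candidate : ∀ d → suc d ≡ 2 ^ top → ∃[ T ] T ≤ W × Reaches (suc d * T)
  top-candidate d d≡ =
    let T , ds , plan , T≤W = server-plan ls (small-on-server d d≡) 0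
    in T , T≤W , candidate-from d top d≡ ≤-refl plan z≤n (≤-trans T≤W (m≤m+n W _))

  module Against {a S T κ ds} (plan : Plan id a S ls T κ ds) (affordable : κ ≤ b) where

    -- `e` is the absolute error; `e * R ≤ T` makes it at most the fraction 1 / R of the makespan to
    -- be compared with.
    Near : Set
    Near = ∃[ m ] ∃[ e ] Reaches m × m ≤ T + e × e * R ≤ T

    -- At scale 2 ^ i the plan survives rounding, within the horizon.
    Succeeds : ℕ → Set
    Succeeds zero    = T ≤ M
    Succeeds (suc i) = scale (2 ^ suc i) T + W ≤ M

    succeeds? : Decidable Succeeds
    succeeds? zero    = T ≤? M
    succeeds? (suc i) = (scale (2 ^ suc i) T + W) ≤? M

    -- The horizon exceeds the error bound `W` by `suc W * (R * 2)`, so a plan that leaves it is at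
    -- least this many multiples of the scale long.
    failure : ∀ i → ¬ Succeeds i → 2 ^ i * (suc W * (R * 2)) ≤ T
    failure zero    ¬s = ≤-trans (≤-reflexive (*-identityˡ _)) (≤-trans (m≤n+m _ W) (<⇒≤ (≰⇒> ¬s)))
    failure (suc i) ¬s with power (suc i)
    ... | d , d≡ = ≮⇒≥ λ T< → ¬s (≤-trans (+-monoˡ-≤ W (Q≥ T<)) (≤-reflexive (+-comm (suc W * (R * 2)) W)))
      where
      Q≥ : T < 2 ^ suc i * (suc W * (R * 2)) → scale (2 ^ suc i) T ≤ suc W * (R * 2)
      Q≥ T< = subst (λ δ → scale δ T ≤ suc W * (R * 2)) d≡ (Scale.scale-bound d
        (≤-trans (<⇒≤ T<) (≤-reflexive (trans (*-comm (2 ^ suc i) _) (cong (suc W * (R * 2) *_) (sym d≡))))))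

    exactly : Succeeds 0 → Near
    exactly T≤M =
      -- At scale 1 nothing is rounded, so the unit of error is 0.
      let T₀ , _ , plan₀ , T₀≤ = round-plan {h = scale 1} {e = 0} (Scale.scale-mono 0) (Scale.scale-0 0)
            (λ x y → ≤-reflexive (trans (cong₂ _+_ (scale-1 x) (scale-1 y)) (trans (sym (scale-1 (x + y))) (sym (+-identityʳ _))))) plan {0} {0} z≤n
          T₀≤T = ≤-trans T₀≤ (≤-reflexive (trans (+-identityʳ _) (scale-1 T)))
      in 1 * T₀ , 0 , candidate-from 0 0 refl z≤n plan₀ affordable (≤-trans T₀≤T T≤M) ,
         ≤-trans (≤-reflexive (*-identityˡ T₀)) (≤-trans T₀≤T (m≤m+n T 0)) , z≤n

    rounded : ∀ i → i < top → ¬ Succeeds i → Succeeds (suc i) → Near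
    rounded i i< ¬s s with power (suc i)
    ... | d , d≡ =
      let T₀ , _ , plan₀ , T₀≤ = round-plan {h = scale (suc d)} {e = 1} (Scale.scale-mono d) (Scale.scale-0 d) (Scale.scale-+ d) plan {0} {0} z≤n
          T₀≤′ = ≤-trans T₀≤ (≤-reflexive (cong (scale (suc d) T +_) (*-identityˡ W)))
      in suc d * T₀ , suc d * suc W ,
         candidate-from d (suc i) d≡ i< plan₀ affordable (≤-trans T₀≤′ (subst (λ δ → scale δ T + W ≤ M) (sym d≡) s)) ,
         near T₀≤′ , small
      where
      open ≤-Reasoning
      near : ∀ {T₀} → T₀ ≤ scale (suc d) T + W → suc d * T₀ ≤ T + suc d * suc W
      near {T₀} T₀≤ = begin
        suc d * T₀                              ≤⟨ *-monoʳ-≤ (suc d) T₀≤ ⟩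
        suc d * (scale (suc d) T + W)           ≡⟨ *-distribˡ-+ (suc d) (scale (suc d) T) W ⟩
        suc d * scale (suc d) T + suc d * W     ≤⟨ +-monoˡ-≤ _ (Scale.scale-upper d T) ⟩
        T + d + suc d * W                       ≤⟨ +-monoˡ-≤ _ (+-monoʳ-≤ T (n≤1+n d)) ⟩
        T + suc d + suc d * W                   ≡⟨ +-assoc T (suc d) _ ⟩
        T + (suc d + suc d * W)                 ≡⟨ cong (T +_) (*-suc (suc d) W) ⟨
        T + suc d * suc W                       ∎
      -- The failure at the preceding scale, half as large, bounds the plan from below; the factor 2
      -- in the horizon makes up for the doubling.
      small : suc d * suc W * R ≤ T
      small = begin
        suc d * suc W * R                 ≡⟨ cong (λ δ → δ * suc W * R) d≡ ⟩
        2 * 2 ^ i * suc W * R             ≡⟨ arrange (2 ^ i) (suc W) R ⟩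
        2 ^ i * (suc W * (R * 2))         ≤⟨ failure i ¬s ⟩
        T                                 ∎
        where
        arrange : ∀ p w r → 2 * p * w * r ≡ p * (w * (r * 2))
        arrange = solve-∀

    -- A plan that fails even at the last scale is at least as long as the one entirely on the
    -- server, so no error remains.
    fallback : ¬ Succeeds top → Near
    fallback ¬s with power top
    ... | d , d≡ =
      let T₀ , T₀≤W , reaches = top-candidate d d≡
      in suc d * T₀ , 0 , reaches , (begin
        suc d * T₀                      ≤⟨ *-monoʳ-≤ (suc d) (≤-trans T₀≤W (n≤1+n W)) ⟩
        suc d * suc W                   ≤⟨ *-monoʳ-≤ (suc d) (≤-trans (≤-reflexive (sym (*-identityʳ (suc W)))) (*-monoʳ-≤ (suc W) (≤-trans 0<R (m≤m*n R 2)))) ⟩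
        suc d * (suc W * (R * 2))       ≡⟨ cong (_* (suc W * (R * 2))) d≡ ⟩
        2 ^ top * (suc W * (R * 2))     ≤⟨ failure top ¬s ⟩
        T                               ≡⟨ +-identityʳ T ⟨
        T + 0                           ∎) , z≤n
      where open ≤-Reasoning

    near : Near
    near = [ exactly , [ (λ (i , i< , ¬s , s) → rounded i i< ¬s s) , fallback ]′ ]′ (first-success succeeds? top)

  opaque
    unfolding solve

    solution : Σ[ y ∈ BudgetSchedule G b ] encodeSchedule G (BudgetSchedule.schedule y) ≡ solve K input ×
      (∀ (z : BudgetSchedule G b) → ∃[ e ] makespan (BudgetSchedule.schedule y) ≤ makespan (BudgetSchedule.schedule z) + e ×
                                            e * R ≤ makespan (BudgetSchedule.schedule z))
    solution =
      let d , d≡ = power top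
          _ , _ , out , c∈ = top-candidate d d≡
          x , x∈ , best≡ , _ = argmin-≤ proj₁ c∈
          y , m≡ , out≡ = candidates-good x∈
      in y , trans out≡ (sym (cong (λ xs → [ (λ _ → []) , (λ x → proj₂ (proj₁ x)) ]′ (unconsF xs)) best≡)) , λ z →
           let module Z = FromSchedule X z
               m , e , (_ , m∈) , m≤ , e≤ = Against.near (roll Z.plan-of) Z.plan-cost
               x′ , _ , best≡′ , x′≤ = argmin-≤ proj₁ m∈
               -- `argmin` has a single value, so the element found for this `z` is the candidate
               -- chosen before `z` was given.
               x≡x′ = ∷-injectiveˡ (trans (sym best≡) best≡′)
           in e , ≤-trans (≤-reflexive (trans m≡ (cong proj₁ x≡x′))) (≤-trans x′≤ (≤-trans m≤ (+-monoˡ-≤ e Z.plan-makespan))) ,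
              ≤-trans e≤ Z.plan-makespan

-- The accuracy in unary

^-* : ∀ m n k → (m * n) ^ k ≡ m ^ k * n ^ k
^-* m n zero    = refl
^-* m n (suc k) = trans (cong (m * n *_) (^-* m n k)) ([m*n]*[o*p]≡[m*o]*[n*p] m n (m ^ k) (n ^ k))

module Accuracy (σ : Ty) where

  private
    StTy : Ty
    StTy = (nat ⊗ list unit) ⊗ (σ ⊗ nat)

    In : Ty
    In = σ ⊗ (nat ⊗ nat)

    -- Counts in unary how often the numerator of ε has to be taken off its denominator until
    -- nothing remains: about 1/ε rounds, which an FPTAS can afford.
    subtract : ⟦ StTy ⟧ → ⟦ StTy ⟧ ⊎ ⟦ σ ⊗ list unit ⟧
    subtract ((d , us) , (x , num)) = ite (leq d 0) (inj₂ (x , us)) (inj₁ ((d ∸ num , tt ∷ us) , (x , num)))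

    opaque
      init : PT In StTy (λ w → (proj₂ (proj₂ w) , []) , (proj₁ w , proj₁ (proj₂ w)))
      init = ⟨ ⟨ pt-snd ⟨2⟩ , pt-nil ⟩ , ⟨ pt-fst , pt-snd ⟨1⟩ ⟩ ⟩

      body : PT StTy (StTy ⊕ (σ ⊗ list unit)) subtract
      body = pt-ite (pt-leq (pt-fst ⟨1⟩) (pt-lit 0)) (pt-inj₂ ⟨ pt-snd ⟨1⟩ , pt-fst ⟨2⟩ ⟩)
        (pt-inj₁ ⟨ ⟨ pt-∸ (pt-fst ⟨1⟩) (pt-snd ⟨2⟩) , pt-cons pt-tt (pt-fst ⟨2⟩) ⟩ , pt-snd ⟩)

    ones : ℕ → List ⊤
    ones k = List.replicate k tt

    Within′ : ℕ → ℕ → ⟦ σ ⟧ → ℕ → ⟦ StTy ⟧ → Set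
    Within′ den X x num s = size StTy s ≤ suc (suc (bits den + suc (2 * X)) + suc (size σ x + bits num))

    -- The recursion is on `Y`, a bound for the rounds that remain, as subtracting `num` gives
    -- nothing structurally smaller.
    quotient : ∀ {den X x num} Y d k → d ≤ Y * num → d ≤ den → Y + k ≤ X →
      ∃[ R ] R ≤ Y × d ≤ R * num × Loop subtract (Within′ den X x num) ((d , ones k) , (x , num)) (x , ones (R + k)) R
    quotient {den} {X} {x} {num} Y zero k _ _ k≤ = 0 , z≤n , z≤n ,
      stop (s≤s (+-monoˡ-≤ _ (s≤s (+-mono-≤ (bits-mono {0} {den} z≤n) (≤-trans (size-units k) (s≤s (*-monoʳ-≤ 2 (≤-trans (m≤n+m k Y) k≤)))))))) refl
    quotient {den} {X} {x} {num} (suc Y) d@(suc d′) k d≤ ≤den k≤ =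
      let R , R≤ , d∸≤ , l = quotient {den} {X} {x} {num} Y (d ∸ num) (suc k) (m≤n+o⇒m∸n≤o d num d≤) (≤-trans (m∸n≤m d num) ≤den)
                               (≤-trans (≤-reflexive (+-suc Y k)) k≤)
      in suc R , s≤s R≤ , ≤-trans (m≤n+m∸n d num) (+-monoʳ-≤ num d∸≤) ,
         next (s≤s (+-monoˡ-≤ _ (s≤s (+-mono-≤ (bits-mono ≤den) (≤-trans (size-units k) (s≤s (*-monoʳ-≤ 2 (≤-trans (m≤n+m k (suc Y)) k≤)))))))) refl
           (subst (λ j → Loop subtract (Within′ den X x num) ((d ∸ num , ones (suc k)) , (x , num)) (x , ones j) R) (+-suc R k) l)

    -- `X` stands for ⌈1/ε⌉, which is not polynomial in the size of the input and is therefore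
    -- measured separately.
    measure : ⟦ In ⟧ × ℕ → ℕ
    measure (w , X) = size In w + X

    bound : ⟦ In ⟧ × ℕ → ℕ
    bound ((x , num , den) , X) = suc (suc (bits den + suc (2 * X)) + suc (size σ x + bits num))

    poly-part : ∀ {g : ⟦ In ⟧ → ℕ} → (∀ w → g w ≤ size In w) → Poly measure (λ z → g (proj₁ z))
    poly-part g≤ = poly-mono (λ z → ≤-trans (g≤ (proj₁ z)) (m≤m+n _ (proj₂ z))) poly-measure

    poly-X : Poly measure proj₂
    poly-X = poly-mono (λ z → m≤n+m (proj₂ z) (size In (proj₁ z))) poly-measure

    poly-2X : Poly measure (λ z → 2 * proj₂ z)
    poly-2X = poly-* {g = λ _ → 2} {proj₂} (poly-const 2) poly-X

    x≤ : ∀ w → size σ (proj₁ w) ≤ size In w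
    x≤ (x , num , den) = ≤-trans (m≤m+n (size σ x) _) (n≤1+n _)

    poly-bound : Poly measure bound
    poly-bound = poly-suc (poly-+ (poly-suc (poly-+ (poly-part den≤) (poly-suc poly-2X))) (poly-suc (poly-+ (poly-part x≤) (poly-part num≤))))
      where
      den≤ : ∀ w → bits (proj₂ (proj₂ w)) ≤ size In w
      den≤ (x , num , den) = ≤-trans (≤-trans (m≤n+m (bits den) (bits num)) (n≤1+n _)) (≤-trans (m≤n+m _ (size σ x)) (n≤1+n _))
      num≤ : ∀ w → bits (proj₁ (proj₂ w)) ≤ size In w
      num≤ (x , num , den) = ≤-trans (≤-trans (m≤m+n (bits num) (bits den)) (n≤1+n _)) (≤-trans (m≤n+m _ (size σ x)) (n≤1+n _))

  module _ {τ f} (p : PT (σ ⊗ list unit) τ f) where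

    private
      rest : ⟦ In ⟧ × ℕ → ℕ
      rest (w , X) = suc (size σ (proj₁ w) + suc (2 * X))

      steps final : ⟦ In ⟧ × ℕ → ℕ
      steps z = suc ((2 + bound z) ^ PT.degree body)
      final z = (2 + rest z) ^ PT.degree p

    opaque
      time : ⟦ In ⟧ × ℕ → ℕ
      time z = suc (suc (timeOf init (proj₁ z) + suc (proj₂ z) * steps z) + final z)

      poly-total : Poly measure time
      poly-total = poly-suc (poly-+ (poly-suc (poly-+ (poly-time init (poly-part (λ _ → ≤-refl)))
          (poly-* {g = λ z → suc (proj₂ z)} {steps} (poly-suc poly-X) (poly-suc (poly-time body poly-bound)))))
        (poly-time p (poly-suc (poly-+ (poly-part x≤) (poly-suc poly-2X)))))

      program′ : Prog In τ
      program′ = (PT.prog init ⨾ iterate (PT.prog body)) ⨾ PT.prog p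

      runs′ : ∀ x num den X → den ≤ X * num → ∃[ R ] den ≤ R * num × (program′ · (x , num , den) ⇓ f (x , ones R) within time ((x , num , den) , X))
      runs′ x num den X den≤ =
        let R , R≤ , den≤R , l = quotient {den} {X} {x} {num} X den 0 den≤ ≤-refl (≤-reflexive (+-identityʳ X))
            a , da , a≤ = PT.runs init (x , num , den)
            c , dc , c≤ = iterate-runs body l
            s , ds , s≤ = PT.runs p (x , ones R)
            dc′ = subst (λ j → iterate (PT.prog body) · ((den , []) , (x , num)) ⇓ (x , ones j) ∣ c) (+-identityʳ R) dc
        in R , den≤R , suc (suc (a + c) + s) , (da ⨾ dc′) ⨾ ds ,
           s≤s (≤-trans (≤-reflexive (+-assoc (suc (a + c)) s _)) (+-mono-≤
             (s≤s (+-mono-≤ (≤-trans (m≤m+n a _) a≤) (≤-trans (≤-trans (m≤m+n c _) c≤) (*-monoˡ-≤ (steps ((x , num , den) , X)) (s≤s R≤)))))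
             (≤-trans s≤ (^-monoˡ-≤ (PT.degree p) (s≤s (s≤s (s≤s (+-monoʳ-≤ (size σ x) (≤-trans (size-units R) (s≤s (*-monoʳ-≤ 2 R≤)))))))))))

      -- The base 3 comes from `2 + m ≤ 3 * m`, valid since sizes are positive.
      coefficient′ degree′ : ℕ
      degree′ = Poly.degree poly-total
      coefficient′ = 3 ^ degree′

      time-≤ : ∀ w X → time (w , X) ≤ coefficient′ * (size In w + X) ^ degree′
      time-≤ w X = begin
        time (w , X)                              ≤⟨ Poly.bounded poly-total (w , X) ⟩
        (2 + m) ^ degree′                         ≤⟨ ^-monoˡ-≤ degree′ (≤-trans (+-monoˡ-≤ m (*-monoʳ-≤ 2 0<m)) (≤-reflexive (triple m))) ⟩
        (3 * m) ^ degree′                         ≡⟨ ^-* 3 m degree′ ⟩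
        coefficient′ * m ^ degree′                ∎
        where
        open ≤-Reasoning
        m : ℕ
        m = size In w + X
        0<m : 1 ≤ m
        0<m = ≤-trans (0<size In w) (m≤m+n _ X)
        triple : ∀ m → 2 * m + m ≡ 3 * m
        triple = solve-∀

-- Rational accuracy

-- A ceiling is the negated floor of the negation, so the quotient to be bounded is a negative one,
-- rounded down.
⌈1/ε⌉-bound : ∀ n d → suc d ≤ ∣ -[1+ d ] ℤ./ +[1+ n ] ∣ * suc n
⌈1/ε⌉-bound n d = ≤-trans (large (ℤ.[n/d]*d≤n -[1+ d ] +[1+ n ])) (≤-reflexive (ℤ.abs-* (-[1+ d ] ℤ./ +[1+ n ]) +[1+ n ]))
  where
  large : ∀ {i} → i ℤ.≤ -[1+ d ] → suc d ≤ ∣ i ∣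
  large (ℤ.-≤- d≤m) = s≤s d≤m

ratio-bound : ∀ (ε : ℚ) .{{_ : Positive ε}} → ↧ₙ ε ≤ ⌈1/ ε ⌉ * ∣ ↥ ε ∣
ratio-bound (mkℚ +[1+ n ] d c) = subst (λ q → suc d ≤ q * suc n) (sym (ℤ.∣-i∣≡∣i∣ (-[1+ d ] ℤ./ +[1+ n ]))) (⌈1/ε⌉-bound n d)

-- For unnormalised rationals the claim is a cross-multiplied inequality between integers, with no
-- common factors to cancel.
fromℕℚ-≤ : ∀ (ε : ℚ) .{{_ : Positive ε}} y z → y * ↧ₙ ε ≤ (↧ₙ ε + ∣ ↥ ε ∣) * z → fromℕℚ y ℚ.≤ (1ℚ ℚ.+ ε) ℚ.* fromℕℚ z
fromℕℚ-≤ ε@(mkℚ +[1+ n ] d c) y z le = ℚ.toℚᵘ-cancel-≤ (begin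
  toℚᵘ (fromℕℚ y)                            ≃⟨ ℚ.toℚᵘ-fromℚᵘ (mkℚᵘ (ℤ.+ y) 0) ⟩
  mkℚᵘ (ℤ.+ y) 0                             ≤⟨ ℚᵘ.*≤* core ⟩
  (1ℚᵘ ℚᵘ.+ toℚᵘ ε) ℚᵘ.* mkℚᵘ (ℤ.+ z) 0      ≃⟨ ℚᵘ.*-cong (ℚ.toℚᵘ-homo-+ 1ℚ ε) (ℚ.toℚᵘ-fromℚᵘ (mkℚᵘ (ℤ.+ z) 0)) ⟨
  toℚᵘ (1ℚ ℚ.+ ε) ℚᵘ.* toℚᵘ (fromℕℚ z)       ≃⟨ ℚ.toℚᵘ-homo-* (1ℚ ℚ.+ ε) (fromℕℚ z) ⟨
  toℚᵘ ((1ℚ ℚ.+ ε) ℚ.* fromℕℚ z)             ∎)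
  where
  open ℚᵘ.≤-Reasoning
  core : ℚᵘ.↥ (mkℚᵘ (ℤ.+ y) 0) ℤ.* ℚᵘ.↧ ((1ℚᵘ ℚᵘ.+ toℚᵘ ε) ℚᵘ.* mkℚᵘ (ℤ.+ z) 0) ℤ.≤ ℚᵘ.↥ ((1ℚᵘ ℚᵘ.+ toℚᵘ ε) ℚᵘ.* mkℚᵘ (ℤ.+ z) 0) ℤ.* ℚᵘ.↧ (mkℚᵘ (ℤ.+ y) 0)
  core = subst₂ ℤ._≤_ (ℤ.pos-* y (suc ((d + 0) * 1)))
    (trans (ℤ.pos-* (suc (d + 0) + suc (n * 1)) z) (sym (ℤ.*-identityʳ _)))
    (ℤ.+≤+ (subst₂ (λ p q → y * suc p ≤ q * z) (sym (trans (*-identityʳ (d + 0)) (+-identityʳ d)))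
      (sym (cong₂ (λ p q → suc p + suc q) (+-identityʳ d) (*-identityʳ n))) le))

module Approximation {cmax : ℕ} (I : BudgetInstance cmax) (ε : ℚ) .{{_ : Positive ε}} where
  open BudgetInstance I
  open Accuracy (ChainTy ⊗ nat)
  open MinimizationProblem (BudgetMakespan cmax) using (Solution; objective)

  private
    G : TaskGraph
    G = taskGraph extendedChain

    P : PT InTy (list (SideTy ⊗ nat)) (solve (slotBound cmax))
    P = pt-solve (slotBound cmax)

    w : ⟦ (ChainTy ⊗ nat) ⊗ (nat ⊗ nat) ⟧
    w = (encodeChain extendedChain , budget) , (∣ ↥ ε ∣ , ↧ₙ ε)

    result : ∃[ R ] ↧ₙ ε ≤ R * ∣ ↥ ε ∣ × (program′ P · w ⇓ solve (slotBound cmax) ((encodeChain extendedChain , budget) , List.replicate R tt) within time P (w , ⌈1/ ε ⌉))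
    result = runs′ P (encodeChain extendedChain , budget) ∣ ↥ ε ∣ (↧ₙ ε) ⌈1/ ε ⌉ (ratio-bound ε)

    R : ℕ
    R = proj₁ result

    R≥ : ↧ₙ ε ≤ R * ∣ ↥ ε ∣
    R≥ = proj₁ (proj₂ result)

    us : List ⊤
    us = List.replicate R tt

    0<us : 0 < length us
    0<us = subst (0 <_) (sym (length-replicate R)) (positive R R≥)
      where
      positive : ∀ R → ↧ₙ ε ≤ R * ∣ ↥ ε ∣ → 0 < R
      positive (suc R) _ = s≤s z≤n

    found : Σ[ y ∈ BudgetSchedule G budget ] encodeSchedule G (BudgetSchedule.schedule y) ≡ solve (slotBound cmax) ((encodeChain extendedChain , budget) , us) ×
      (∀ (z : BudgetSchedule G budget) → ∃[ e ] makespan (BudgetSchedule.schedule y) ≤ makespan (BudgetSchedule.schedule z) + e ×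
                                                 e * length us ≤ makespan (BudgetSchedule.schedule z))
    found = Quality.solution I us 0<us

    accuracy : ∀ {y z e R num den} → y ≤ z + e → e * R ≤ z → den ≤ R * num → y * den ≤ (den + num) * z
    accuracy {y} {z} {e} {R} {num} {den} y≤ e≤ den≤ = begin
      y * den                   ≤⟨ *-monoˡ-≤ den y≤ ⟩
      (z + e) * den             ≡⟨ *-distribʳ-+ den z e ⟩
      z * den + e * den         ≤⟨ +-monoʳ-≤ (z * den) (*-monoʳ-≤ e den≤) ⟩
      z * den + e * (R * num)   ≡⟨ cong (z * den +_) (*-assoc e R num) ⟨
      z * den + e * R * num     ≤⟨ +-monoʳ-≤ (z * den) (*-monoˡ-≤ num e≤) ⟩
      z * den + z * num         ≡⟨ *-distribˡ-+ z den num ⟨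
      z * (den + num)           ≡⟨ *-comm z (den + num) ⟩
      (den + num) * z           ∎
      where open ≤-Reasoning

  schedule′ : BudgetSchedule G budget
  schedule′ = proj₁ found

  computed : program′ P · w ⇓ encodeSchedule G (BudgetSchedule.schedule schedule′)
             within coefficient′ P * (size ((ChainTy ⊗ nat) ⊗ (nat ⊗ nat)) w + ⌈1/ ε ⌉) ^ degree′ P
  computed = within-mono (time-≤ P w ⌈1/ ε ⌉)
    (subst (λ out → program′ P · w ⇓ out within time P (w , ⌈1/ ε ⌉)) (sym (proj₁ (proj₂ found))) (proj₂ (proj₂ result)))

  close : ∀ (z : Solution I) → fromℕℚ (objective I schedule′) ℚ.≤ (1ℚ ℚ.+ ε) ℚ.* fromℕℚ (objective I z)
  close z = fromℕℚ-≤ ε (objective I schedule′) (objective I z)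
    (accuracy (proj₁ (proj₂ near)) (subst (λ r → proj₁ near * r ≤ makespan (BudgetSchedule.schedule z)) (length-replicate R) (proj₂ (proj₂ near))) R≥)
    where
    near : ∃[ e ] makespan (BudgetSchedule.schedule schedule′) ≤ makespan (BudgetSchedule.schedule z) + e ×
                  e * length us ≤ makespan (BudgetSchedule.schedule z)
    near = proj₂ (proj₂ found) z

theorem6 : ∀ (cmax : ℕ) → FPTAS (BudgetMakespan cmax)
theorem6 cmax = record
  { program      = program′ (pt-solve (slotBound cmax))
  ; coefficient  = coefficient′ (pt-solve (slotBound cmax))
  ; degree       = degree′ (pt-solve (slotBound cmax))
  ; approximates = λ I ε → Approximation.schedule′ I ε , Approximation.computed I ε , Approximation.close I ε
  }
  where open Accuracy (ChainTy ⊗ nat)
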